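{- Let $q \geq 4$ be a prime power and $k \geq 1$. Let $Y$ be an independent set of $qK_{2k:k}$ (i.e. a family of $k$-dimensional subspaces of $\mathbb{F}_q^{2k}$ any two of which intersect nontrivially). If $Y$ is not contained in a dictator or in the dual of a dictator, then \[ |Y| < 3 \begin{bmatrix} k \\ 1 \end{bmatrix} \begin{bmatrix} 2k-2 \\ k-2 \end{bmatrix}. \]
   Context: The $q$-Kneser graph $qK_{2k:k}$ has as vertices the $k$-dimensional subspaces of $\mathbb{F}_q^{2k}$, adjacent iff they intersect trivially. The Gaussian binomial coefficient is $\begin{bmatrix} n \\ m \end{bmatrix} = \prod_{i=1}^m \frac{q^{n-i+1}-1}{q^i-1}$ (and $0$ if $m<0$), the number of $m$-dimensional subspaces of $\mathbb{F}_q^n$. A dictator is the set of all $k$-subspaces containing a fixed $1$-dimensional subspace (point); the dual of a dictator is the set of all $k$-subspaces contained in a fixed $(2k-1)$-dimensional subspace (hyperplane). -}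

module Defs where

open import Level using (0ℓ)
open import Data.Nat using (ℕ; zero; suc; _+_; _*_; _^_; _≥_)
open import Data.Integer using (ℤ; +_; -[1+_])
open import Data.Fin using (Fin)
open import Data.Vec using (Vec; []; _∷_; zipWith; map; replicate; foldr)
open import Data.Bool using (Bool; true)
open import Data.Product using (Σ; ∃; _×_)
open import Data.List using (List)
open import Data.List.Relation.Unary.All using (All)
open import Data.List.Relation.Unary.AllPairs using (AllPairs)
open import Data.Nat.Primality using (Prime)
open import Relation.Binary.PropositionalEquality using (_≡_)
open import Relation.Binary.Definitions using (DecidableEquality)
open import Relation.Nullary using (¬_)
open import Algebra.Structures using (IsCommutativeRing)
open import Function.Bundles using (_↔_; _⇔_)

IsPrimePower : ℕ → Set
IsPrimePower q = Σ ℕ λ p → Σ ℕ λ e → Prime p × e ≥ 1 × q ≡ p ^ e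

record FiniteField (q : ℕ) : Set₁ where
  field
    F     : Set
    _≟_   : DecidableEquality F
    0# 1# : F
    _+F_ _*F_ : F → F → F
    -F_   : F → F
    isCommutativeRing : IsCommutativeRing _≡_ _+F_ _*F_ -F_ 0# 1#
    0≢1   : ¬ (0# ≡ 1#)
    inv   : (x : F) → ¬ (x ≡ 0#) → F
    inverse : (x : F) (nz : ¬ (x ≡ 0#)) → x *F inv x nz ≡ 1#
    enum  : Fin q ↔ F

module Geometry {q : ℕ} (𝔽 : FiniteField q) where
  open FiniteField 𝔽

  V : ℕ → Set
  V n = Vec F n

  zeroV : ∀ {n} → V n
  zeroV = replicate _ 0#

  _⊕_ : ∀ {n} → V n → V n → V n
  _⊕_ = zipWith _+F_

  _·_ : ∀ {n} → F → V n → V n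
  c · v = map (c *F_) v

  lincomb : ∀ {n d} → Vec F d → Vec (V n) d → V n
  lincomb [] [] = zeroV
  lincomb (c ∷ cs) (b ∷ bs) = (c · b) ⊕ lincomb cs bs

  LinIndep : ∀ {n d} → Vec (V n) d → Set
  LinIndep {d = d} b = ∀ (c : Vec F d) → lincomb c b ≡ zeroV → c ≡ replicate d 0#

  Subset : ℕ → Set
  Subset n = V n → Bool

  _∈_ : ∀ {n} → V n → Subset n → Set
  v ∈ U = U v ≡ true

  IsSubspaceOfDim : ∀ {n} → Subset n → ℕ → Set
  IsSubspaceOfDim {n} U d =
    Σ (Vec (V n) d) λ b → LinIndep b ×
      (∀ (v : V n) → (v ∈ U) ⇔ (Σ (Vec F d) λ c → lincomb c b ≡ v))

  SameSet : ∀ {n} → Subset n → Subset n → Set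
  SameSet U W = ∀ v → U v ≡ W v

  MeetNontrivially : ∀ {n} → Subset n → Subset n → Set
  MeetNontrivially {n} U W = Σ (V n) λ v → ¬ (v ≡ zeroV) × v ∈ U × v ∈ W

  _⊆_ : ∀ {n} → Subset n → Subset n → Set
  U ⊆ W = ∀ v → v ∈ U → v ∈ W

  InDictator : ∀ {n} → List (Subset n) → Set
  InDictator {n} Y = Σ (V n) λ p → ¬ (p ≡ zeroV) × All (λ U → p ∈ U) Y

  InDualDictator : ∀ {n} → List (Subset n) → Set
  InDualDictator {n} Y =
    Σ (Subset n) λ H → IsSubspaceOfDim H (n Data.Nat.∸ 1) × All (λ U → U ⊆ H) Y

-- Gaussian binomial coefficient [n choose m]_q via the q-Pascal recursion
-- [n+1, m+1] = [n, m] + q^(m+1) [n, m+1].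
gauss : ℕ → ℕ → ℕ → ℕ
gauss q n zero = 1
gauss q zero (suc m) = 0
gauss q (suc n) (suc m) = gauss q n m + q ^ suc m * gauss q n (suc m)

gaussℤ : ℕ → ℕ → ℤ → ℕ
gaussℤ q n (+ m) = gauss q n m
gaussℤ q n -[1+ m ] = 0

{-# OPTIONS --safe #-}
-- Suppose |Y| ≥ 3 [k 1] [2k-2 k-2]. Counting members through a point p that meet two members avoiding p
-- shows that every point, and dually every hyperplane, lies on O(|Y| / q) members of Y.
-- Let δ(v) be the number of members through v, and w its centred multiple. Every member A of Y meets all the others,
-- so the sum of w over A is large, and the δ-weighted second moment of the sums of w over random k-tuples of
-- vectors is bounded below in terms of |Y|. Expanding this moment leaves only Σ w², Σ δ w² and the correlation
-- Σ w(u) w(v) w(u+v); a Parseval identity turns the latter into a sum of cubes over hyperplanes, so the point and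
-- hyperplane bounds control everything. For q ≥ 4 the two estimates contradict each other.
module Submission where

open import Defs

-- Any two members of a dictator meet as well, so an estimate that sees only pairwise intersections
-- cannot go below the size of a dictator, which is about (q - 1) / 3 times the claimed bound. Hence
-- the weight δ in the second moment: it lets the largest values of δ and, by duality, of its
-- transform enter the estimate. The assumed lower bound on |Y| is spent three times: to find two
-- members in general position relative to a point, to trade one of the two factors |Y| of the lower
-- estimate against a Gaussian coefficient, and in the final comparison. To leading order in X =
-- q^(k-2) that comparison is the sign of 2q³ - 5q² - 8q + 2, which is 18 at q = 4 and -13 at q = 3.
-- The improved point bound counts members through planes, hence k ≥ 3; for k = 1 and k = 2
-- incidence geometry excludes such a family altogether. Everything stays in ℤ without division:
-- means and ratios are multiplied out by q - 1, q^k + 1 and powers of N = q^(2k), and dimensions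
-- appear as cardinalities.

module Proof where
  open import Data.Nat as ℕ using (ℕ; zero; suc)
  import Data.Nat.Properties as ℕ
  open import Data.Integer hiding (suc; _≟_)
  open import Data.Integer.Properties hiding (_≟_)
  open import Data.Integer.Tactic.RingSolver using (solve-∀)
  open import Data.Bool as Bool using (Bool; true; false; not; _∧_; _∨_)
  open import Data.Fin as Fin using (Fin)
  import Data.Fin.Properties as Fin
  open import Data.List using (List; []; _∷_; _++_; length; map; concatMap; filter)
  open import Data.List.Membership.Propositional using (_∈_; find; lose)
  open import Data.List.Membership.Propositional.Properties using (∈-map⁺; ∈-map⁻)
  open import Data.List.Relation.Unary.All as All using (All; []; _∷_)
  import Data.List.Relation.Unary.All.Properties as All
  open import Data.List.Relation.Unary.AllPairs using (AllPairs; []; _∷_)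
  import Data.List.Relation.Unary.AllPairs.Properties as AllPairs
  open import Data.List.Relation.Unary.Any as Any using (here; there)
  open import Data.Vec as Vec using (Vec; []; _∷_; replicate)
  import Data.Vec.Properties as Vec
  open import Data.Product using (Σ; ∃; _×_; _,_; proj₁; proj₂)
  open import Data.Sum using (_⊎_; inj₁; inj₂)
  open import Data.Empty using (⊥; ⊥-elim)
  open import Function using (_∘_; _⇔_; _↔_; Equivalence; Inverse; mk⇔)
  open import Relation.Nullary using (¬_; Dec; yes; no; does)
  open import Relation.Nullary.Decidable using (dec-true; dec-false)
  open import Relation.Binary.Definitions using (DecidableEquality)
  open import Relation.Binary.PropositionalEquality
  open import Algebra.Bundles using (CommutativeRing)
  import Algebra.Properties.Ring as RingProperties

  private variable
    𝒜 ℬ : Set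

  -- Ordered integer arithmetic and Boolean indicators.

  0≤+ : ∀ {a b} → 0ℤ ≤ a → 0ℤ ≤ b → 0ℤ ≤ a + b
  0≤+ p q = +-mono-≤ p q

  0≤* : ∀ {a b} → 0ℤ ≤ a → 0ℤ ≤ b → 0ℤ ≤ a * b
  0≤* {a} {b} p q = subst (_≤ a * b) (*-zeroʳ a) (*-monoˡ-≤-nonNeg a {{nonNegative p}} q)

  0<* : ∀ {a b} → 0ℤ < a → 0ℤ < b → 0ℤ < a * b
  0<* {a} {b} p q = subst (_< a * b) (*-zeroʳ a) (*-monoˡ-<-pos a {{positive p}} q)

  ≤-gap : ∀ {a b} d → 0ℤ ≤ d → b ≡ a + d → a ≤ b
  ≤-gap {a} d p refl = subst (_≤ a + d) (+-identityʳ a) (+-monoʳ-≤ a p)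

  *-monoˡ : ∀ c {a b} → 0ℤ ≤ c → a ≤ b → c * a ≤ c * b
  *-monoˡ c p = *-monoˡ-≤-nonNeg c {{nonNegative p}}

  *-monoʳ : ∀ c {a b} → 0ℤ ≤ c → a ≤ b → a * c ≤ b * c
  *-monoʳ c p = *-monoʳ-≤-nonNeg c {{nonNegative p}}

  *-cancelˡ : ∀ c {a b} → 0ℤ < c → c * a ≤ c * b → a ≤ b
  *-cancelˡ c {a} {b} p = *-cancelˡ-≤-pos a b c {{positive p}}

  *-cancelˡ-≡′ : ∀ c {a b} → 0ℤ < c → c * a ≡ c * b → a ≡ b
  *-cancelˡ-≡′ c p e = ≤-antisym (*-cancelˡ c p (≤-reflexive e)) (*-cancelˡ c p (≤-reflexive (sym e)))

  0≤∙² : ∀ a → 0ℤ ≤ a * a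
  0≤∙² (+ n)    = 0≤* {+ n} {+ n} (+≤+ ℕ.z≤n) (+≤+ ℕ.z≤n)
  0≤∙² -[1+ n ] = +≤+ ℕ.z≤n

  ι : Bool → ℤ
  ι true  = 1ℤ
  ι false = 0ℤ

  ι-not : ∀ b → ι (not b) ≡ 1ℤ - ι b
  ι-not true  = refl
  ι-not false = refl

  0≤ι : ∀ b → 0ℤ ≤ ι b
  0≤ι true  = +≤+ ℕ.z≤n
  0≤ι false = +≤+ ℕ.z≤n

  ι-∧ : ∀ a b → ι (a ∧ b) ≡ ι a * ι b
  ι-∧ true  b = sym (*-identityˡ (ι b))
  ι-∧ false b = refl

  ι-mono : ∀ {a b} → (a ≡ true → b ≡ true) → ι a ≤ ι b
  ι-mono {true}  {b} f rewrite f refl = ≤-refl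
  ι-mono {false} {b} f = 0≤ι b

  bool-ext : ∀ {a b} → (a ≡ true → b ≡ true) → (b ≡ true → a ≡ true) → a ≡ b
  bool-ext {true}          f g = sym (f refl)
  bool-ext {false} {true}  f g = g refl
  bool-ext {false} {false} f g = refl

  contra : ∀ {b} {X : Set} → b ≡ true → b ≡ false → X
  contra refl ()

  not⁻ : ∀ {b} → not b ≡ true → b ≡ false
  not⁻ {false} _ = refl

  not⁺ : ∀ {b} → b ≡ false → not b ≡ true
  not⁺ refl = refl

  not-false : ∀ {b} → ¬ (b ≡ false) → b ≡ true
  not-false {true}  f = refl
  not-false {false} f = ⊥-elim (f refl)

  not-true : ∀ {b} → ¬ (b ≡ true) → b ≡ false
  not-true {true}  f = ⊥-elim (f refl)
  not-true {false} f = refl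

  holds : ∀ {p} {P : Set p} (d : Dec P) → does d ≡ true → P
  holds (yes p) _ = p

  ⟦_⟧ : ∀ {p} {P : Set p} → Dec P → ℤ
  ⟦ d ⟧ = ι (does d)

  ⟦⟧-yes : ∀ {p} {P : Set p} (d : Dec P) → P → ⟦ d ⟧ ≡ 1ℤ
  ⟦⟧-yes d p = cong ι (dec-true d p)

  ⟦⟧-no : ∀ {p} {P : Set p} (d : Dec P) → ¬ P → ⟦ d ⟧ ≡ 0ℤ
  ⟦⟧-no d p = cong ι (dec-false d p)

  does-cong : ∀ {p r} {P : Set p} {R : Set r} (d : Dec P) (e : Dec R) → (P → R) → (R → P) → does d ≡ does e
  does-cong d e f g = bool-ext (dec-true e ∘ f ∘ holds d) (dec-true d ∘ g ∘ holds e)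

  ⟦⟧-cong : ∀ {p r} {P : Set p} {R : Set r} (d : Dec P) (e : Dec R) → (P → R) → (R → P) → ⟦ d ⟧ ≡ ⟦ e ⟧
  ⟦⟧-cong d e f g = cong ι (does-cong d e f g)

  -- Finite sums over lists.

  ∑ : List 𝒜 → (𝒜 → ℤ) → ℤ
  ∑ []       f = 0ℤ
  ∑ (x ∷ xs) f = f x + ∑ xs f

  ∑-cong : ∀ (xs : List 𝒜) {f g} → (∀ x → f x ≡ g x) → ∑ xs f ≡ ∑ xs g
  ∑-cong []       e = refl
  ∑-cong (x ∷ xs) e = cong₂ _+_ (e x) (∑-cong xs e)

  ∑-congᴬ : ∀ {xs : List 𝒜} {f g} → All (λ x → f x ≡ g x) xs → ∑ xs f ≡ ∑ xs g
  ∑-congᴬ []       = refl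
  ∑-congᴬ (e ∷ es) = cong₂ _+_ e (∑-congᴬ es)

  ∑-0 : ∀ (xs : List 𝒜) → ∑ xs (λ _ → 0ℤ) ≡ 0ℤ
  ∑-0 []       = refl
  ∑-0 (x ∷ xs) = trans (+-identityˡ _) (∑-0 xs)

  ∑-+ : ∀ (xs : List 𝒜) f g → ∑ xs (λ x → f x + g x) ≡ ∑ xs f + ∑ xs g
  ∑-+ []       f g = refl
  ∑-+ (x ∷ xs) f g = trans (cong (_+_ (f x + g x)) (∑-+ xs f g)) (swap (f x) (g x) (∑ xs f) (∑ xs g))
    where swap : ∀ a b c d → a + b + (c + d) ≡ a + c + (b + d)
          swap = solve-∀

  ∑-*ˡ : ∀ (xs : List 𝒜) c f → ∑ xs (λ x → c * f x) ≡ c * ∑ xs f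
  ∑-*ˡ []       c f = sym (*-zeroʳ c)
  ∑-*ˡ (x ∷ xs) c f = trans (cong (_+_ (c * f x)) (∑-*ˡ xs c f)) (sym (*-distribˡ-+ c (f x) (∑ xs f)))

  ∑-*ʳ : ∀ (xs : List 𝒜) c f → ∑ xs (λ x → f x * c) ≡ ∑ xs f * c
  ∑-*ʳ xs c f = trans (∑-cong xs (λ x → *-comm (f x) c)) (trans (∑-*ˡ xs c f) (*-comm c _))

  ∑-- : ∀ (xs : List 𝒜) f g → ∑ xs (λ x → f x - g x) ≡ ∑ xs f - ∑ xs g
  ∑-- []       f g = refl
  ∑-- (x ∷ xs) f g = trans (cong (_+_ (f x - g x)) (∑-- xs f g)) (swap (f x) (g x) (∑ xs f) (∑ xs g))
    where swap : ∀ a b c d → a - b + (c - d) ≡ a + c - (b + d)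
          swap = solve-∀

  ∑-swap : ∀ (xs : List 𝒜) (ys : List ℬ) (f : 𝒜 → ℬ → ℤ) → ∑ xs (λ x → ∑ ys (f x)) ≡ ∑ ys (λ y → ∑ xs (λ x → f x y))
  ∑-swap []       ys f = sym (∑-0 ys)
  ∑-swap (x ∷ xs) ys f = trans (cong (_+_ (∑ ys (f x))) (∑-swap xs ys f)) (sym (∑-+ ys (f x) _))

  ∑-mono : ∀ (xs : List 𝒜) {f g} → (∀ x → f x ≤ g x) → ∑ xs f ≤ ∑ xs g
  ∑-mono []       p = ≤-refl
  ∑-mono (x ∷ xs) p = +-mono-≤ (p x) (∑-mono xs p)

  ∑-monoᴬ : ∀ {xs : List 𝒜} {f g} → All (λ x → f x ≤ g x) xs → ∑ xs f ≤ ∑ xs g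
  ∑-monoᴬ []       = ≤-refl
  ∑-monoᴬ (p ∷ ps) = +-mono-≤ p (∑-monoᴬ ps)

  ∑-nonneg : ∀ (xs : List 𝒜) {f} → (∀ x → 0ℤ ≤ f x) → 0ℤ ≤ ∑ xs f
  ∑-nonneg []       p = ≤-refl
  ∑-nonneg (x ∷ xs) p = 0≤+ (p x) (∑-nonneg xs p)

  ∑-const : ∀ (xs : List 𝒜) c → ∑ xs (λ _ → c) ≡ + length xs * c
  ∑-const []       c = refl
  ∑-const (x ∷ xs) c = trans (cong (_+_ c) (∑-const xs c)) (sym (suc-* (+ length xs) c))

  ∑-++ : ∀ (xs ys : List 𝒜) f → ∑ (xs ++ ys) f ≡ ∑ xs f + ∑ ys f
  ∑-++ []       ys f = sym (+-identityˡ _)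
  ∑-++ (x ∷ xs) ys f = trans (cong (_+_ (f x)) (∑-++ xs ys f)) (sym (+-assoc (f x) _ _))

  ∑-map : ∀ (g : 𝒜 → ℬ) (xs : List 𝒜) f → ∑ (map g xs) f ≡ ∑ xs (f ∘ g)
  ∑-map g []       f = refl
  ∑-map g (x ∷ xs) f = cong (_+_ (f (g x))) (∑-map g xs f)

  ∑-concatMap : ∀ (g : 𝒜 → List ℬ) (xs : List 𝒜) f → ∑ (concatMap g xs) f ≡ ∑ xs (λ x → ∑ (g x) f)
  ∑-concatMap g []       f = refl
  ∑-concatMap g (x ∷ xs) f = trans (∑-++ (g x) (concatMap g xs) f) (cong (_+_ (∑ (g x) f)) (∑-concatMap g xs f))

  ∑-term≤ : ∀ {xs : List 𝒜} {f x} → (∀ x → 0ℤ ≤ f x) → x ∈ xs → f x ≤ ∑ xs f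
  ∑-term≤ {xs = y ∷ xs} {f} p (here refl) = ≤-gap (∑ xs f) (∑-nonneg xs p) refl
  ∑-term≤ {xs = y ∷ xs} {f} {x} p (there i) = ≤-trans (∑-term≤ p i) (≤-gap (f y) (p y) (+-comm (f y) _))

  module _ {P : 𝒜 → Set} (P? : ∀ x → Dec (P x)) where
    ∑-filter : ∀ xs f → ∑ (filter P? xs) f ≡ ∑ xs (λ x → ⟦ P? x ⟧ * f x)
    ∑-filter []       f = refl
    ∑-filter (x ∷ xs) f with P? x
    ... | yes _ = cong₂ _+_ (sym (*-identityˡ (f x))) (∑-filter xs f)
    ... | no  _ = trans (∑-filter xs f) (sym (+-identityˡ _))

  -- Enumerated types and sums over them.

  record Enum (𝒜 : Set) : Set where
    field
      _≟_   : DecidableEquality 𝒜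
      elems : List 𝒜
      -- Completeness and absence of repetitions in one equation, stated as an indicator sum because
      -- that is the form in which sums are collapsed.
      once  : ∀ y → ∑ elems (λ x → ⟦ x ≟ y ⟧) ≡ 1ℤ

    ∑∑ : (𝒜 → ℤ) → ℤ
    ∑∑ = ∑ elems

    ∈-elems : ∀ y → y ∈ elems
    ∈-elems y with Any.any? (_≟_ y) elems
    ... | yes i = i
    ... | no ¬i with trans (sym (once y)) (absent elems ¬i)
      where
      absent : ∀ xs → ¬ (y ∈ xs) → ∑ xs (λ x → ⟦ x ≟ y ⟧) ≡ 0ℤ
      absent []       _ = refl
      absent (x ∷ xs) n = cong₂ _+_ (⟦⟧-no (x ≟ y) (λ e → n (here (sym e)))) (absent xs (λ i → n (there i)))
    ...   | ()

    sift : ∀ y f → ∑∑ (λ x → ⟦ x ≟ y ⟧ * f x) ≡ f y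
    sift y f = trans (∑-cong elems pt) (trans (∑-*ʳ elems (f y) _) (trans (cong (_* f y) (once y)) (*-identityˡ _)))
      where
      pt : ∀ x → ⟦ x ≟ y ⟧ * f x ≡ ⟦ x ≟ y ⟧ * f y
      pt x with x ≟ y
      ... | yes refl = refl
      ... | no _     = refl

    -- Both sides are the sum of `f y` over the graph of `g`; since `g` is a bijection, the
    -- indicator of the graph collapses in either coordinate.
    reindex : ∀ (g h : 𝒜 → 𝒜) → (∀ x → g (h x) ≡ x) → (∀ x → h (g x) ≡ x) → ∀ f → ∑∑ (f ∘ g) ≡ ∑∑ f
    reindex g h gh hg f = begin
      ∑∑ (λ x → f (g x)) ≡⟨ ∑-cong elems (λ x → sym (sift (g x) f)) ⟩
      ∑∑ (λ x → ∑∑ (λ y → ⟦ y ≟ g x ⟧ * f y)) ≡⟨ ∑-swap elems elems (λ x y → ⟦ y ≟ g x ⟧ * f y) ⟩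
      ∑∑ (λ y → ∑∑ (λ x → ⟦ y ≟ g x ⟧ * f y)) ≡⟨ ∑-cong elems (λ y → ∑-*ʳ elems (f y) _) ⟩
      ∑∑ (λ y → ∑∑ (λ x → ⟦ y ≟ g x ⟧) * f y) ≡⟨ ∑-cong elems (λ y → cong (_* f y) (hit y)) ⟩
      ∑∑ (λ y → 1ℤ * f y) ≡⟨ ∑-cong elems (λ y → *-identityˡ (f y)) ⟩
      ∑∑ f                                           ∎
      where
      open ≡-Reasoning
      hit : ∀ y → ∑∑ (λ x → ⟦ y ≟ g x ⟧) ≡ 1ℤ
      hit y = trans (∑-cong elems (λ x → ⟦⟧-cong (y ≟ g x) (x ≟ h y)
                (λ e → trans (sym (hg x)) (cong h (sym e))) (λ e → trans (sym (gh y)) (cong g (sym e))))) (once (h y))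

    anyᵇ : (𝒜 → Bool) → Bool
    anyᵇ P = does (Any.any? (λ x → P x Bool.≟ true) elems)

    allᵇ : (𝒜 → Bool) → Bool
    allᵇ P = does (All.all? (λ x → P x Bool.≟ true) elems)

    anyᵇ⁻ : ∀ P → anyᵇ P ≡ true → ∃ λ x → P x ≡ true
    anyᵇ⁻ P e with find (holds (Any.any? (λ x → P x Bool.≟ true) elems) e)
    ... | x , _ , p = x , p

    anyᵇ⁺ : ∀ P x → P x ≡ true → anyᵇ P ≡ true
    anyᵇ⁺ P x p = dec-true (Any.any? (λ x → P x Bool.≟ true) elems) (lose (∈-elems x) p)

    allᵇ⁻ : ∀ P → allᵇ P ≡ true → ∀ x → P x ≡ true
    allᵇ⁻ P e x = All.lookup (holds (All.all? (λ x → P x Bool.≟ true) elems) e) (∈-elems x)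

    allᵇ⁺ : ∀ P → (∀ x → P x ≡ true) → allᵇ P ≡ true
    allᵇ⁺ P p = dec-true (All.all? (λ x → P x Bool.≟ true) elems) (All.tabulate (λ {x} _ → p x))

  finEnum : ∀ n → Enum (Fin n)
  finEnum n = record { _≟_ = Fin._≟_ ; elems = fins n ; once = once n }
    where
    fins : ∀ n → List (Fin n)
    fins zero    = []
    fins (suc n) = Fin.zero ∷ map Fin.suc (fins n)
    once : ∀ n (y : Fin n) → ∑ (fins n) (λ x → ⟦ x Fin.≟ y ⟧) ≡ 1ℤ
    once (suc n) Fin.zero = cong (_+_ 1ℤ) (trans (∑-map Fin.suc (fins n) _)
      (trans (∑-cong (fins n) (λ x → ⟦⟧-no (Fin.suc x Fin.≟ Fin.zero) λ ())) (∑-0 (fins n))))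
    once (suc n) (Fin.suc y) = trans (+-identityˡ _) (trans (∑-map Fin.suc (fins n) _)
      (trans (∑-cong (fins n) (λ x → ⟦⟧-cong (Fin.suc x Fin.≟ Fin.suc y) (x Fin.≟ y) Fin.suc-injective (cong Fin.suc))) (once n y)))

  ∑-fin : ∀ n → Enum.∑∑ (finEnum n) (λ _ → 1ℤ) ≡ + n
  ∑-fin zero    = refl
  ∑-fin (suc n) = cong (_+_ 1ℤ) (trans (∑-map Fin.suc (Enum.elems (finEnum n)) _) (∑-fin n))

  module _ (E : Enum 𝒜) (_≟ᴮ_ : DecidableEquality ℬ) (bij : 𝒜 ↔ ℬ) where
    open Enum E
    open Inverse bij

    ↔-enum : Enum ℬ
    ↔-enum = record { _≟_ = _≟ᴮ_ ; elems = map to elems ; once = λ y → trans (∑-map to elems _)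
      (trans (∑-cong elems (λ x → ⟦⟧-cong (to x ≟ᴮ y) (x ≟ from y)
        (λ e → trans (sym (strictlyInverseʳ x)) (cong from e)) (λ e → trans (cong to e) (strictlyInverseˡ y)))) (once (from y))) }

  module _ (E : Enum 𝒜) where
    open Enum E

    vecs : ∀ n → List (Vec 𝒜 n)
    vecs zero    = [] ∷ []
    vecs (suc n) = concatMap (λ x → map (x ∷_) (vecs n)) elems

    ∑-vecs : ∀ n f → ∑ (vecs (suc n)) f ≡ ∑ elems (λ x → ∑ (vecs n) (λ v → f (x ∷ v)))
    ∑-vecs n f = trans (∑-concatMap _ elems f) (∑-cong elems (λ x → ∑-map (x ∷_) (vecs n) f))

    vecEnum : ∀ n → Enum (Vec 𝒜 n)
    vecEnum n = record { _≟_ = Vec.≡-dec _≟_ ; elems = vecs n ; once = once′ n }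
      where
      open ≡-Reasoning
      once′ : ∀ n y → ∑ (vecs n) (λ x → ⟦ Vec.≡-dec _≟_ x y ⟧) ≡ 1ℤ
      once′ zero []         = refl
      once′ (suc n) (y ∷ v) = begin
        ∑ (vecs (suc n)) (λ x → ⟦ Vec.≡-dec _≟_ x (y ∷ v) ⟧) ≡⟨ ∑-vecs n _ ⟩
        ∑ elems (λ x → ∑ (vecs n) (λ u → ⟦ Vec.≡-dec _≟_ (x ∷ u) (y ∷ v) ⟧)) ≡⟨ ∑-cong elems (λ x → ∑-cong (vecs n) (pt x)) ⟩
        ∑ elems (λ x → ∑ (vecs n) (λ u → ⟦ x ≟ y ⟧ * ⟦ Vec.≡-dec _≟_ u v ⟧)) ≡⟨ ∑-cong elems (λ x → ∑-*ˡ (vecs n) ⟦ x ≟ y ⟧ _) ⟩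
        ∑ elems (λ x → ⟦ x ≟ y ⟧ * ∑ (vecs n) (λ u → ⟦ Vec.≡-dec _≟_ u v ⟧)) ≡⟨ sift y (λ _ → ∑ (vecs n) (λ u → ⟦ Vec.≡-dec _≟_ u v ⟧)) ⟩
        ∑ (vecs n) (λ u → ⟦ Vec.≡-dec _≟_ u v ⟧) ≡⟨ once′ n v ⟩
        1ℤ                                                                           ∎
        where
        pt : ∀ x u → ⟦ Vec.≡-dec _≟_ (x ∷ u) (y ∷ v) ⟧ ≡ ⟦ x ≟ y ⟧ * ⟦ Vec.≡-dec _≟_ u v ⟧
        pt x u with x ≟ y | Vec.≡-dec _≟_ u v
        ... | yes refl | yes refl = refl
        ... | yes refl | no _     = refl
        ... | no _     | _        = refl

    ∑-vec : ∀ n → ∑ (vecs n) (λ _ → 1ℤ) ≡ ∑∑ (λ _ → 1ℤ) ^ n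
    ∑-vec zero    = refl
    ∑-vec (suc n) = trans (∑-vecs n _) (trans (∑-cong elems (λ x → trans (∑-vec n) (sym (*-identityˡ _)))) (∑-*ʳ elems _ _))

  -- Vector arithmetic and the standard bilinear form over a finite field.

  module Space {q : ℕ} (𝔽 : FiniteField q) where
    open FiniteField 𝔽 renaming (_≟_ to _≟F_)
    open Geometry 𝔽 using (V; zeroV; _⊕_; _·_)

    R : CommutativeRing _ _
    R = record { isCommutativeRing = isCommutativeRing }
    open CommutativeRing R public using () renaming
      ( +-assoc to +F-assoc; +-comm to +F-comm; +-identityˡ to +F-idˡ; +-identityʳ to +F-idʳ
      ; -‿inverseˡ to -F-inverseˡ; -‿inverseʳ to -F-inverseʳ; *-assoc to *F-assoc; *-comm to *F-comm
      ; *-identityˡ to *F-idˡ; *-identityʳ to *F-idʳ; distribˡ to F-distribˡ; distribʳ to F-distribʳ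
      ; zeroˡ to F-zeroˡ; zeroʳ to F-zeroʳ)
    open RingProperties (CommutativeRing.ring R) public using () renaming
      (-‿involutive to -F-involutive; -0#≈0# to -F-0)

    -1F : F
    -1F = -F 1#

    -1F≢0 : ¬ -1F ≡ 0#
    -1F≢0 e = 0≢1 (trans (sym (trans (cong -F_ e) -F-0)) (-F-involutive 1#))

    ⊕-assoc : ∀ {n} (u v w : V n) → (u ⊕ v) ⊕ w ≡ u ⊕ (v ⊕ w)
    ⊕-assoc = Vec.zipWith-assoc +F-assoc

    ⊕-comm : ∀ {n} (u v : V n) → u ⊕ v ≡ v ⊕ u
    ⊕-comm = Vec.zipWith-comm +F-comm

    ⊕-idˡ : ∀ {n} (v : V n) → zeroV ⊕ v ≡ v
    ⊕-idˡ = Vec.zipWith-identityˡ +F-idˡ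

    ⊕-idʳ : ∀ {n} (v : V n) → v ⊕ zeroV ≡ v
    ⊕-idʳ = Vec.zipWith-identityʳ +F-idʳ

    ·-assoc : ∀ {n} a b (v : V n) → a · (b · v) ≡ (a *F b) · v
    ·-assoc a b []      = refl
    ·-assoc a b (x ∷ v) = cong₂ _∷_ (sym (*F-assoc a b x)) (·-assoc a b v)

    ·-distribˡ : ∀ {n} a (u v : V n) → a · (u ⊕ v) ≡ (a · u) ⊕ (a · v)
    ·-distribˡ a []      []      = refl
    ·-distribˡ a (x ∷ u) (y ∷ v) = cong₂ _∷_ (F-distribˡ a x y) (·-distribˡ a u v)

    ·-distribʳ : ∀ {n} a b (v : V n) → (a +F b) · v ≡ (a · v) ⊕ (b · v)
    ·-distribʳ a b []      = refl
    ·-distribʳ a b (x ∷ v) = cong₂ _∷_ (F-distribʳ x a b) (·-distribʳ a b v)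

    ·-id : ∀ {n} (v : V n) → 1# · v ≡ v
    ·-id []      = refl
    ·-id (x ∷ v) = cong₂ _∷_ (*F-idˡ x) (·-id v)

    ·-zeroˡ : ∀ {n} (v : V n) → 0# · v ≡ zeroV
    ·-zeroˡ []      = refl
    ·-zeroˡ (x ∷ v) = cong₂ _∷_ (F-zeroˡ x) (·-zeroˡ v)

    ·-zeroʳ : ∀ {n} a → a · zeroV {n} ≡ zeroV
    ·-zeroʳ {zero}  a = refl
    ·-zeroʳ {suc n} a = cong₂ _∷_ (F-zeroʳ a) (·-zeroʳ a)

    infix 30 ⊖_
    -- As a scalar multiple, negation is covered by closure of subspaces under scaling and by
    -- homogeneity of functions.
    ⊖_ : ∀ {n} → V n → V n
    ⊖ v = -1F · v

    ⊖-inverseʳ : ∀ {n} (v : V n) → v ⊕ ⊖ v ≡ zeroV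
    ⊖-inverseʳ v = trans (cong (_⊕ ⊖ v) (sym (·-id v))) (trans (sym (·-distribʳ 1# -1F v)) (trans (cong (_· v) (-F-inverseʳ 1#)) (·-zeroˡ v)))

    ⊖-inverseˡ : ∀ {n} (v : V n) → ⊖ v ⊕ v ≡ zeroV
    ⊖-inverseˡ v = trans (⊕-comm (⊖ v) v) (⊖-inverseʳ v)

    ⊕⊖-cancel : ∀ {n} (u v : V n) → (u ⊕ v) ⊕ ⊖ v ≡ u
    ⊕⊖-cancel u v = trans (⊕-assoc u v (⊖ v)) (trans (cong (u ⊕_) (⊖-inverseʳ v)) (⊕-idʳ u))

    ⊖⊕-cancel : ∀ {n} (u v : V n) → (u ⊕ ⊖ v) ⊕ v ≡ u
    ⊖⊕-cancel u v = trans (⊕-assoc u (⊖ v) v) (trans (cong (u ⊕_) (⊖-inverseˡ v)) (⊕-idʳ u))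

    -F·-cancel : ∀ {n} c (u v : V n) → (u ⊕ (c · v)) ⊕ ((-F c) · v) ≡ u
    -F·-cancel c u v = trans (⊕-assoc u _ _) (trans (cong (u ⊕_) (trans (sym (·-distribʳ c (-F c) v))
      (trans (cong (_· v) (-F-inverseʳ c)) (·-zeroˡ v)))) (⊕-idʳ u))

    inv-cancelˡ : ∀ {n} c (nz : ¬ c ≡ 0#) (v : V n) → inv c nz · (c · v) ≡ v
    inv-cancelˡ c nz v = trans (·-assoc _ c v) (trans (cong (_· v) (trans (*F-comm _ c) (inverse c nz))) (·-id v))

    inv-cancelʳ : ∀ {n} c (nz : ¬ c ≡ 0#) (v : V n) → c · (inv c nz · v) ≡ v
    inv-cancelʳ c nz v = trans (·-assoc c _ v) (trans (cong (_· v) (inverse c nz)) (·-id v))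

    infix 25 ⟪_,_⟫
    ⟪_,_⟫ : ∀ {n} → V n → V n → F
    ⟪ []    , []    ⟫ = 0#
    ⟪ x ∷ u , y ∷ v ⟫ = (x *F y) +F ⟪ u , v ⟫

    ⟪⟫-sym : ∀ {n} (u v : V n) → ⟪ u , v ⟫ ≡ ⟪ v , u ⟫
    ⟪⟫-sym []      []      = refl
    ⟪⟫-sym (x ∷ u) (y ∷ v) = cong₂ _+F_ (*F-comm x y) (⟪⟫-sym u v)

    +F-interchange : ∀ a b c d → (a +F b) +F (c +F d) ≡ (a +F c) +F (b +F d)
    +F-interchange a b c d = trans (+F-assoc a b _) (trans (cong (a +F_) (trans (sym (+F-assoc b c d))
      (trans (cong (_+F d) (+F-comm b c)) (+F-assoc c b d)))) (sym (+F-assoc a c _)))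

    ⟪⟫-⊕ : ∀ {n} (a u v : V n) → ⟪ a , u ⊕ v ⟫ ≡ ⟪ a , u ⟫ +F ⟪ a , v ⟫
    ⟪⟫-⊕ []      []      []      = sym (+F-idˡ 0#)
    ⟪⟫-⊕ (z ∷ a) (x ∷ u) (y ∷ v) = trans (cong₂ _+F_ (F-distribˡ z x y) (⟪⟫-⊕ a u v)) (+F-interchange _ _ _ _)

    ⟪⟫-· : ∀ {n} (a : V n) c u → ⟪ a , c · u ⟫ ≡ c *F ⟪ a , u ⟫
    ⟪⟫-· []      c []      = sym (F-zeroʳ c)
    ⟪⟫-· (z ∷ a) c (x ∷ u) = trans (cong₂ _+F_ (trans (sym (*F-assoc z c x)) (trans (cong (_*F x) (*F-comm z c)) (*F-assoc c z x))) (⟪⟫-· a c u))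
      (sym (F-distribˡ c _ _))

    ⟪⟫-0ˡ : ∀ {n} (u : V n) → ⟪ zeroV , u ⟫ ≡ 0#
    ⟪⟫-0ˡ []      = refl
    ⟪⟫-0ˡ (x ∷ u) = trans (cong₂ _+F_ (F-zeroˡ x) (⟪⟫-0ˡ u)) (+F-idˡ 0#)

    ⟪⟫-0ʳ : ∀ {n} (u : V n) → ⟪ u , zeroV ⟫ ≡ 0#
    ⟪⟫-0ʳ u = trans (⟪⟫-sym u zeroV) (⟪⟫-0ˡ u)

    ⟪⟫-nondegenerate : ∀ {n} (a : V n) → (∀ u → ⟪ a , u ⟫ ≡ 0#) → a ≡ zeroV
    ⟪⟫-nondegenerate []      h = refl
    ⟪⟫-nondegenerate (x ∷ a) h = cong₂ _∷_
      (trans (sym (trans (cong₂ _+F_ (*F-idʳ x) (⟪⟫-0ʳ a)) (+F-idʳ x))) (h (1# ∷ zeroV)))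
      (⟪⟫-nondegenerate a (λ u → trans (sym (trans (cong (_+F ⟪ a , u ⟫) (F-zeroʳ x)) (+F-idˡ _))) (h (0# ∷ u))))

    fieldEnum : Enum F
    fieldEnum = ↔-enum (finEnum q) _≟F_ enum

    ∑-field : Enum.∑∑ fieldEnum (λ _ → 1ℤ) ≡ + q
    ∑-field = trans (∑-map (Inverse.to enum) (Enum.elems (finEnum q)) _) (∑-fin q)

  -- Subspaces as Boolean predicates, their cardinalities and bases.

  module Subspaces {q : ℕ} (𝔽 : FiniteField q) (4≤q : + 4 ≤ + q) (n : ℕ) where
    open FiniteField 𝔽 renaming (_≟_ to _≟F_)
    open Geometry 𝔽 using (V; zeroV; _⊕_; _·_; lincomb; LinIndep; IsSubspaceOfDim)
    open Space 𝔽
    module F∑ = Enum fieldEnum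
    module V∑ = Enum (vecEnum fieldEnum n)
    open F∑ public using () renaming (elems to fs)
    open V∑ public using () renaming (elems to vs; _≟_ to _≟V_)

    ∑F : (F → ℤ) → ℤ
    ∑F = ∑ fs

    ∑V : (V n → ℤ) → ℤ
    ∑V = ∑ vs

    q′ N : ℤ
    q′ = + q
    N = q′ ^ n

    0<q : 0ℤ < q′
    0<q = <-≤-trans (+<+ (ℕ.s≤s ℕ.z≤n)) 4≤q

    0≤q : 0ℤ ≤ q′
    0≤q = <⇒≤ 0<q

    0<q-1 : 0ℤ < q′ - 1ℤ
    0<q-1 = <-≤-trans (+<+ (ℕ.s≤s ℕ.z≤n)) (+-monoˡ-≤ -1ℤ 4≤q)

    0<q^ : ∀ j → 0ℤ < q′ ^ j
    0<q^ zero    = +<+ (ℕ.s≤s ℕ.z≤n)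
    0<q^ (suc j) = 0<* 0<q (0<q^ j)

    0<N : 0ℤ < N
    0<N = 0<q^ n

    0<N^ : ∀ m → 0ℤ < N ^ m
    0<N^ zero    = +<+ (ℕ.s≤s ℕ.z≤n)
    0<N^ (suc m) = 0<* 0<N (0<N^ m)

    1≤q^ : ∀ j → 1ℤ ≤ q′ ^ j
    1≤q^ j = i<j⇒suc[i]≤j (0<q^ j)

    q^i<q^i+1+j : ∀ i j → q′ ^ i < q′ ^ (i ℕ.+ suc j)
    q^i<q^i+1+j i j rewrite ^-distribˡ-+-* q′ i (suc j) =
      subst (_< q′ ^ i * q′ ^ suc j) (*-identityʳ (q′ ^ i)) (*-monoˡ-<-pos (q′ ^ i) {{positive (0<q^ i)}} 1<q^1+j)
      where
      1<q^1+j : 1ℤ < q′ ^ suc j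
      1<q^1+j = <-≤-trans (<-≤-trans (+<+ (ℕ.s≤s (ℕ.s≤s ℕ.z≤n))) 4≤q)
        (subst (_≤ q′ ^ suc j) (*-identityʳ q′) (*-monoˡ q′ 0≤q (1≤q^ j)))

    0<q^-1 : ∀ j → 0ℤ < q′ ^ suc j - 1ℤ
    0<q^-1 j = subst (_< q′ ^ suc j - 1ℤ) (+-inverseʳ 1ℤ) (+-monoˡ-< -1ℤ (q^i<q^i+1+j 0 j))

    ∑F-1 : ∑F (λ _ → 1ℤ) ≡ q′
    ∑F-1 = ∑-field

    ∑F-const : ∀ c → ∑F (λ _ → c) ≡ q′ * c
    ∑F-const c = trans (∑-cong fs (λ _ → sym (*-identityˡ c))) (trans (∑-*ʳ fs c _) (cong (_* c) ∑F-1))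

    ∑V-1 : ∑V (λ _ → 1ℤ) ≡ N
    ∑V-1 = trans (∑-vec fieldEnum n) (cong (_^ n) ∑F-1)

    ∑V-const : ∀ c → ∑V (λ _ → c) ≡ N * c
    ∑V-const c = trans (∑-cong vs (λ _ → sym (*-identityˡ c))) (trans (∑-*ʳ vs c _) (cong (_* c) ∑V-1))

    ∑V-shift : ∀ v f → ∑V (λ x → f (x ⊕ v)) ≡ ∑V f
    ∑V-shift v f = V∑.reindex (_⊕ v) (_⊕ ⊖ v) (λ x → ⊖⊕-cancel x v) (λ x → ⊕⊖-cancel x v) f

    ∑V-scale : ∀ c → ¬ c ≡ 0# → ∀ f → ∑V (λ x → f (c · x)) ≡ ∑V f
    ∑V-scale c nz f = V∑.reindex (c ·_) (inv c nz ·_) (inv-cancelʳ c nz) (inv-cancelˡ c nz) f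

    ∑F-shift : ∀ d (f : F → ℤ) → ∑F (λ c → f (c +F d)) ≡ ∑F f
    ∑F-shift d f = F∑.reindex (_+F d) (_+F (-F d))
      (λ x → trans (+F-assoc x _ d) (trans (cong (x +F_) (-F-inverseˡ d)) (+F-idʳ x)))
      (λ x → trans (+F-assoc x d _) (trans (cong (x +F_) (-F-inverseʳ d)) (+F-idʳ x))) f

    ∑F-neg : ∀ (f : F → ℤ) → ∑F (λ c → f (-F c)) ≡ ∑F f
    ∑F-neg f = F∑.reindex (λ c → -F c) (λ c → -F c) -F-involutive -F-involutive f

    search : ∀ (P : V n → Bool) → (∃ λ x → P x ≡ true) ⊎ (∀ x → P x ≡ false)
    search P with V∑.anyᵇ P in eq
    ... | true  = inj₁ (V∑.anyᵇ⁻ P eq)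
    ... | false = inj₂ (λ x → not-true (λ p → contra (V∑.anyᵇ⁺ P x p) eq))

    Sub : Set
    Sub = V n → Bool

    infix 4 _⊑_
    _⊑_ : Sub → Sub → Set
    S ⊑ T = ∀ x → S x ≡ true → T x ≡ true

    ∣_∣ₛ : Sub → ℤ
    ∣ S ∣ₛ = ∑V (λ x → ι (S x))

    ⊑-size : ∀ {S T} → S ⊑ T → ∣ S ∣ₛ ≤ ∣ T ∣ₛ
    ⊑-size p = ∑-mono vs (λ x → ι-mono (p x))

    -- The difference of the two indicators is nonnegative with total at most 0, while a vector of
    -- `T` outside `S` would already contribute 1. This does the work of comparing dimensions.
    ⊑-full : ∀ {S T} → S ⊑ T → ∣ T ∣ₛ ≤ ∣ S ∣ₛ → T ⊑ S
    ⊑-full {S} {T} p le x t with S x in eq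
    ... | true  = refl
    ... | false = ⊥-elim (≤⇒≯ 1≤0 (+<+ (ℕ.s≤s ℕ.z≤n)))
      where
      d : V n → ℤ
      d x = ι (T x) - ι (S x)
      0≤d : ∀ x → 0ℤ ≤ d x
      0≤d x = i≤j⇒0≤j-i (ι-mono (p x))
      1≤0 : 1ℤ ≤ 0ℤ
      1≤0 = ≤-trans (≤-reflexive (sym (cong₂ (λ a b → ι a - ι b) t eq)))
        (≤-trans (∑-term≤ {f = d} 0≤d (V∑.∈-elems x))
          (≤-trans (≤-reflexive (∑-- vs _ _)) (i≤j⇒i-j≤0 le)))

    ⊑-proper : ∀ {S T} → ∣ S ∣ₛ < ∣ T ∣ₛ → ∃ λ x → T x ≡ true × S x ≡ false
    ⊑-proper {S} {T} lt with search (λ x → T x ∧ not (S x))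
    ... | inj₁ (x , e) = x , split (T x) (S x) e
      where split : ∀ a b → a ∧ not b ≡ true → a ≡ true × b ≡ false
            split true false _ = refl , refl
    ... | inj₂ h = ⊥-elim (<⇒≱ lt (⊑-size (λ x t → split (T x) (S x) (h x) t)))
      where split : ∀ a b → a ∧ not b ≡ false → a ≡ true → b ≡ true
            split true true _ _ = refl

    -- Being a subspace is kept apart from having a basis: a dimension d is recorded only as the
    -- cardinality q^d, which sums can compute.
    record Lin (S : Sub) : Set where
      field
        0∈ : S zeroV ≡ true
        ⊕∈ : ∀ {u v} → S u ≡ true → S v ≡ true → S (u ⊕ v) ≡ true
        ·∈ : ∀ c {u} → S u ≡ true → S (c · u) ≡ true

      ⊖∈ : ∀ {u v} → S u ≡ true → S v ≡ true → S (u ⊕ ⊖ v) ≡ true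
      ⊖∈ p q = ⊕∈ p (·∈ -1F q)

      ·∈⁻ : ∀ c → ¬ c ≡ 0# → ∀ {u} → S (c · u) ≡ true → S u ≡ true
      ·∈⁻ c nz {u} p = subst (λ x → S x ≡ true) (inv-cancelˡ c nz u) (·∈ (inv c nz) p)

      ⊕∈⁻ : ∀ {u v} → S v ≡ true → S (u ⊕ v) ≡ true → S u ≡ true
      ⊕∈⁻ {u} {v} q p = subst (λ x → S x ≡ true) (⊕⊖-cancel u v) (⊖∈ p q)

      shift : ∀ u {v} → S v ≡ true → S (u ⊕ v) ≡ S u
      shift u q = bool-ext (⊕∈⁻ q) (λ p → ⊕∈ p q)

      scale : ∀ c → ¬ c ≡ 0# → ∀ u → S (c · u) ≡ S u
      scale c nz u = bool-ext (·∈⁻ c nz) (·∈ c)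

    open Lin

    𝟘 𝟙 : Sub
    𝟘 x = does (x ≟V zeroV)
    𝟙 x = true

    𝟘-lin : Lin 𝟘
    𝟘-lin = record
      { 0∈ = dec-true (zeroV ≟V zeroV) refl
      ; ⊕∈ = λ {u} {v} p r → dec-true ((u ⊕ v) ≟V zeroV)
          (trans (cong₂ _⊕_ (holds (u ≟V zeroV) p) (holds (v ≟V zeroV) r)) (⊕-idˡ zeroV))
      ; ·∈ = λ c {u} p → dec-true ((c · u) ≟V zeroV) (trans (cong (c ·_) (holds (u ≟V zeroV) p)) (·-zeroʳ c)) }

    𝟙-lin : Lin 𝟙
    𝟙-lin = record { 0∈ = refl ; ⊕∈ = λ _ _ → refl ; ·∈ = λ _ _ → refl }

    ∣𝟘∣ : ∣ 𝟘 ∣ₛ ≡ 1ℤ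
    ∣𝟘∣ = V∑.once zeroV

    𝟘⊑ : ∀ {S} → Lin S → 𝟘 ⊑ S
    𝟘⊑ {S} L x e = subst (λ v → S v ≡ true) (sym (holds (x ≟V zeroV) e)) (0∈ L)

    infixl 7 _⊓ₛ_
    _⊓ₛ_ : Sub → Sub → Sub
    (S ⊓ₛ T) x = S x ∧ T x

    ∧⁺ : ∀ {a b} → a ≡ true → b ≡ true → a ∧ b ≡ true
    ∧⁺ refl refl = refl

    ∧⁻ˡ : ∀ {a b} → a ∧ b ≡ true → a ≡ true
    ∧⁻ˡ {true} _ = refl

    ∧⁻ʳ : ∀ {a b} → a ∧ b ≡ true → b ≡ true
    ∧⁻ʳ {true} e = e

    ⊓-lin : ∀ {S T} → Lin S → Lin T → Lin (S ⊓ₛ T)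
    ⊓-lin {S} {T} L M = record
      { 0∈ = ∧⁺ (0∈ L) (0∈ M)
      ; ⊕∈ = λ {u} {v} p r → ∧⁺ (⊕∈ L (∧⁻ˡ p) (∧⁻ˡ r)) (⊕∈ M (∧⁻ʳ {S u} p) (∧⁻ʳ {S v} r))
      ; ·∈ = λ c {u} p → ∧⁺ (·∈ L c (∧⁻ˡ p)) (·∈ M c (∧⁻ʳ {S u} p)) }

    infixl 6 _+⟨_⟩
    -- The span of `S` and `v`: a vector belongs to it when some multiple of `v` moves it into `S`.
    -- The sign of the multiple is immaterial, since all scalars are searched.
    _+⟨_⟩ : Sub → V n → Sub
    (S +⟨ v ⟩) x = F∑.anyᵇ (λ c → S (x ⊕ (c · v)))

    module _ {S : Sub} {v : V n} where
      +⟨⟩⁻ : ∀ {x} → (S +⟨ v ⟩) x ≡ true → ∃ λ c → S (x ⊕ (c · v)) ≡ true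
      +⟨⟩⁻ {x} = F∑.anyᵇ⁻ (λ c → S (x ⊕ (c · v)))

      +⟨⟩⁺ : ∀ {x} c → S (x ⊕ (c · v)) ≡ true → (S +⟨ v ⟩) x ≡ true
      +⟨⟩⁺ {x} = F∑.anyᵇ⁺ (λ c → S (x ⊕ (c · v)))

      ⊑+⟨⟩ : S ⊑ S +⟨ v ⟩
      ⊑+⟨⟩ x p = +⟨⟩⁺ 0# (subst (λ y → S y ≡ true) (sym (trans (cong (x ⊕_) (·-zeroˡ v)) (⊕-idʳ x))) p)

      +⟨⟩-least : ∀ {T} → Lin T → S ⊑ T → T v ≡ true → S +⟨ v ⟩ ⊑ T
      +⟨⟩-least {T} M p t x e with +⟨⟩⁻ e
      ... | c , r = ⊕∈⁻ M (·∈ M c t) (p _ r)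

      module _ (L : Lin S) where
        ∈+⟨⟩ : (S +⟨ v ⟩) v ≡ true
        ∈+⟨⟩ = +⟨⟩⁺ -1F (subst (λ y → S y ≡ true) (sym (⊖-inverseʳ v)) (0∈ L))

        +⟨⟩-lin : Lin (S +⟨ v ⟩)
        +⟨⟩-lin = record
          { 0∈ = ⊑+⟨⟩ zeroV (0∈ L)
          ; ⊕∈ = λ {x} {y} p r → add x y (+⟨⟩⁻ p) (+⟨⟩⁻ r)
          ; ·∈ = λ a {x} p → mul a x (+⟨⟩⁻ p) }
          where
          add : ∀ x y → ∃ (λ c → S (x ⊕ (c · v)) ≡ true) → ∃ (λ c → S (y ⊕ (c · v)) ≡ true) → (S +⟨ v ⟩) (x ⊕ y) ≡ true
          add x y (c , p) (d , r) = +⟨⟩⁺ (c +F d) (subst (λ z → S z ≡ true) eq (⊕∈ L p r))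
            where
            open ≡-Reasoning
            eq : (x ⊕ (c · v)) ⊕ (y ⊕ (d · v)) ≡ (x ⊕ y) ⊕ ((c +F d) · v)
            eq = begin
              (x ⊕ (c · v)) ⊕ (y ⊕ (d · v)) ≡⟨ ⊕-assoc x _ _ ⟩
              x ⊕ ((c · v) ⊕ (y ⊕ (d · v))) ≡⟨ cong (x ⊕_) (sym (⊕-assoc _ y _)) ⟩
              x ⊕ (((c · v) ⊕ y) ⊕ (d · v)) ≡⟨ cong (λ z → x ⊕ (z ⊕ (d · v))) (⊕-comm _ y) ⟩
              x ⊕ ((y ⊕ (c · v)) ⊕ (d · v)) ≡⟨ cong (x ⊕_) (⊕-assoc y _ _) ⟩
              x ⊕ (y ⊕ ((c · v) ⊕ (d · v))) ≡⟨ sym (⊕-assoc x y _) ⟩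
              (x ⊕ y) ⊕ ((c · v) ⊕ (d · v)) ≡⟨ cong ((x ⊕ y) ⊕_) (sym (·-distribʳ c d v)) ⟩
              (x ⊕ y) ⊕ ((c +F d) · v)        ∎
          mul : ∀ a x → ∃ (λ c → S (x ⊕ (c · v)) ≡ true) → (S +⟨ v ⟩) (a · x) ≡ true
          mul a x (c , p) = +⟨⟩⁺ (a *F c) (subst (λ z → S z ≡ true)
            (trans (·-distribˡ a x (c · v)) (cong ((a · x) ⊕_) (·-assoc a c v))) (·∈ L a p))

        module _ (v∉ : S v ≡ false) where
          unique : ∀ {x c d} → S (x ⊕ (c · v)) ≡ true → S (x ⊕ (d · v)) ≡ true → c ≡ d
          unique {x} {c} {d} p r with (c +F (-F d)) ≟F 0#
          ... | yes e = trans (sym (+F-idʳ c)) (trans (cong (c +F_) (sym (-F-inverseˡ d)))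
                          (trans (sym (+F-assoc c _ d)) (trans (cong (_+F d) e) (+F-idˡ d))))
          ... | no ne = contra (·∈⁻ L _ ne (⊕∈⁻ L r (subst (λ z → S z ≡ true) eq p))) v∉
            where
            open ≡-Reasoning
            eq : x ⊕ (c · v) ≡ ((c +F (-F d)) · v) ⊕ (x ⊕ (d · v))
            eq = begin
              x ⊕ (c · v) ≡⟨ cong (λ z → x ⊕ (z · v)) (sym (trans (+F-assoc c _ d) (trans (cong (c +F_) (-F-inverseˡ d)) (+F-idʳ c)))) ⟩
              x ⊕ (((c +F (-F d)) +F d) · v) ≡⟨ cong (x ⊕_) (·-distribʳ _ d v) ⟩
              x ⊕ (((c +F (-F d)) · v) ⊕ (d · v)) ≡⟨ sym (⊕-assoc x _ _) ⟩
              (x ⊕ ((c +F (-F d)) · v)) ⊕ (d · v) ≡⟨ cong (_⊕ (d · v)) (⊕-comm x _) ⟩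
              (((c +F (-F d)) · v) ⊕ x) ⊕ (d · v) ≡⟨ ⊕-assoc _ x _ ⟩
              ((c +F (-F d)) · v) ⊕ (x ⊕ (d · v))         ∎

          -- For `v` outside `S` the scalar that moves `x` into `S` is unique, so the existential
          -- becomes an exact sum. The size of a span and sums over it reduce to translations
          -- through this identity.
          +⟨⟩-ι : ∀ x → ι ((S +⟨ v ⟩) x) ≡ ∑F (λ c → ι (S (x ⊕ (c · v))))
          +⟨⟩-ι x with (S +⟨ v ⟩) x in eq
          ... | true with +⟨⟩⁻ eq
          ...   | c , p = sym (trans (∑-cong fs pt) (F∑.once c))
            where
            pt : ∀ d → ι (S (x ⊕ (d · v))) ≡ ⟦ d ≟F c ⟧
            pt d = cong ι (bool-ext (λ r → dec-true (d ≟F c) (unique r p))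
                     (λ e → subst (λ z → S (x ⊕ (z · v)) ≡ true) (sym (holds (d ≟F c) e)) p))
          +⟨⟩-ι x | false = sym (trans (∑-cong fs pt) (∑-0 fs))
            where
            pt : ∀ d → ι (S (x ⊕ (d · v))) ≡ 0ℤ
            pt d = cong ι (not-true (λ r → contra (+⟨⟩⁺ d r) eq))

          ∣+⟨⟩∣ : ∣ S +⟨ v ⟩ ∣ₛ ≡ q′ * ∣ S ∣ₛ
          ∣+⟨⟩∣ = begin
            ∑V (λ x → ι ((S +⟨ v ⟩) x)) ≡⟨ ∑-cong vs +⟨⟩-ι ⟩
            ∑V (λ x → ∑F (λ c → ι (S (x ⊕ (c · v))))) ≡⟨ ∑-swap vs fs (λ x c → ι (S (x ⊕ (c · v)))) ⟩
            ∑F (λ c → ∑V (λ x → ι (S (x ⊕ (c · v))))) ≡⟨ ∑-cong fs (λ c → ∑V-shift (c · v) (λ x → ι (S x))) ⟩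
            ∑F (λ c → ∣ S ∣ₛ) ≡⟨ ∑F-const ∣ S ∣ₛ ⟩
            q′ * ∣ S ∣ₛ                                  ∎
            where open ≡-Reasoning

    ⟨_⟩ : V n → Sub
    ⟨ v ⟩ = 𝟘 +⟨ v ⟩

    𝟘-∌ : ∀ {v} → ¬ v ≡ zeroV → 𝟘 v ≡ false
    𝟘-∌ {v} = dec-false (v ≟V zeroV)

    ∣⟨⟩∣ : ∀ {v} → ¬ v ≡ zeroV → ∣ ⟨ v ⟩ ∣ₛ ≡ q′ ^ 1
    ∣⟨⟩∣ nz = trans (∣+⟨⟩∣ 𝟘-lin (𝟘-∌ nz)) (cong (q′ *_) ∣𝟘∣)

    ⟨⟩⊑ : ∀ {v T} → Lin T → T v ≡ true → ⟨ v ⟩ ⊑ T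
    ⟨⟩⊑ M = +⟨⟩-least M (𝟘⊑ M)

    ⟨⟩-lin : ∀ {v} → Lin ⟨ v ⟩
    ⟨⟩-lin = +⟨⟩-lin 𝟘-lin

    -- Already the span of `S` and `z` lies in `T`, and it has q times as many vectors as `S`.
    proper-size : ∀ {S T} → Lin S → Lin T → S ⊑ T → ∀ {z} → T z ≡ true → S z ≡ false → q′ * ∣ S ∣ₛ ≤ ∣ T ∣ₛ
    proper-size L M p t f = subst (_≤ _) (∣+⟨⟩∣ L f) (⊑-size (+⟨⟩-least M p t))

    lincomb-0 : ∀ {d} (b : Vec (V n) d) → lincomb (replicate d 0#) b ≡ zeroV
    lincomb-0 []      = refl
    lincomb-0 (v ∷ b) = trans (cong₂ _⊕_ (·-zeroˡ v) (lincomb-0 b)) (⊕-idˡ zeroV)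

    ⊕-interchange : ∀ (a b c d : V n) → (a ⊕ b) ⊕ (c ⊕ d) ≡ (a ⊕ c) ⊕ (b ⊕ d)
    ⊕-interchange a b c d = trans (⊕-assoc a b _) (trans (cong (a ⊕_) (trans (sym (⊕-assoc b c d))
      (trans (cong (_⊕ d) (⊕-comm b c)) (⊕-assoc c b d)))) (sym (⊕-assoc a c _)))

    lincomb-⊕ : ∀ {d} (c e : V d) (b : Vec (V n) d) → lincomb (c ⊕ e) b ≡ lincomb c b ⊕ lincomb e b
    lincomb-⊕ []      []      []      = sym (⊕-idˡ zeroV)
    lincomb-⊕ (x ∷ c) (y ∷ e) (v ∷ b) = trans (cong₂ _⊕_ (·-distribʳ x y v) (lincomb-⊕ c e b)) (⊕-interchange _ _ _ _)

    lincomb-· : ∀ {d} a (c : V d) (b : Vec (V n) d) → lincomb (a · c) b ≡ a · lincomb c b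
    lincomb-· a []      []      = sym (·-zeroʳ a)
    lincomb-· a (x ∷ c) (v ∷ b) = trans (cong₂ _⊕_ (sym (·-assoc a x v)) (lincomb-· a c b)) (sym (·-distribˡ a _ _))

    module _ {d : ℕ} {U : Sub} (basis : IsSubspaceOfDim U d) where
      private
        b : Vec (V n) d
        b = proj₁ basis
        indep : LinIndep b
        indep = proj₁ (proj₂ basis)
        mem : ∀ x → (U x ≡ true) ⇔ Σ (V d) λ c → lincomb c b ≡ x
        mem = proj₂ (proj₂ basis)
        module D∑ = Enum (vecEnum fieldEnum d)
        toU : ∀ c → U (lincomb c b) ≡ true
        toU c = Equivalence.from (mem _) (c , refl)
        fromU : ∀ {x} → U x ≡ true → Σ (V d) λ c → lincomb c b ≡ x
        fromU {x} = Equivalence.to (mem x)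

      dim⇒lin : Lin U
      dim⇒lin = record
        { 0∈ = subst (λ x → U x ≡ true) (lincomb-0 b) (toU (replicate d 0#))
        ; ⊕∈ = λ p r → add (fromU p) (fromU r)
        ; ·∈ = λ a p → mul a (fromU p) }
        where
        add : ∀ {u v} → Σ (V d) (λ c → lincomb c b ≡ u) → Σ (V d) (λ c → lincomb c b ≡ v) → U (u ⊕ v) ≡ true
        add (c , refl) (e , refl) = subst (λ x → U x ≡ true) (lincomb-⊕ c e b) (toU (c ⊕ e))
        mul : ∀ a {u} → Σ (V d) (λ c → lincomb c b ≡ u) → U (a · u) ≡ true
        mul a (c , refl) = subst (λ x → U x ≡ true) (lincomb-· a c b) (toU (a · c))

      private
        inj : ∀ c e → lincomb c b ≡ lincomb e b → c ≡ e
        inj c e eq = trans (sym (⊖⊕-cancel c e)) (trans (cong (_⊕ e) (indep (c ⊕ ⊖ e)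
          (trans (lincomb-⊕ c (⊖ e) b) (trans (cong₂ _⊕_ eq (lincomb-· -1F e b)) (⊖-inverseʳ _))))) (⊕-idˡ e))

        count : ∀ x → ι (U x) ≡ ∑ D∑.elems (λ c → ⟦ lincomb c b ≟V x ⟧)
        count x with U x in eq
        ... | true with fromU eq
        ...   | c , refl = sym (trans (∑-cong D∑.elems (λ e →
                  ⟦⟧-cong (lincomb e b ≟V lincomb c b) (e D∑.≟ c) (inj e c) (cong (λ z → lincomb z b)))) (D∑.once c))
        count x | false = sym (trans (∑-cong D∑.elems (λ e →
                  ⟦⟧-no (lincomb e b ≟V x) (λ h → contra (trans (cong U (sym h)) (toU e)) eq))) (∑-0 D∑.elems))

      dim⇒size : ∣ U ∣ₛ ≡ q′ ^ d
      dim⇒size = begin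
        ∑V (λ x → ι (U x)) ≡⟨ ∑-cong vs count ⟩
        ∑V (λ x → ∑ D∑.elems (λ c → ⟦ lincomb c b ≟V x ⟧)) ≡⟨ ∑-swap vs D∑.elems (λ x c → ⟦ lincomb c b ≟V x ⟧) ⟩
        ∑ D∑.elems (λ c → ∑V (λ x → ⟦ lincomb c b ≟V x ⟧)) ≡⟨ ∑-cong D∑.elems (λ c → trans (∑-cong vs (λ x → ⟦⟧-cong (lincomb c b ≟V x) (x ≟V lincomb c b) sym sym)) (V∑.once _)) ⟩
        ∑ D∑.elems (λ c → 1ℤ) ≡⟨ trans (∑-vec fieldEnum d) (cong (_^ d) ∑F-1) ⟩
        q′ ^ d                                                          ∎
        where open ≡-Reasoning

    module _ {S : Sub} (L : Lin S) {d : ℕ} (size : ∣ S ∣ₛ ≡ q′ ^ d) where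
      private
        -- Greedy extension of a basis steered by cardinality: as long as i < d, the span of i
        -- vectors has q^i elements, fewer than `S`, so a vector of `S` is missing from it. The
        -- number j of vectors still to be found decreases.
        grow : ∀ i j → i ℕ.+ j ≡ d → (T : Sub) → Lin T → T ⊑ S → ∣ T ∣ₛ ≡ q′ ^ i →
               (b : Vec (V n) i) → LinIndep b → (∀ x → (T x ≡ true) ⇔ Σ (V i) λ c → lincomb c b ≡ x) →
               IsSubspaceOfDim S d
        grow i zero e T M sub sz b indep mem with trans (sym (ℕ.+-identityʳ i)) e
        ... | refl = b , indep , λ x → mk⇔ (λ p → Equivalence.to (mem x) (S⊑T x p)) (λ p → sub x (Equivalence.from (mem x) p))
          where
          S⊑T : S ⊑ T
          S⊑T = ⊑-full sub (≤-reflexive (trans size (sym sz)))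
        grow i (suc j) e T M sub sz b indep mem with ⊑-proper {T} {S} (subst₂ _<_ (sym sz) (trans (cong (q′ ^_) e) (sym size)) (q^i<q^i+1+j i j))
        ... | v , v∈S , v∉T = grow (suc i) j (trans (sym (ℕ.+-suc i j)) e) (T +⟨ v ⟩) (+⟨⟩-lin M)
                (+⟨⟩-least L sub v∈S) (trans (∣+⟨⟩∣ M v∉T) (cong (q′ *_) sz)) (v ∷ b) indep′ mem′
          where
          toT : ∀ c → T (lincomb c b) ≡ true
          toT c = Equivalence.from (mem _) (c , refl)
          indep′ : LinIndep (v ∷ b)
          indep′ (c ∷ cs) h with c ≟F 0#
          ... | yes refl = cong (0# ∷_) (indep cs (trans (sym (trans (cong (_⊕ lincomb cs b) (·-zeroˡ v)) (⊕-idˡ _))) h))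
          ... | no nz = contra (·∈⁻ M c nz (⊕∈⁻ M (toT cs) (subst (λ z → T z ≡ true) (sym h) (0∈ M)))) v∉T
          mem′ : ∀ x → ((T +⟨ v ⟩) x ≡ true) ⇔ Σ (V (suc i)) λ c → lincomb c (v ∷ b) ≡ x
          mem′ x = mk⇔ to′ from′
            where
            to′ : (T +⟨ v ⟩) x ≡ true → Σ (V (suc i)) λ c → lincomb c (v ∷ b) ≡ x
            to′ p with +⟨⟩⁻ {T} {v} p
            ... | c , r with Equivalence.to (mem _) r
            ...   | cs , h = ((-F c) ∷ cs) , trans (cong (((-F c) · v) ⊕_) h) (trans (⊕-comm _ _) (-F·-cancel c x v))
            from′ : Σ (V (suc i)) (λ c → lincomb c (v ∷ b) ≡ x) → (T +⟨ v ⟩) x ≡ true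
            from′ ((c ∷ cs) , refl) = ⊕∈ (+⟨⟩-lin M) (·∈ (+⟨⟩-lin M) c (∈+⟨⟩ M)) (⊑+⟨⟩ {T} {v} _ (toT cs))

      lin⇒dim : IsSubspaceOfDim S d
      lin⇒dim = grow 0 d refl 𝟘 𝟘-lin (𝟘⊑ L) ∣𝟘∣ [] (λ { [] _ → refl })
        (λ x → mk⇔ (λ p → [] , sym (holds (x ≟V zeroV) p)) (λ { ([] , h) → dec-true (x ≟V zeroV) (sym h) }))

  -- Orthogonal complements and an integer-valued Fourier transform.

  module Transform {q : ℕ} (𝔽 : FiniteField q) (4≤q : + 4 ≤ + q) (n : ℕ) where
    open FiniteField 𝔽 renaming (_≟_ to _≟F_)
    open Geometry 𝔽 using (V; zeroV; _⊕_; _·_)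
    open Space 𝔽
    open Subspaces 𝔽 4≤q n
    open Lin

    infix 50 _ᗮ
    _ᗮ : Sub → Sub
    (S ᗮ) a = V∑.allᵇ (λ v → not (S v) ∨ does (⟪ a , v ⟫ ≟F 0#))

    ᗮ⁻ : ∀ S a {v} → (S ᗮ) a ≡ true → S v ≡ true → ⟪ a , v ⟫ ≡ 0#
    ᗮ⁻ S a {v} p s = holds (⟪ a , v ⟫ ≟F 0#) (strip s (V∑.allᵇ⁻ _ p v))
      where strip : ∀ {x y} → x ≡ true → not x ∨ y ≡ true → y ≡ true
            strip refl e = e

    ᗮ⁺ : ∀ S a → (∀ v → S v ≡ true → ⟪ a , v ⟫ ≡ 0#) → (S ᗮ) a ≡ true
    ᗮ⁺ S a h = V∑.allᵇ⁺ _ pt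
      where pt : ∀ v → not (S v) ∨ does (⟪ a , v ⟫ ≟F 0#) ≡ true
            pt v with S v in eq
            ... | true  = dec-true (⟪ a , v ⟫ ≟F 0#) (h v eq)
            ... | false = refl

    ᗮ-lin : ∀ {S} → Lin (S ᗮ)
    ᗮ-lin {S} = record
      { 0∈ = ᗮ⁺ S zeroV (λ v _ → ⟪⟫-0ˡ v)
      ; ⊕∈ = λ {a} {b} p r → ᗮ⁺ S (a ⊕ b) (λ v s → trans (⟪⟫-sym (a ⊕ b) v) (trans (⟪⟫-⊕ v a b)
          (trans (cong₂ _+F_ (trans (⟪⟫-sym v a) (ᗮ⁻ S a p s)) (trans (⟪⟫-sym v b) (ᗮ⁻ S b r s))) (+F-idˡ 0#))))
      ; ·∈ = λ c {a} p → ᗮ⁺ S (c · a) (λ v s → trans (⟪⟫-sym (c · a) v) (trans (⟪⟫-· v c a)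
          (trans (cong (c *F_) (trans (⟪⟫-sym v a) (ᗮ⁻ S a p s))) (F-zeroʳ c)))) }

    𝟙ᗮ : ∀ a → (𝟙 ᗮ) a ≡ 𝟘 a
    𝟙ᗮ a = bool-ext (λ p → dec-true (a ≟V zeroV) (⟪⟫-nondegenerate a (λ u → ᗮ⁻ 𝟙 a p refl)))
                    (λ e → ᗮ⁺ 𝟙 a (λ v _ → subst (λ b → ⟪ b , v ⟫ ≡ 0#) (sym (holds (a ≟V zeroV) e)) (⟪⟫-0ˡ v)))

    𝟘ᗮ : ∀ a → (𝟘 ᗮ) a ≡ true
    𝟘ᗮ a = ᗮ⁺ 𝟘 a (λ v e → subst (λ z → ⟪ a , z ⟫ ≡ 0#) (sym (holds (v ≟V zeroV) e)) (⟪⟫-0ʳ a))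

    -- χ c is the sum of ψ(λ c) over λ ≠ 0, for any nontrivial additive character ψ of F;
    -- on functions constant along punctured lines it replaces ψ itself.
    χ : F → ℤ
    χ c = q′ * ⟦ c ≟F 0# ⟧ - 1ℤ

    χ-0 : χ 0# ≡ q′ - 1ℤ
    χ-0 = trans (cong (λ z → q′ * z - 1ℤ) (⟦⟧-yes (0# ≟F 0#) refl)) (cong (_- 1ℤ) (*-identityʳ q′))

    ∑F-χ : ∑F χ ≡ 0ℤ
    ∑F-χ = begin
      ∑F (λ c → q′ * ⟦ c ≟F 0# ⟧ - 1ℤ) ≡⟨ ∑-- fs _ _ ⟩
      ∑F (λ c → q′ * ⟦ c ≟F 0# ⟧) - ∑F (λ _ → 1ℤ) ≡⟨ cong₂ _-_ (trans (∑-*ˡ fs q′ _) (cong (q′ *_) (F∑.once 0#))) ∑F-1 ⟩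
      q′ * 1ℤ - q′ ≡⟨ ring q′ ⟩
      0ℤ                                                     ∎
      where
      open ≡-Reasoning
      ring : ∀ x → x * 1ℤ - x ≡ 0ℤ
      ring = solve-∀

    -- Unlike a character, `χ` is not multiplicative. The free offset `c` makes up for this: it
    -- absorbs the pairings with other variables, so that multiple sums are evaluated one variable
    -- at a time.
    HasTransform : (V n → ℤ) → (V n → ℤ) → Set
    HasTransform f f̂ = ∀ a c → ∑V (λ v → f v * χ (c +F ⟪ a , v ⟫)) ≡ f̂ a * χ c

    -- If `a` is orthogonal to `S`, the factor `χ` is constant on `S`. Otherwise some `e` in `S`
    -- pairs to 1 with `a`; translating by all multiples of `e` leaves the sum unchanged and
    -- averages `χ` over the whole field, which gives 0.
    ι-transform : ∀ {S} → Lin S → HasTransform (λ v → ι (S v)) (λ a → ∣ S ∣ₛ * ι ((S ᗮ) a))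
    ι-transform {S} L a c with (S ᗮ) a in eq
    ... | true = trans (∑-cong vs pt) (trans (∑-*ʳ vs (χ c) (λ v → ι (S v))) (cong (_* χ c) (sym (*-identityʳ ∣ S ∣ₛ))))
      where
      pt : ∀ v → ι (S v) * χ (c +F ⟪ a , v ⟫) ≡ ι (S v) * χ c
      pt v with S v in s
      ... | true  = cong (λ z → 1ℤ * χ z) (trans (cong (c +F_) (ᗮ⁻ S a eq s)) (+F-idʳ c))
      ... | false = refl
    ... | false with search (λ v → S v ∧ not (does (⟪ a , v ⟫ ≟F 0#)))
    ...   | inj₂ none = ⊥-elim (contra (ᗮ⁺ S a (λ v s → holds (⟪ a , v ⟫ ≟F 0#) (strip s (none v)))) eq)
      where
      strip : ∀ {x y} → x ≡ true → x ∧ not y ≡ false → y ≡ true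
      strip {y = true} _ _ = refl
      strip {y = false} refl ()
    ...   | inj₁ (u , p) = trans Σ≡0 (sym (cong (_* χ c) (*-zeroʳ ∣ S ∣ₛ)))
      where
      u∈ : S u ≡ true
      u∈ = ∧⁻ˡ p
      nz : ¬ ⟪ a , u ⟫ ≡ 0#
      nz h = contra (dec-true (⟪ a , u ⟫ ≟F 0#) h) (not⁻ (∧⁻ʳ {S u} p))
      e : V n
      e = inv ⟪ a , u ⟫ nz · u
      e∈ : S e ≡ true
      e∈ = ·∈ L _ u∈
      ae : ∀ λ′ → ⟪ a , λ′ · e ⟫ ≡ λ′
      ae λ′ = trans (⟪⟫-· a λ′ e) (trans (cong (λ′ *F_) (trans (⟪⟫-· a _ u) (trans (*F-comm _ _) (inverse _ nz)))) (*F-idʳ λ′))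
      g : V n → ℤ
      g v = ι (S v) * χ (c +F ⟪ a , v ⟫)
      moved : ∀ λ′ → ∑V (λ v → ι (S v) * χ ((c +F ⟪ a , v ⟫) +F λ′)) ≡ ∑V g
      moved λ′ = trans (∑-cong vs (λ v → cong₂ (λ s z → ι s * χ z) (sym (shift L v (·∈ L λ′ e∈)))
          (trans (+F-assoc c _ λ′) (cong (c +F_) (trans (cong (⟪ a , v ⟫ +F_) (sym (ae λ′))) (sym (⟪⟫-⊕ a v _)))))))
        (∑V-shift (λ′ · e) g)
      open ≡-Reasoning
      Σ≡0 : ∑V g ≡ 0ℤ
      Σ≡0 = *-cancelˡ-≡′ q′ 0<q (begin
        q′ * ∑V g ≡⟨ sym (∑F-const _) ⟩
        ∑F (λ λ′ → ∑V g) ≡⟨ ∑-cong fs (λ λ′ → sym (moved λ′)) ⟩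
        ∑F (λ λ′ → ∑V (λ v → ι (S v) * χ ((c +F ⟪ a , v ⟫) +F λ′))) ≡⟨ ∑-swap fs vs (λ λ′ v → ι (S v) * χ ((c +F ⟪ a , v ⟫) +F λ′)) ⟩
        ∑V (λ v → ∑F (λ λ′ → ι (S v) * χ ((c +F ⟪ a , v ⟫) +F λ′))) ≡⟨ ∑-cong vs (λ v → trans (∑-*ˡ fs (ι (S v)) _)
            (trans (cong (ι (S v) *_) (zero-sum (c +F ⟪ a , v ⟫))) (*-zeroʳ (ι (S v))))) ⟩
        ∑V (λ v → 0ℤ) ≡⟨ ∑-0 vs ⟩
        0ℤ ≡⟨ sym (*-zeroʳ q′) ⟩
        q′ * 0ℤ                                                               ∎)
        where
        zero-sum : ∀ d → ∑F (λ λ′ → χ (d +F λ′)) ≡ 0ℤ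
        zero-sum d = trans (∑-cong fs (λ λ′ → cong χ (+F-comm d λ′))) (trans (∑F-shift d χ) ∑F-χ)

    ∑V-χ : ∀ z → ∑V (λ a → χ ⟪ a , z ⟫) ≡ N * (q′ - 1ℤ) * ⟦ z ≟V zeroV ⟧
    ∑V-χ z = begin
      ∑V (λ a → χ ⟪ a , z ⟫) ≡⟨ ∑-cong vs (λ a → trans (cong χ (trans (⟪⟫-sym a z) (sym (+F-idˡ _)))) (sym (*-identityˡ _))) ⟩
      ∑V (λ a → ι (𝟙 a) * χ (0# +F ⟪ z , a ⟫)) ≡⟨ ι-transform 𝟙-lin z 0# ⟩
      ∣ 𝟙 ∣ₛ * ι ((𝟙 ᗮ) z) * χ 0# ≡⟨ cong₂ _*_ (cong₂ (λ x y → x * ι y) ∑V-1 (𝟙ᗮ z)) χ-0 ⟩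
      N * ⟦ z ≟V zeroV ⟧ * (q′ - 1ℤ) ≡⟨ ring N ⟦ z ≟V zeroV ⟧ (q′ - 1ℤ) ⟩
      N * (q′ - 1ℤ) * ⟦ z ≟V zeroV ⟧                     ∎
      where
      open ≡-Reasoning
      ring : ∀ a b c → a * b * c ≡ a * c * b
      ring = solve-∀

    transform-at-0 : ∀ f f̂ → HasTransform f f̂ → ∀ a → ∑V (λ v → f v * χ ⟪ a , v ⟫) ≡ f̂ a * (q′ - 1ℤ)
    transform-at-0 f f̂ h a = trans (∑-cong vs (λ v → cong (λ z → f v * χ z) (sym (+F-idˡ _)))) (trans (h a 0#) (cong (f̂ a *_) χ-0))

    ∑-at : ∀ z f → ∑V (λ v → f v * ⟦ (z ⊕ v) ≟V zeroV ⟧) ≡ f (⊖ z)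
    ∑-at z f = trans (∑-cong vs (λ v → trans (*-comm (f v) _) (cong (_* f v) (⟦⟧-cong ((z ⊕ v) ≟V zeroV) (v ≟V ⊖ z) to from)))) (V∑.sift (⊖ z) f)
      where
      to : ∀ {v} → z ⊕ v ≡ zeroV → v ≡ ⊖ z
      to {v} e = trans (sym (⊕⊖-cancel v z)) (trans (cong (_⊕ ⊖ z) (trans (⊕-comm v z) e)) (⊕-idˡ _))
      from : ∀ {v} → v ≡ ⊖ z → z ⊕ v ≡ zeroV
      from refl = ⊖-inverseʳ z

    -- The triple sum of f(u) g(v) χ(⟨a,u⟩ + ⟨a,v⟩) is evaluated twice: over `v` and `u` first it
    -- gives the transforms, over `a` first it forces v = -u. Both ways produce the factor χ(0) = q
    -- - 1, which cancels.
    parseval₂ : ∀ f f̂ g ĝ → HasTransform f f̂ → HasTransform g ĝ →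
                ∑V (λ a → f̂ a * ĝ a) ≡ N * ∑V (λ u → f u * g (⊖ u))
    parseval₂ f f̂ g ĝ hf hg = *-cancelˡ-≡′ (q′ - 1ℤ) 0<q-1 (begin
      (q′ - 1ℤ) * ∑V (λ a → f̂ a * ĝ a) ≡⟨ sym (∑-*ˡ vs (q′ - 1ℤ) _) ⟩
      ∑V (λ a → (q′ - 1ℤ) * (f̂ a * ĝ a)) ≡⟨ ∑-cong vs (λ a → sym (spectral a)) ⟩
      ∑V (λ a → ∑V (λ u → f u * ∑V (λ v → g v * χ (⟪ a , u ⟫ +F ⟪ a , v ⟫)))) ≡⟨ ∑-swap vs vs (λ a u → f u * ∑V (λ v → g v * χ (⟪ a , u ⟫ +F ⟪ a , v ⟫))) ⟩
      ∑V (λ u → ∑V (λ a → f u * ∑V (λ v → g v * χ (⟪ a , u ⟫ +F ⟪ a , v ⟫)))) ≡⟨ ∑-cong vs spatial ⟩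
      ∑V (λ u → (N * (q′ - 1ℤ)) * (f u * g (⊖ u))) ≡⟨ ∑-*ˡ vs (N * (q′ - 1ℤ)) (λ u → f u * g (⊖ u)) ⟩
      (N * (q′ - 1ℤ)) * ∑V (λ u → f u * g (⊖ u)) ≡⟨ ring N (q′ - 1ℤ) _ ⟩
      (q′ - 1ℤ) * (N * ∑V (λ u → f u * g (⊖ u)))                              ∎)
      where
      open ≡-Reasoning
      ring : ∀ a b c → a * b * c ≡ b * (a * c)
      ring = solve-∀
      spectral : ∀ a → ∑V (λ u → f u * ∑V (λ v → g v * χ (⟪ a , u ⟫ +F ⟪ a , v ⟫))) ≡ (q′ - 1ℤ) * (f̂ a * ĝ a)
      spectral a = begin
        ∑V (λ u → f u * ∑V (λ v → g v * χ (⟪ a , u ⟫ +F ⟪ a , v ⟫))) ≡⟨ ∑-cong vs (λ u → trans (cong (f u *_) (hg a ⟪ a , u ⟫)) (r (f u) (ĝ a) (χ ⟪ a , u ⟫))) ⟩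
        ∑V (λ u → f u * χ ⟪ a , u ⟫ * ĝ a) ≡⟨ ∑-*ʳ vs (ĝ a) _ ⟩
        ∑V (λ u → f u * χ ⟪ a , u ⟫) * ĝ a ≡⟨ cong (_* ĝ a) (transform-at-0 f f̂ hf a) ⟩
        f̂ a * (q′ - 1ℤ) * ĝ a ≡⟨ r′ (f̂ a) (q′ - 1ℤ) (ĝ a) ⟩
        (q′ - 1ℤ) * (f̂ a * ĝ a)                                       ∎
        where
        r : ∀ a b c → a * (b * c) ≡ a * c * b
        r = solve-∀
        r′ : ∀ a b c → a * b * c ≡ b * (a * c)
        r′ = solve-∀
      spatial : ∀ u → ∑V (λ a → f u * ∑V (λ v → g v * χ (⟪ a , u ⟫ +F ⟪ a , v ⟫))) ≡ (N * (q′ - 1ℤ)) * (f u * g (⊖ u))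
      spatial u = begin
        ∑V (λ a → f u * ∑V (λ v → g v * χ (⟪ a , u ⟫ +F ⟪ a , v ⟫))) ≡⟨ ∑-*ˡ vs (f u) _ ⟩
        f u * ∑V (λ a → ∑V (λ v → g v * χ (⟪ a , u ⟫ +F ⟪ a , v ⟫))) ≡⟨ cong (f u *_) (∑-swap vs vs (λ a v → g v * χ (⟪ a , u ⟫ +F ⟪ a , v ⟫))) ⟩
        f u * ∑V (λ v → ∑V (λ a → g v * χ (⟪ a , u ⟫ +F ⟪ a , v ⟫))) ≡⟨ cong (f u *_) (∑-cong vs inner) ⟩
        f u * ∑V (λ v → (N * (q′ - 1ℤ)) * (g v * ⟦ (u ⊕ v) ≟V zeroV ⟧)) ≡⟨ cong (f u *_) (trans (∑-*ˡ vs (N * (q′ - 1ℤ)) _) (cong ((N * (q′ - 1ℤ)) *_) (∑-at u g))) ⟩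
        f u * ((N * (q′ - 1ℤ)) * g (⊖ u)) ≡⟨ r (f u) (N * (q′ - 1ℤ)) (g (⊖ u)) ⟩
        (N * (q′ - 1ℤ)) * (f u * g (⊖ u))                                     ∎
        where
        r : ∀ a b c → a * (b * c) ≡ b * (a * c)
        r = solve-∀
        inner : ∀ v → ∑V (λ a → g v * χ (⟪ a , u ⟫ +F ⟪ a , v ⟫)) ≡ (N * (q′ - 1ℤ)) * (g v * ⟦ (u ⊕ v) ≟V zeroV ⟧)
        inner v = trans (∑-*ˡ vs (g v) _) (trans (cong (g v *_) (trans (∑-cong vs (λ a → cong χ (sym (⟪⟫-⊕ a u v)))) (∑V-χ (u ⊕ v))))
          (r (g v) (N * (q′ - 1ℤ)) _))

    -- One more variable in the argument of `parseval₂`; summation over `a` now forces u + v + w =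
    -- 0.
    parseval₃ : ∀ f f̂ → HasTransform f f̂ →
                ∑V (λ a → f̂ a * (f̂ a * f̂ a)) ≡ N * ∑V (λ u → f u * ∑V (λ v → f v * f (⊖ (u ⊕ v))))
    parseval₃ f f̂ hf = *-cancelˡ-≡′ (q′ - 1ℤ) 0<q-1 (begin
      (q′ - 1ℤ) * ∑V (λ a → f̂ a * (f̂ a * f̂ a)) ≡⟨ sym (∑-*ˡ vs (q′ - 1ℤ) _) ⟩
      ∑V (λ a → (q′ - 1ℤ) * (f̂ a * (f̂ a * f̂ a))) ≡⟨ ∑-cong vs (λ a → sym (spectral a)) ⟩
      ∑V (λ a → ∑V (λ u → f u * ∑V (λ v → f v * ∑V (λ w → X a u v w)))) ≡⟨ ∑-swap vs vs (λ a u → f u * ∑V (λ v → f v * ∑V (λ w → X a u v w))) ⟩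
      ∑V (λ u → ∑V (λ a → f u * ∑V (λ v → f v * ∑V (λ w → X a u v w)))) ≡⟨ ∑-cong vs (λ u → trans (∑-*ˡ vs (f u) _)
            (cong (f u *_) (trans (∑-swap vs vs (λ a v → f v * ∑V (λ w → X a u v w))) (∑-cong vs (spatial u))))) ⟩
      ∑V (λ u → f u * ∑V (λ v → (N * (q′ - 1ℤ)) * (f v * f (⊖ (u ⊕ v))))) ≡⟨ ∑-cong vs (λ u → trans (cong (f u *_) (∑-*ˡ vs (N * (q′ - 1ℤ)) _)) (r (f u) (N * (q′ - 1ℤ)) _)) ⟩
      ∑V (λ u → (N * (q′ - 1ℤ)) * (f u * ∑V (λ v → f v * f (⊖ (u ⊕ v))))) ≡⟨ ∑-*ˡ vs (N * (q′ - 1ℤ)) _ ⟩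
      (N * (q′ - 1ℤ)) * ∑V (λ u → f u * ∑V (λ v → f v * f (⊖ (u ⊕ v)))) ≡⟨ r″ N (q′ - 1ℤ) _ ⟩
      (q′ - 1ℤ) * (N * ∑V (λ u → f u * ∑V (λ v → f v * f (⊖ (u ⊕ v)))))       ∎)
      where
      open ≡-Reasoning
      X : V n → V n → V n → V n → ℤ
      X a u v w = f w * χ ((⟪ a , u ⟫ +F ⟪ a , v ⟫) +F ⟪ a , w ⟫)
      r : ∀ a b c → a * (b * c) ≡ b * (a * c)
      r = solve-∀
      r″ : ∀ a b c → a * b * c ≡ b * (a * c)
      r″ = solve-∀
      spectral : ∀ a → ∑V (λ u → f u * ∑V (λ v → f v * ∑V (λ w → X a u v w))) ≡ (q′ - 1ℤ) * (f̂ a * (f̂ a * f̂ a))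
      spectral a = begin
        ∑V (λ u → f u * ∑V (λ v → f v * ∑V (λ w → X a u v w))) ≡⟨ ∑-cong vs (λ u → cong (f u *_) (∑-cong vs (λ v →
            trans (cong (f v *_) (hf a _)) (r (f v) (f̂ a) _)))) ⟩
        ∑V (λ u → f u * ∑V (λ v → f̂ a * (f v * χ (⟪ a , u ⟫ +F ⟪ a , v ⟫)))) ≡⟨ ∑-cong vs (λ u → cong (f u *_) (trans (∑-*ˡ vs (f̂ a) _) (cong (f̂ a *_) (hf a ⟪ a , u ⟫)))) ⟩
        ∑V (λ u → f u * (f̂ a * (f̂ a * χ ⟪ a , u ⟫))) ≡⟨ ∑-cong vs (λ u → r₃ (f u) (f̂ a) _) ⟩
        ∑V (λ u → f̂ a * f̂ a * (f u * χ ⟪ a , u ⟫)) ≡⟨ ∑-*ˡ vs (f̂ a * f̂ a) _ ⟩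
        f̂ a * f̂ a * ∑V (λ u → f u * χ ⟪ a , u ⟫) ≡⟨ cong (f̂ a * f̂ a *_) (transform-at-0 f f̂ hf a) ⟩
        f̂ a * f̂ a * (f̂ a * (q′ - 1ℤ)) ≡⟨ r₄ (f̂ a) (q′ - 1ℤ) ⟩
        (q′ - 1ℤ) * (f̂ a * (f̂ a * f̂ a))                                         ∎
        where
        r₃ : ∀ a b c → a * (b * (b * c)) ≡ b * b * (a * c)
        r₃ = solve-∀
        r₄ : ∀ a b → a * a * (a * b) ≡ b * (a * (a * a))
        r₄ = solve-∀
      spatial : ∀ u v → ∑V (λ a → f v * ∑V (λ w → X a u v w)) ≡ (N * (q′ - 1ℤ)) * (f v * f (⊖ (u ⊕ v)))
      spatial u v = begin
        ∑V (λ a → f v * ∑V (λ w → X a u v w)) ≡⟨ ∑-*ˡ vs (f v) _ ⟩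
        f v * ∑V (λ a → ∑V (λ w → X a u v w)) ≡⟨ cong (f v *_) (∑-swap vs vs (λ a w → X a u v w)) ⟩
        f v * ∑V (λ w → ∑V (λ a → X a u v w)) ≡⟨ cong (f v *_) (∑-cong vs inner) ⟩
        f v * ∑V (λ w → (N * (q′ - 1ℤ)) * (f w * ⟦ ((u ⊕ v) ⊕ w) ≟V zeroV ⟧)) ≡⟨ cong (f v *_) (trans (∑-*ˡ vs (N * (q′ - 1ℤ)) _) (cong ((N * (q′ - 1ℤ)) *_) (∑-at (u ⊕ v) f))) ⟩
        f v * ((N * (q′ - 1ℤ)) * f (⊖ (u ⊕ v))) ≡⟨ r (f v) (N * (q′ - 1ℤ)) _ ⟩
        (N * (q′ - 1ℤ)) * (f v * f (⊖ (u ⊕ v)))                                      ∎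
        where
        inner : ∀ w → ∑V (λ a → X a u v w) ≡ (N * (q′ - 1ℤ)) * (f w * ⟦ ((u ⊕ v) ⊕ w) ≟V zeroV ⟧)
        inner w = trans (∑-*ˡ vs (f w) _) (trans (cong (f w *_) (trans (∑-cong vs (λ a →
            cong χ (sym (trans (⟪⟫-⊕ a (u ⊕ v) w) (cong (_+F ⟪ a , w ⟫) (⟪⟫-⊕ a u v)))))) (∑V-χ ((u ⊕ v) ⊕ w)))) (r (f w) (N * (q′ - 1ℤ)) _))

    -- Parseval for the two indicators. It replaces the dimension formula for the intersection of
    -- two complements, and with `T` equal to 0 it gives the size of a single complement.
    ᗮ-size₂ : ∀ {S T} → Lin S → Lin T → ∣ S ∣ₛ * ∣ T ∣ₛ * ∣ (S ᗮ) ⊓ₛ (T ᗮ) ∣ₛ ≡ N * ∣ S ⊓ₛ T ∣ₛ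
    ᗮ-size₂ {S} {T} L M = begin
      ∣ S ∣ₛ * ∣ T ∣ₛ * ∑V (λ a → ι ((S ᗮ) a ∧ (T ᗮ) a)) ≡⟨ sym (∑-*ˡ vs (∣ S ∣ₛ * ∣ T ∣ₛ) (λ a → ι ((S ᗮ) a ∧ (T ᗮ) a))) ⟩
      ∑V (λ a → ∣ S ∣ₛ * ∣ T ∣ₛ * ι ((S ᗮ) a ∧ (T ᗮ) a)) ≡⟨ ∑-cong vs (λ a → trans (cong (∣ S ∣ₛ * ∣ T ∣ₛ *_) (ι-∧ ((S ᗮ) a) ((T ᗮ) a))) (r ∣ S ∣ₛ ∣ T ∣ₛ (ι ((S ᗮ) a)) (ι ((T ᗮ) a)))) ⟩
      ∑V (λ a → ∣ S ∣ₛ * ι ((S ᗮ) a) * (∣ T ∣ₛ * ι ((T ᗮ) a))) ≡⟨ parseval₂ (λ v → ι (S v)) (λ a → ∣ S ∣ₛ * ι ((S ᗮ) a)) (λ v → ι (T v)) (λ a → ∣ T ∣ₛ * ι ((T ᗮ) a)) (ι-transform L) (ι-transform M) ⟩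
      N * ∑V (λ u → ι (S u) * ι (T (⊖ u))) ≡⟨ cong (N *_) (∑-cong vs (λ u → trans (cong (λ z → ι (S u) * ι z) (scale M -1F -1F≢0 u)) (sym (ι-∧ (S u) (T u))))) ⟩
      N * ∣ S ⊓ₛ T ∣ₛ                                                  ∎
      where
      open ≡-Reasoning
      r : ∀ a b c d → a * b * (c * d) ≡ a * c * (b * d)
      r = solve-∀

    ᗮ-size : ∀ {S} → Lin S → ∣ S ∣ₛ * ∣ S ᗮ ∣ₛ ≡ N
    ᗮ-size {S} L = begin
      ∣ S ∣ₛ * ∣ S ᗮ ∣ₛ ≡⟨ cong₂ _*_ (trans (sym (*-identityʳ ∣ S ∣ₛ)) (cong (∣ S ∣ₛ *_) (sym ∣𝟘∣)))
                                                            (∑-cong vs (λ a → cong ι (bool-ext (λ p → ∧⁺ p (𝟘ᗮ a)) ∧⁻ˡ))) ⟩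
      ∣ S ∣ₛ * ∣ 𝟘 ∣ₛ * ∣ (S ᗮ) ⊓ₛ (𝟘 ᗮ) ∣ₛ ≡⟨ ᗮ-size₂ L 𝟘-lin ⟩
      N * ∣ S ⊓ₛ 𝟘 ∣ₛ ≡⟨ cong (N *_) (trans (∑-cong vs (λ x → cong ι (bool-ext (∧⁻ʳ {S x}) (λ e → ∧⁺ (𝟘⊑ L x e) e)))) ∣𝟘∣) ⟩
      N * 1ℤ ≡⟨ *-identityʳ N ⟩
      N                                                ∎
      where open ≡-Reasoning

  -- Second moments of sums over random spans.

  module Moments {q : ℕ} (𝔽 : FiniteField q) (4≤q : + 4 ≤ + q) (n : ℕ) where
    open FiniteField 𝔽 renaming (_≟_ to _≟F_)
    open Geometry 𝔽 using (V; zeroV; _⊕_; _·_)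
    open Space 𝔽
    open Subspaces 𝔽 4≤q n

    Homogeneous : (V n → ℤ) → Set
    Homogeneous f = ∀ c → ¬ c ≡ 0# → ∀ x → f (c · x) ≡ f x

    line-sum : ∀ f → Homogeneous f → ∀ v → ∑F (λ c → f (c · v)) ≡ f zeroV + (q′ - 1ℤ) * f v
    line-sum f hom v = begin
      ∑F (λ c → f (c · v)) ≡⟨ ∑-cong fs pt ⟩
      ∑F (λ c → ⟦ c ≟F 0# ⟧ * (f zeroV - f v) + f v) ≡⟨ ∑-+ fs _ _ ⟩
      ∑F (λ c → ⟦ c ≟F 0# ⟧ * (f zeroV - f v)) + ∑F (λ c → f v) ≡⟨ cong₂ _+_ (F∑.sift 0# (λ _ → f zeroV - f v)) (∑F-const (f v)) ⟩
      (f zeroV - f v) + q′ * f v ≡⟨ ring (f zeroV) (f v) q′ ⟩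
      f zeroV + (q′ - 1ℤ) * f v                                             ∎
      where
      open ≡-Reasoning
      ring : ∀ a b c → (a - b) + c * b ≡ a + (c - 1ℤ) * b
      ring = solve-∀
      ring₁ : ∀ a b → a ≡ 1ℤ * (a - b) + b
      ring₁ = solve-∀
      pt : ∀ c → f (c · v) ≡ ⟦ c ≟F 0# ⟧ * (f zeroV - f v) + f v
      pt c with c ≟F 0#
      ... | yes refl = trans (cong f (·-zeroˡ v)) (ring₁ (f zeroV) (f v))
      ... | no nz    = trans (hom c nz v) (sym (+-identityˡ (f v)))

    ∑F-scale : ∀ a → ¬ a ≡ 0# → ∀ (f : F → ℤ) → ∑F (λ c → f (a *F c)) ≡ ∑F f
    ∑F-scale a nz f = F∑.reindex (a *F_) (inv a nz *F_)
      (λ x → trans (sym (*F-assoc a _ x)) (trans (cong (_*F x) (inverse a nz)) (*F-idˡ x)))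
      (λ x → trans (sym (*F-assoc _ a x)) (trans (cong (_*F x) (trans (*F-comm _ a) (inverse a nz))) (*F-idˡ x))) f

    T : V n → (V n → ℤ) → V n → ℤ
    T v f x = ∑F (λ c → f (x ⊕ (c · v)))

    -- Mom m f is the second moment of Σ_c f(c₁v₁ + ... + c_m v_m) over all m-tuples v.
    Mom : ℕ → (V n → ℤ) → ℤ
    Mom zero    f = f zeroV * f zeroV
    Mom (suc m) f = ∑V (λ v → Mom m (T v f))

    T-cong : ∀ {f g} → (∀ x → f x ≡ g x) → ∀ v x → T v f x ≡ T v g x
    T-cong h v x = ∑-cong fs (λ c → h _)

    Mom-cong : ∀ m {f g} → (∀ x → f x ≡ g x) → Mom m f ≡ Mom m g
    Mom-cong zero    h = cong₂ _*_ (h zeroV) (h zeroV)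
    Mom-cong (suc m) h = ∑-cong vs (λ v → Mom-cong m (T-cong h v))

    Mom-nonneg : ∀ m f → 0ℤ ≤ Mom m f
    Mom-nonneg zero    f = 0≤∙² (f zeroV)
    Mom-nonneg (suc m) f = ∑-nonneg vs (λ v → Mom-nonneg m (T v f))

    T-0 : ∀ f → Homogeneous f → ∀ v → T v f zeroV ≡ f zeroV + (q′ - 1ℤ) * f v
    T-0 f hom v = trans (∑-cong fs (λ c → cong f (⊕-idˡ _))) (line-sum f hom v)

    T-homogeneous : ∀ f v → Homogeneous f → Homogeneous (T v f)
    T-homogeneous f v hom a nz x = trans (sym (∑F-scale a nz (λ c → f ((a · x) ⊕ (c · v)))))
      (∑-cong fs (λ c → trans (cong f (trans (cong ((a · x) ⊕_) (sym (·-assoc a c v))) (sym (·-distribˡ a x _)))) (hom a nz _)))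

    T-sum : ∀ f v → ∑V f ≡ 0ℤ → ∑V (T v f) ≡ 0ℤ
    T-sum f v h = trans (∑-swap vs fs (λ x c → f (x ⊕ (c · v))))
      (trans (∑-cong fs (λ c → trans (∑V-shift (c · v) f) h)) (∑-0 fs))

    T-shift : ∀ f v d x → T v f (x ⊕ (d · v)) ≡ T v f x
    T-shift f v d x = trans (∑-cong fs (λ c → cong f (trans (⊕-assoc x _ _)
        (cong (x ⊕_) (trans (sym (·-distribʳ d c v)) (cong (_· v) (+F-comm d c)))))))
      (∑F-shift d (λ c → f (x ⊕ (c · v))))

    corr : (V n → ℤ) → V n → ℤ
    corr f x = ∑V (λ u → f u * f (u ⊕ x))

    sq : (V n → ℤ) → ℤ
    sq f = ∑V (λ u → f u * f u)

    corr-0 : ∀ f → corr f zeroV ≡ sq f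
    corr-0 f = ∑-cong vs (λ u → cong (λ z → f u * f z) (⊕-idʳ u))

    corr-homogeneous : ∀ f → Homogeneous f → Homogeneous (corr f)
    corr-homogeneous f hom a nz x = trans (sym (∑V-scale a nz (λ u → f u * f (u ⊕ (a · x)))))
      (∑-cong vs (λ u → cong₂ _*_ (hom a nz u) (trans (cong f (sym (·-distribˡ a u x))) (hom a nz _))))

    corr-sum : ∀ f → ∑V f ≡ 0ℤ → ∑V (corr f) ≡ 0ℤ
    corr-sum f h = trans (∑-swap vs vs (λ x u → f u * f (u ⊕ x))) (trans (∑-cong vs pt) (∑-0 vs))
      where
      pt : ∀ u → ∑V (λ x → f u * f (u ⊕ x)) ≡ 0ℤ
      pt u = trans (∑-*ˡ vs (f u) (λ x → f (u ⊕ x))) (trans (cong (f u *_)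
        (trans (∑-cong vs (λ x → cong f (⊕-comm u x))) (trans (∑V-shift u f) h))) (*-zeroʳ (f u)))

    -- `T v f` is invariant along `v`, so after translation one of the two line sums in the square
    -- contributes only a factor q; the other is a line sum of the autocorrelation.
    T-sq : ∀ f → Homogeneous f → ∀ v → sq (T v f) ≡ q′ * (sq f + (q′ - 1ℤ) * corr f v)
    T-sq f hom v = begin
      ∑V (λ x → T v f x * T v f x) ≡⟨ ∑-cong vs (λ x → sym (∑-*ʳ fs (T v f x) (λ c → f (x ⊕ (c · v))))) ⟩
      ∑V (λ x → ∑F (λ c → f (x ⊕ (c · v)) * T v f x)) ≡⟨ ∑-swap vs fs (λ x c → f (x ⊕ (c · v)) * T v f x) ⟩
      ∑F (λ c → ∑V (λ x → f (x ⊕ (c · v)) * T v f x)) ≡⟨ ∑-cong fs (λ c → trans (∑-cong vs (λ x → cong (f (x ⊕ (c · v)) *_) (sym (T-shift f v c x))))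
            (∑V-shift (c · v) (λ x → f x * T v f x))) ⟩
      ∑F (λ c → ∑V (λ x → f x * T v f x)) ≡⟨ ∑F-const _ ⟩
      q′ * ∑V (λ x → f x * T v f x) ≡⟨ cong (q′ *_) (∑-cong vs (λ x → sym (∑-*ˡ fs (f x) (λ c → f (x ⊕ (c · v)))))) ⟩
      q′ * ∑V (λ x → ∑F (λ c → f x * f (x ⊕ (c · v)))) ≡⟨ cong (q′ *_) (∑-swap vs fs (λ x c → f x * f (x ⊕ (c · v)))) ⟩
      q′ * ∑F (λ c → corr f (c · v)) ≡⟨ cong (q′ *_) (line-sum (corr f) (corr-homogeneous f hom) v) ⟩
      q′ * (corr f zeroV + (q′ - 1ℤ) * corr f v) ≡⟨ cong (λ z → q′ * (z + (q′ - 1ℤ) * corr f v)) (corr-0 f) ⟩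
      q′ * (sq f + (q′ - 1ℤ) * corr f v)                               ∎
      where open ≡-Reasoning

    -- Expand the square over pairs of coefficient vectors c, d. If they are linearly independent,
    -- or exactly one is zero, the mean-zero condition kills the term. The pair (0, 0) gives f(0)²,
    -- and each of the (q - 1)(q^m - 1) pairs of nonzero proportional vectors gives the same
    -- multiple of `sq f`. In the induction these cancellations are the vanishing of the sums of `f`
    -- and of `corr f`.
    second-moment : ∀ m f → Homogeneous f → ∑V f ≡ 0ℤ →
      N * Mom m f ≡ N * N ^ m * (f zeroV * f zeroV) + N ^ m * (q′ - 1ℤ) * (q′ ^ m - 1ℤ) * sq f
    second-moment zero f hom h = ring N (f zeroV) q′ (sq f)
      where
      ring : ∀ a b c d → a * (b * b) ≡ a * 1ℤ * (b * b) + 1ℤ * (c - 1ℤ) * (1ℤ - 1ℤ) * d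
      ring = solve-∀
    second-moment (suc m) f hom h = begin
      N * ∑V (λ v → Mom m (T v f)) ≡⟨ sym (∑-*ˡ vs N (λ v → Mom m (T v f))) ⟩
      ∑V (λ v → N * Mom m (T v f)) ≡⟨ ∑-cong vs step ⟩
      ∑V (λ v → ((c₀ + c₁ * f v) + c₂ * (f v * f v)) + c₃ * corr f v) ≡⟨ ∑-+ vs _ _ ⟩
      ∑V (λ v → (c₀ + c₁ * f v) + c₂ * (f v * f v)) + ∑V (λ v → c₃ * corr f v)
            ≡⟨ cong₂ _+_ (trans (∑-+ vs _ _) (cong (_+ ∑V (λ v → c₂ * (f v * f v))) (∑-+ vs _ _))) (∑-*ˡ vs c₃ (corr f)) ⟩
      ∑V (λ v → c₀) + ∑V (λ v → c₁ * f v) + ∑V (λ v → c₂ * (f v * f v)) + c₃ * ∑V (corr f)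
            ≡⟨ cong₂ (λ a b → a + b + c₃ * ∑V (corr f)) (cong₂ _+_ (∑V-const c₀) (trans (∑-*ˡ vs c₁ f) (cong (c₁ *_) h))) (∑-*ˡ vs c₂ (λ v → f v * f v)) ⟩
      N * c₀ + c₁ * 0ℤ + c₂ * sq f + c₃ * ∑V (corr f) ≡⟨ cong (λ z → N * c₀ + c₁ * 0ℤ + c₂ * sq f + c₃ * z) (corr-sum f h) ⟩
      N * c₀ + c₁ * 0ℤ + c₂ * sq f + c₃ * 0ℤ ≡⟨ final N (N ^ m) q′ (q′ ^ m) (f zeroV) (sq f) ⟩
      N * N ^ suc m * (f zeroV * f zeroV) + N ^ suc m * (q′ - 1ℤ) * (q′ ^ suc m - 1ℤ) * sq f ∎
      where
      open ≡-Reasoning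
      c₀ c₁ c₂ c₃ : ℤ
      c₀ = N * N ^ m * (f zeroV * f zeroV) + N ^ m * (q′ - 1ℤ) * (q′ ^ m - 1ℤ) * (q′ * sq f)
      c₁ = N * N ^ m * (+ 2 * (q′ - 1ℤ) * f zeroV)
      c₂ = N * N ^ m * ((q′ - 1ℤ) * (q′ - 1ℤ))
      c₃ = N ^ m * (q′ - 1ℤ) * (q′ ^ m - 1ℤ) * (q′ * (q′ - 1ℤ))
      expand : ∀ N M q Q f₀ fv s r →
        N * M * ((f₀ + (q - 1ℤ) * fv) * (f₀ + (q - 1ℤ) * fv)) + M * (q - 1ℤ) * (Q - 1ℤ) * (q * (s + (q - 1ℤ) * r)) ≡
        ((N * M * (f₀ * f₀) + M * (q - 1ℤ) * (Q - 1ℤ) * (q * s)) + N * M * (+ 2 * (q - 1ℤ) * f₀) * fv)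
          + N * M * ((q - 1ℤ) * (q - 1ℤ)) * (fv * fv) + M * (q - 1ℤ) * (Q - 1ℤ) * (q * (q - 1ℤ)) * r
      expand = solve-∀
      final : ∀ N M q Q f₀ s →
        N * (N * M * (f₀ * f₀) + M * (q - 1ℤ) * (Q - 1ℤ) * (q * s)) + N * M * (+ 2 * (q - 1ℤ) * f₀) * 0ℤ
          + N * M * ((q - 1ℤ) * (q - 1ℤ)) * s + M * (q - 1ℤ) * (Q - 1ℤ) * (q * (q - 1ℤ)) * 0ℤ ≡
        N * (N * M) * (f₀ * f₀) + (N * M) * (q - 1ℤ) * (q * Q - 1ℤ) * s
      final = solve-∀
      step : ∀ v → N * Mom m (T v f) ≡ ((c₀ + c₁ * f v) + c₂ * (f v * f v)) + c₃ * corr f v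
      step v = trans (second-moment m (T v f) (T-homogeneous f v hom) (T-sum f v h))
        (trans (cong₂ (λ a b → N * N ^ m * (a * a) + N ^ m * (q′ - 1ℤ) * (q′ ^ m - 1ℤ) * b) (T-0 f hom v) (T-sq f hom v))
          (expand N (N ^ m) q′ (q′ ^ m) (f zeroV) (f v) (sq f) (corr f v)))

    cosum : (V n → ℤ) → Sub → V n → ℤ
    cosum w S x = ∑V (λ u → ι (S u) * w (x ⊕ u))

    -- For `v` outside `S` the translates of x + S along `v` tile the coset of the larger span.
    -- Hence line sums taken along independent vectors, starting from `w`, produce the sum of `w`
    -- over their span.
    T-cosum : ∀ w {S v} → Lin S → S v ≡ false → ∀ x → T v (cosum w S) x ≡ cosum w (S +⟨ v ⟩) x
    T-cosum w {S} {v} L v∉ x = begin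
      ∑F (λ c → ∑V (λ u → ι (S u) * w ((x ⊕ (c · v)) ⊕ u))) ≡⟨ ∑-cong fs move ⟩
      ∑F (λ c → ∑V (λ u → ι (S (u ⊕ ((-F c) · v))) * w (x ⊕ u))) ≡⟨ ∑F-neg (λ c → ∑V (λ u → ι (S (u ⊕ (c · v))) * w (x ⊕ u))) ⟩
      ∑F (λ c → ∑V (λ u → ι (S (u ⊕ (c · v))) * w (x ⊕ u))) ≡⟨ ∑-swap fs vs (λ c u → ι (S (u ⊕ (c · v))) * w (x ⊕ u)) ⟩
      ∑V (λ u → ∑F (λ c → ι (S (u ⊕ (c · v))) * w (x ⊕ u))) ≡⟨ ∑-cong vs (λ u → trans (∑-*ʳ fs (w (x ⊕ u)) (λ c → ι (S (u ⊕ (c · v)))))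
            (cong (_* w (x ⊕ u)) (sym (+⟨⟩-ι L v∉ u)))) ⟩
      ∑V (λ u → ι ((S +⟨ v ⟩) u) * w (x ⊕ u)) ∎
      where
      open ≡-Reasoning
      move : ∀ c → ∑V (λ u → ι (S u) * w ((x ⊕ (c · v)) ⊕ u)) ≡ ∑V (λ u → ι (S (u ⊕ ((-F c) · v))) * w (x ⊕ u))
      move c = trans (∑-cong vs (λ u → cong₂ (λ s z → ι (S s) * w z) (sym (-F·-cancel c u v))
          (trans (⊕-assoc x _ u) (cong (x ⊕_) (⊕-comm (c · v) u)))))
        (∑V-shift (c · v) (λ u → ι (S (u ⊕ ((-F c) · v))) * w (x ⊕ u)))

    cosum-0 : ∀ w x → cosum w 𝟘 x ≡ w x
    cosum-0 w x = trans (V∑.sift zeroV (λ u → w (x ⊕ u))) (cong w (⊕-idʳ x))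

  -- Gaussian binomial coefficients without division.

  module Gauss (q : ℕ) where
    private
      q′ : ℤ
      q′ = + q

    +-^ : ∀ m → + (q ℕ.^ m) ≡ q′ ^ m
    +-^ zero    = refl
    +-^ (suc m) = trans (pos-* q _) (cong (q′ *_) (+-^ m))

    G : ℕ → ℕ → ℤ
    G a b = + gauss q a b

    G-pascal : ∀ a b → G (suc a) (suc b) ≡ G a b + q′ ^ suc b * G a (suc b)
    G-pascal a b = trans (pos-+ (gauss q a b) _) (cong (_+_ (G a b)) (trans (pos-* (q ℕ.^ suc b) _) (cong (_* G a (suc b)) (+-^ (suc b)))))

    0≤G : ∀ a b → 0ℤ ≤ G a b
    0≤G a b = +≤+ ℕ.z≤n

    1≤G : ∀ a b → 1ℤ ≤ G (a ℕ.+ b) b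
    1≤G a zero    = ≤-refl
    1≤G a (suc b) rewrite ℕ.+-suc a b | G-pascal (a ℕ.+ b) b =
      ≤-trans (1≤G a b) (≤-gap _ (0≤* (subst (0ℤ ≤_) (+-^ (suc b)) (+≤+ ℕ.z≤n)) (0≤G (a ℕ.+ b) (suc b))) refl)

    mutual
      -- The product formula, cross-multiplied. The Pascal recursion alone does not close the
      -- induction: the step in `a` needs the ratio of neighbours with equal lower index, which is
      -- `G-shift`, and that in turn comes from `G-step` with smaller lower index.
      G-step : ∀ a b → (q′ ^ suc b - 1ℤ) * G (suc a) (suc b) ≡ (q′ ^ suc a - 1ℤ) * G a b
      G-step zero zero    = cong ((q′ ^ 1 - 1ℤ) *_) (trans (G-pascal 0 0) (cong (_+_ 1ℤ) (*-zeroʳ (q′ ^ 1))))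
      G-step zero (suc b) = trans (cong ((q′ ^ suc (suc b) - 1ℤ) *_) (trans (G-pascal 0 (suc b)) (trans (+-identityˡ _) (*-zeroʳ (q′ ^ suc (suc b))))))
                              (trans (*-zeroʳ (q′ ^ suc (suc b) - 1ℤ)) (sym (*-zeroʳ (q′ ^ 1 - 1ℤ))))
      G-step (suc a) b = begin
        (q′ * B - 1ℤ) * G (suc (suc a)) (suc b) ≡⟨ cong ((q′ * B - 1ℤ) *_) (G-pascal (suc a) b) ⟩
        (q′ * B - 1ℤ) * (G (suc a) b + q′ * B * G (suc a) (suc b)) ≡⟨ r₁ q′ B (G (suc a) b) (G (suc a) (suc b)) ⟩
        (q′ * B - 1ℤ) * G (suc a) b + q′ * B * ((q′ * B - 1ℤ) * G (suc a) (suc b)) ≡⟨ cong (λ z → (q′ * B - 1ℤ) * G (suc a) b + q′ * B * z) (G-step a b) ⟩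
        (q′ * B - 1ℤ) * G (suc a) b + q′ * B * ((q′ * A - 1ℤ) * G a b) ≡⟨ r₂ q′ B (q′ * A - 1ℤ) (G (suc a) b) (G a b) ⟩
        (q′ * B - 1ℤ) * G (suc a) b + q′ * (B * (q′ * A - 1ℤ) * G a b) ≡⟨ cong (λ z → (q′ * B - 1ℤ) * G (suc a) b + q′ * z) (sym (G-shift a b)) ⟩
        (q′ * B - 1ℤ) * G (suc a) b + q′ * ((q′ * A - B) * G (suc a) b) ≡⟨ r₃ q′ B A (G (suc a) b) ⟩
        (q′ * (q′ * A) - 1ℤ) * G (suc a) b                                       ∎
        where
        open ≡-Reasoning
        A B : ℤ
        A = q′ ^ a
        B = q′ ^ b
        r₁ : ∀ q B g h → (q * B - 1ℤ) * (g + q * B * h) ≡ (q * B - 1ℤ) * g + q * B * ((q * B - 1ℤ) * h)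
        r₁ = solve-∀
        r₂ : ∀ q B c g h → (q * B - 1ℤ) * g + q * B * (c * h) ≡ (q * B - 1ℤ) * g + q * (B * c * h)
        r₂ = solve-∀
        r₃ : ∀ q B A g → (q * B - 1ℤ) * g + q * ((q * A - B) * g) ≡ (q * (q * A) - 1ℤ) * g
        r₃ = solve-∀

      G-shift : ∀ a b → (q′ ^ suc a - q′ ^ b) * G (suc a) b ≡ q′ ^ b * (q′ ^ suc a - 1ℤ) * G a b
      G-shift a zero    = cong (_* 1ℤ) (sym (*-identityˡ (q′ ^ suc a - 1ℤ)))
      G-shift a (suc b) = begin
        (A - B) * G (suc a) (suc b) ≡⟨ r₁ A B (G (suc a) (suc b)) ⟩
        (A - 1ℤ) * G (suc a) (suc b) - (B - 1ℤ) * G (suc a) (suc b) ≡⟨ cong (λ z → (A - 1ℤ) * G (suc a) (suc b) - z) (G-step a b) ⟩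
        (A - 1ℤ) * G (suc a) (suc b) - (A - 1ℤ) * G a b ≡⟨ cong (λ z → (A - 1ℤ) * z - (A - 1ℤ) * G a b) (G-pascal a b) ⟩
        (A - 1ℤ) * (G a b + B * G a (suc b)) - (A - 1ℤ) * G a b ≡⟨ r₂ A B (G a b) (G a (suc b)) ⟩
        B * (A - 1ℤ) * G a (suc b)                                               ∎
        where
        open ≡-Reasoning
        A B : ℤ
        A = q′ ^ suc a
        B = q′ ^ suc b
        r₁ : ∀ A B g → (A - B) * g ≡ (A - 1ℤ) * g - (B - 1ℤ) * g
        r₁ = solve-∀
        r₂ : ∀ A B g h → (A - 1ℤ) * (g + B * h) - (A - 1ℤ) * g ≡ B * (A - 1ℤ) * h
        r₂ = solve-∀

  -- Counting subspaces by extending them one vector at a time.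

  module Counting {q : ℕ} (𝔽 : FiniteField q) (4≤q : + 4 ≤ + q) (n : ℕ) where
    open Geometry 𝔽 using (V; zeroV)
    open Space 𝔽
    open Subspaces 𝔽 4≤q n
    open Moments 𝔽 4≤q n
    open Gauss q

    Distinct : List Sub → Set
    Distinct = AllPairs (λ U W → ¬ (∀ x → U x ≡ W x))

    through : V n → List Sub → List Sub
    through v = filter (λ A → A v Bool.≟ true)

    ∑-through : ∀ v Z g → ∑ (through v Z) g ≡ ∑ Z (λ A → ι (A v) * g A)
    ∑-through v Z g = trans (∑-filter (λ A → A v Bool.≟ true) Z g)
      (∑-cong Z (λ A → cong (λ b → ι b * g A) (bool-ext (holds (A v Bool.≟ true)) (dec-true (A v Bool.≟ true)))))

    record Above (S : Sub) (Q : ℤ) (A : Sub) : Set where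
      constructor above
      field
        lin  : Lin A
        base : S ⊑ A
        size : ∣ A ∣ₛ ≡ Q

    through-above : ∀ {S Q v Z} → All (Above S Q) Z → All (Above (S +⟨ v ⟩) Q) (through v Z)
    through-above {S} {Q} {v} {Z} h = All.zipWith (λ { (above L b s , e) → above L (+⟨⟩-least {S} {v} L b e) s })
        (All.filter⁺ (λ A → A v Bool.≟ true) h , All.all-filter (λ A → A v Bool.≟ true) Z)

    through-distinct : ∀ {v Z} → Distinct Z → Distinct (through v Z)
    through-distinct {v} = AllPairs.filter⁺ (λ A → A v Bool.≟ true)

    ∑-minus : ∀ S A → S ⊑ A → ∑V (λ v → ι (not (S v)) * ι (A v)) ≡ ∣ A ∣ₛ - ∣ S ∣ₛ
    ∑-minus S A p = trans (∑-cong vs pt) (∑-- vs (λ v → ι (A v)) (λ v → ι (S v)))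
      where
      pt : ∀ v → ι (not (S v)) * ι (A v) ≡ ι (A v) - ι (S v)
      pt v with S v in eq
      ... | false = trans (*-identityˡ _) (sym (+-identityʳ _))
      ... | true rewrite p v eq = refl

    -- Double counting of pairs of a member and a vector of it outside `S`: every member has Q - ∣S∣
    -- such vectors.
    extend-count : ∀ {S Q Z} (g : Sub → ℤ) → All (Above S Q) Z →
      (Q - ∣ S ∣ₛ) * ∑ Z g ≡ ∑V (λ v → ι (not (S v)) * ∑ (through v Z) g)
    extend-count {S} {Q} {Z} g h = sym (begin
      ∑V (λ v → ι (not (S v)) * ∑ (through v Z) g) ≡⟨ ∑-cong vs (λ v → trans (cong (ι (not (S v)) *_) (∑-through v Z g))
            (sym (∑-*ˡ Z (ι (not (S v))) (λ A → ι (A v) * g A)))) ⟩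
      ∑V (λ v → ∑ Z (λ A → ι (not (S v)) * (ι (A v) * g A))) ≡⟨ ∑-swap vs Z (λ v A → ι (not (S v)) * (ι (A v) * g A)) ⟩
      ∑ Z (λ A → ∑V (λ v → ι (not (S v)) * (ι (A v) * g A))) ≡⟨ ∑-congᴬ (All.map (λ {A} → each A) h) ⟩
      ∑ Z (λ A → (Q - ∣ S ∣ₛ) * g A) ≡⟨ ∑-*ˡ Z (Q - ∣ S ∣ₛ) g ⟩
      (Q - ∣ S ∣ₛ) * ∑ Z g                                                  ∎)
      where
      open ≡-Reasoning
      each : ∀ A → Above S Q A → ∑V (λ v → ι (not (S v)) * (ι (A v) * g A)) ≡ (Q - ∣ S ∣ₛ) * g A
      each A (above _ b s) = trans (∑-cong vs (λ v → sym (*-assoc (ι (not (S v))) (ι (A v)) (g A))))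
        (trans (∑-*ʳ vs (g A) (λ v → ι (not (S v)) * ι (A v))) (cong (_* g A) (trans (∑-minus S A b) (cong (_- ∣ S ∣ₛ) s))))

    above-self : ∀ {S A} → Above S ∣ S ∣ₛ A → ∀ x → A x ≡ S x
    above-self {S} {A} (above _ b s) x = bool-ext (⊑-full b (≤-reflexive s) x) (b x)

    at-most-one : ∀ {S Z} → All (Above S ∣ S ∣ₛ) Z → Distinct Z → Z ≡ [] ⊎ ∃ λ A → Z ≡ A ∷ []
    at-most-one {Z = []}        _ _ = inj₁ refl
    at-most-one {Z = A ∷ []}    _ _ = inj₂ (A , refl)
    at-most-one {Z = A ∷ B ∷ _} (a ∷ b ∷ _) ((d ∷ _) ∷ _) = ⊥-elim (d (λ x → trans (above-self a x) (sym (above-self b x))))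

    -- The bound is the number of subspaces of size `Q` between `S` and `W`. Each step adjoins a
    -- vector of `W` outside `S`; the quotient of the number of such vectors in `W` by the number in
    -- a member is the ratio in `G-step`.
    count : ∀ m s r {Q S W Z} → Lin S → ∣ S ∣ₛ ≡ q′ ^ s → Q ≡ q′ ^ s * q′ ^ m → ∣ W ∣ₛ ≡ q′ ^ s * q′ ^ (r ℕ.+ m) → Lin W → S ⊑ W →
      All (Above S Q) Z → All (_⊑ W) Z → Distinct Z → ∑ Z (λ _ → 1ℤ) ≤ G (r ℕ.+ m) m
    count zero s r {Q} {S} {W} {Z} L S≡ Q≡ W≡ LW S⊑W h u d
      with at-most-one (subst (λ z → All (Above S z) Z) (trans Q≡ (trans (*-identityʳ _) (sym S≡))) h) d
    ... | inj₁ refl       = 0≤G (r ℕ.+ 0) 0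
    ... | inj₂ (A , refl) = ≤-refl
    count (suc m) s r {Q} {S} {W} {Z} L S≡ Q≡ W≡ LW S⊑W h u d
      rewrite ℕ.+-suc r m = *-cancelˡ (q′ ^ s * (q′ ^ suc m - 1ℤ)) (0<* (0<q^ s) (0<q^-1 m)) (begin
        q′ ^ s * (q′ ^ suc m - 1ℤ) * ∑ Z (λ _ → 1ℤ) ≡⟨ cong (_* ∑ Z (λ _ → 1ℤ)) (trans (r₁ (q′ ^ s) (q′ ^ suc m)) (cong₂ _-_ (sym Q≡) (sym S≡))) ⟩
        (Q - ∣ S ∣ₛ) * ∑ Z (λ _ → 1ℤ) ≡⟨ extend-count (λ _ → 1ℤ) h ⟩
        ∑V (λ v → ι (not (S v)) * ∑ (through v Z) (λ _ → 1ℤ)) ≤⟨ ∑-mono vs bound ⟩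
        ∑V (λ v → ι (not (S v)) * ι (W v) * G (r ℕ.+ m) m) ≡⟨ ∑-*ʳ vs (G (r ℕ.+ m) m) (λ v → ι (not (S v)) * ι (W v)) ⟩
        ∑V (λ v → ι (not (S v)) * ι (W v)) * G (r ℕ.+ m) m ≡⟨ cong (_* G (r ℕ.+ m) m) (trans (∑-minus S W S⊑W) (trans (cong₂ _-_ W≡ S≡) (sym (r₁ (q′ ^ s) (q′ ^ suc (r ℕ.+ m)))))) ⟩
        q′ ^ s * (q′ ^ suc (r ℕ.+ m) - 1ℤ) * G (r ℕ.+ m) m ≡⟨ *-assoc (q′ ^ s) _ _ ⟩
        q′ ^ s * ((q′ ^ suc (r ℕ.+ m) - 1ℤ) * G (r ℕ.+ m) m) ≡⟨ cong (q′ ^ s *_) (sym (G-step (r ℕ.+ m) m)) ⟩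
        q′ ^ s * ((q′ ^ suc m - 1ℤ) * G (suc (r ℕ.+ m)) (suc m)) ≡⟨ sym (*-assoc (q′ ^ s) _ _) ⟩
        q′ ^ s * (q′ ^ suc m - 1ℤ) * G (suc (r ℕ.+ m)) (suc m)            ∎)
      where
      open ≤-Reasoning
      r₁ : ∀ a b → a * (b - 1ℤ) ≡ a * b - a
      r₁ = solve-∀
      r₂ : ∀ a b c → a * (b * c) ≡ (b * a) * c
      r₂ = solve-∀
      bound : ∀ v → ι (not (S v)) * ∑ (through v Z) (λ _ → 1ℤ) ≤ ι (not (S v)) * ι (W v) * G (r ℕ.+ m) m
      bound v with S v in sv | W v in wv
      ... | true  | _    = ≤-refl
      ... | false | true = subst₂ _≤_ (sym (*-identityˡ _)) (sym (*-identityˡ _))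
        (count m (suc s) r {Q} {S +⟨ v ⟩} {W} {through v Z} (+⟨⟩-lin L) (trans (∣+⟨⟩∣ L sv) (cong (q′ *_) S≡))
          (trans Q≡ (r₂ (q′ ^ s) q′ (q′ ^ m))) (trans W≡ (r₂ (q′ ^ s) q′ (q′ ^ (r ℕ.+ m)))) LW
          (+⟨⟩-least LW S⊑W wv) (through-above h) (All.filter⁺ (λ A → A v Bool.≟ true) u) (through-distinct d))
      ... | false | false = ≤-reflexive (trans (cong (1ℤ *_) (trans (∑-through v Z (λ _ → 1ℤ))
          (trans (∑-congᴬ (All.map (λ {A} p → cong (λ b → ι b * 1ℤ) (not-true (λ e → contra (p v e) wv))) u)) (∑-0 Z)))) refl)

    -- The number of ordered m-tuples in a space of `Q` vectors that are independent modulo a given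
    -- s-dimensional subspace.
    falling : ℤ → ℕ → ℕ → ℤ
    falling Q zero    s = 1ℤ
    falling Q (suc m) s = (Q - q′ ^ s) * falling Q m (suc s)

    total : (V n → ℤ) → Sub → ℤ
    total w A = ∑V (λ u → ι (A u) * w u)

    falling-nonneg : ∀ {Q} m s → Q ≡ q′ ^ s * q′ ^ m → 0ℤ ≤ falling Q m s
    falling-nonneg zero    s e = +≤+ ℕ.z≤n
    falling-nonneg (suc m) s e = 0≤* (i≤j⇒0≤j-i (≤-trans (≤-reflexive (sym (*-identityʳ (q′ ^ s))))
        (≤-trans (*-monoˡ (q′ ^ s) (<⇒≤ (0<q^ s)) (1≤q^ (suc m))) (≤-reflexive (sym e)))))
      (falling-nonneg m (suc s) (trans e (r₂ (q′ ^ s) q′ (q′ ^ m))))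
      where
      r₂ : ∀ a b c → a * (b * c) ≡ (b * a) * c
      r₂ = solve-∀

    -- An independent m-tuple modulo `S` that completes `S` to a member `A` contributes the square
    -- of `total w A` to the moment. Each member arises from `falling Q m s` tuples, and a tuple
    -- determines its member; all other tuples contribute squares, hence something nonnegative.
    moment-lower : ∀ w m s {Q S Z} → Lin S → ∣ S ∣ₛ ≡ q′ ^ s → Q ≡ q′ ^ s * q′ ^ m →
      All (Above S Q) Z → Distinct Z → falling Q m s * ∑ Z (λ A → total w A * total w A) ≤ Mom m (cosum w S)
    moment-lower w zero s {Q} {S} {Z} L S≡ Q≡ h d
      with at-most-one (subst (λ z → All (Above S z) Z) (trans Q≡ (trans (*-identityʳ _) (sym S≡))) h) d
    ... | inj₁ refl       = 0≤∙² (cosum w S zeroV)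
    ... | inj₂ (A , refl) = ≤-reflexive (trans (*-identityˡ _) (trans (+-identityʳ _) (cong₂ _*_ same same)))
      where
      same : total w A ≡ cosum w S zeroV
      same = ∑-cong vs (λ u → cong₂ (λ b z → ι b * w z)
        (above-self (All.head (subst (λ z → All (Above S z) Z) (trans Q≡ (trans (*-identityʳ _) (sym S≡))) h)) u) (sym (⊕-idˡ u)))
    moment-lower w (suc m) s {Q} {S} {Z} L S≡ Q≡ h d = begin
      (Q - q′ ^ s) * φ * ∑ Z Ψ² ≡⟨ r₃ (Q - q′ ^ s) φ (∑ Z Ψ²) ⟩
      φ * ((Q - q′ ^ s) * ∑ Z Ψ²) ≡⟨ cong (λ z → φ * ((Q - z) * ∑ Z Ψ²)) (sym S≡) ⟩
      φ * ((Q - ∣ S ∣ₛ) * ∑ Z Ψ²) ≡⟨ cong (φ *_) (extend-count Ψ² h) ⟩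
      φ * ∑V (λ v → ι (not (S v)) * ∑ (through v Z) Ψ²) ≡⟨ sym (∑-*ˡ vs φ (λ v → ι (not (S v)) * ∑ (through v Z) Ψ²)) ⟩
      ∑V (λ v → φ * (ι (not (S v)) * ∑ (through v Z) Ψ²)) ≤⟨ ∑-mono vs bound ⟩
      ∑V (λ v → Mom m (T v (cosum w S)))                              ∎
      where
      open ≤-Reasoning
      φ : ℤ
      φ = falling Q m (suc s)
      Ψ² : Sub → ℤ
      Ψ² A = total w A * total w A
      r₂ : ∀ a b c → a * (b * c) ≡ (b * a) * c
      r₂ = solve-∀
      r₃ : ∀ a b c → a * b * c ≡ b * (a * c)
      r₃ = solve-∀
      bound : ∀ v → φ * (ι (not (S v)) * ∑ (through v Z) Ψ²) ≤ Mom m (T v (cosum w S))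
      bound v with S v in sv
      -- A vector already in `S` extends nothing; its nonnegative moment is discarded.
      ... | true  = ≤-trans (≤-reflexive (*-zeroʳ φ)) (Mom-nonneg m (T v (cosum w S)))
      ... | false = begin
        φ * (1ℤ * ∑ (through v Z) Ψ²) ≡⟨ cong (φ *_) (*-identityˡ _) ⟩
        φ * ∑ (through v Z) Ψ² ≤⟨ moment-lower w m (suc s) (+⟨⟩-lin L) (trans (∣+⟨⟩∣ L sv) (cong (q′ *_) S≡))
                                               (trans Q≡ (r₂ (q′ ^ s) q′ (q′ ^ m))) (through-above h) (through-distinct d) ⟩
        Mom m (cosum w (S +⟨ v ⟩)) ≡⟨ Mom-cong m (λ x → sym (T-cosum w L sv x)) ⟩
        Mom m (T v (cosum w S))           ∎

  -- The quadratic inequality behind the pencil bound.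

  pencil-arith : ∀ q x Q ε δ n₂ n₃ → Q ≡ q * (q * x) → + 4 ≤ q → 0ℤ < x → 0ℤ ≤ ε → ε ≤ q * x → 0ℤ ≤ n₂ → Q * n₃ ≤ n₂ →
    (q - 1ℤ) * (q - 1ℤ) * δ ≤ (q - 1ℤ) * ((ε - 1ℤ) * n₂) + (Q - ε) * (Q - ε) * n₃ →
    (q - 1ℤ) * δ ≤ (+ 2 * q - 1ℤ) * x * n₂
  pencil-arith q x .(q * (q * x)) ε δ n₂ n₃ refl 4≤q 0<x 0≤ε ε≤h 0≤n₂ n₃≤ main = *-cancelˡ c 0<c (begin
    c * ((q - 1ℤ) * δ) ≡⟨ r₁ q x δ ⟩
    Q * ((q - 1ℤ) * (q - 1ℤ) * δ) ≤⟨ *-monoˡ Q 0≤Q main ⟩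
    Q * ((q - 1ℤ) * ((ε - 1ℤ) * n₂) + (Q - ε) * (Q - ε) * n₃) ≡⟨ r₂ q Q ε n₂ n₃ ⟩
    Q * (q - 1ℤ) * (ε - 1ℤ) * n₂ + (Q - ε) * (Q - ε) * (Q * n₃) ≤⟨ +-monoʳ-≤ (Q * (q - 1ℤ) * (ε - 1ℤ) * n₂) (*-monoˡ ((Q - ε) * (Q - ε)) (0≤∙² (Q - ε)) n₃≤) ⟩
    -- The worst case is ε = h = q x. The difference from the value there factors as (h - ε) times
    -- (q - 3) Q + ε + h, and the value at h has leading part (q - 1)(2q - 1) h², which is where the
    -- constant 2q - 1 comes from.
    Q * (q - 1ℤ) * (ε - 1ℤ) * n₂ + (Q - ε) * (Q - ε) * n₂ ≤⟨ ≤-gap (((h - ε) * ((q - + 3) * (q * h) + (ε + h)) + (q - 1ℤ) * (q * h)) * n₂)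
            (0≤* (0≤+ (0≤* (i≤j⇒0≤j-i ε≤h) (0≤+ (0≤* 0≤q-3 (0≤* 0≤q 0≤h)) (0≤+ 0≤ε 0≤h))) (0≤* 0≤q-1 (0≤* 0≤q 0≤h))) 0≤n₂)
            (r₃ q x ε n₂) ⟩
    c * ((+ 2 * q - 1ℤ) * x * n₂)                                               ∎)
    where
    open ≤-Reasoning
    h Q c : ℤ
    h = q * x
    Q = q * (q * x)
    c = (q - 1ℤ) * (q * x) * q
    0<q : 0ℤ < q
    0<q = <-≤-trans (+<+ (ℕ.s≤s ℕ.z≤n)) 4≤q
    0≤q : 0ℤ ≤ q
    0≤q = <⇒≤ 0<q
    0<q-1 : 0ℤ < q - 1ℤ
    0<q-1 = <-≤-trans (+<+ (ℕ.s≤s ℕ.z≤n)) (+-monoˡ-≤ -1ℤ 4≤q)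
    0≤q-1 : 0ℤ ≤ q - 1ℤ
    0≤q-1 = <⇒≤ 0<q-1
    0≤q-3 : 0ℤ ≤ q - + 3
    0≤q-3 = ≤-trans (+≤+ ℕ.z≤n) (+-monoˡ-≤ (- + 3) 4≤q)
    0≤h : 0ℤ ≤ h
    0≤h = 0≤* 0≤q (<⇒≤ 0<x)
    0≤Q : 0ℤ ≤ Q
    0≤Q = 0≤* 0≤q 0≤h
    0<c : 0ℤ < c
    0<c = 0<* (0<* 0<q-1 (0<* 0<q 0<x)) 0<q
    r₁ : ∀ q x δ → (q - 1ℤ) * (q * x) * q * ((q - 1ℤ) * δ) ≡ q * (q * x) * ((q - 1ℤ) * (q - 1ℤ) * δ)
    r₁ = solve-∀
    r₂ : ∀ q Q ε n₂ n₃ → Q * ((q - 1ℤ) * ((ε - 1ℤ) * n₂) + (Q - ε) * (Q - ε) * n₃) ≡ Q * (q - 1ℤ) * (ε - 1ℤ) * n₂ + (Q - ε) * (Q - ε) * (Q * n₃)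
    r₂ = solve-∀
    r₃ : ∀ q x ε n₂ → (q - 1ℤ) * (q * x) * q * ((+ 2 * q - 1ℤ) * x * n₂) ≡
      (q * (q * x) * (q - 1ℤ) * (ε - 1ℤ) * n₂ + (q * (q * x) - ε) * (q * (q * x) - ε) * n₂)
        + ((q * x - ε) * ((q - + 3) * (q * (q * x)) + (ε + q * x)) + (q - 1ℤ) * (q * (q * x))) * n₂
    r₃ = solve-∀

  -- Intersecting families and the elementary point bound.

  module Families {q : ℕ} (𝔽 : FiniteField q) (4≤q : + 4 ≤ + q) (k : ℕ) where
    open FiniteField 𝔽 renaming (_≟_ to _≟F_)
    open Geometry 𝔽 using (V; zeroV; _⊕_; _·_)
    open Space 𝔽
    open Subspaces 𝔽 4≤q (k ℕ.+ k)
    open Counting 𝔽 4≤q (k ℕ.+ k)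
    open Gauss q
    open Lin

    Q : ℤ
    Q = q′ ^ k

    N≡Q² : N ≡ Q * Q
    N≡Q² = ^-distribˡ-+-* q′ k k

    0<Q : 0ℤ < Q
    0<Q = 0<q^ k

    -- Intersections are measured by size, a nonzero subspace having at least q vectors, because
    -- sizes pass to orthogonal complements. `avoid` excludes dictators; the exclusion of dual
    -- dictators enters as a second `Family`, the one of the complements.
    record Family (Z : List Sub) : Set where
      field
        members  : All (Above 𝟘 Q) Z
        distinct : Distinct Z
        meet     : ∀ {A B} → A ∈ Z → B ∈ Z → q′ ≤ ∣ A ⊓ₛ B ∣ₛ
        avoid    : ∀ p → ¬ p ≡ zeroV → ∃ λ A → A ∈ Z × A p ≡ false

    δ : List Sub → V (k ℕ.+ k) → ℤ
    δ Z v = ∑ Z (λ A → ι (A v))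

    big⇒∃ : ∀ {T} → q′ ≤ ∣ T ∣ₛ → ∃ λ x → ¬ x ≡ zeroV × T x ≡ true
    big⇒∃ {T} b with ⊑-proper {𝟘} {T} (subst (_< ∣ T ∣ₛ) (sym ∣𝟘∣) (<-≤-trans (<-≤-trans (+<+ (ℕ.s≤s (ℕ.s≤s ℕ.z≤n))) 4≤q) b))
    ... | x , t , z = x , (λ e → contra (dec-true (x ≟V zeroV) e) z) , t

    ∃⇒big : ∀ {T} → Lin T → ∀ {x} → ¬ x ≡ zeroV → T x ≡ true → q′ ≤ ∣ T ∣ₛ
    ∃⇒big {T} L {x} nz t = ≤-trans (≤-reflexive (trans (sym (*-identityʳ q′)) (sym (∣⟨⟩∣ nz)))) (⊑-size (⟨⟩⊑ {x} {T} L t))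

    ∉⟨⟩ : ∀ {C p x} → Lin C → C p ≡ false → ¬ x ≡ zeroV → C x ≡ true → ⟨ p ⟩ x ≡ false
    ∉⟨⟩ {C} {p} {x} L p∉ nz x∈ = not-true λ e → absurd (+⟨⟩⁻ {𝟘} {p} {x} e)
      where
      absurd : ∃ (λ c → 𝟘 (x ⊕ (c · p)) ≡ true) → ⊥
      absurd (c , z) with c ≟F 0#
      ... | yes refl = nz (trans (sym (trans (cong (x ⊕_) (·-zeroˡ p)) (⊕-idʳ x))) (holds (_ ≟V zeroV) z))
      ... | no c≢0   = contra (·∈⁻ L c c≢0 (⊕∈⁻ L x∈ (subst (λ y → C y ≡ true)
          (sym (trans (⊕-comm (c · p) x) (holds ((x ⊕ (c · p)) ≟V zeroV) z))) (0∈ L)))) p∉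

    infixl 7 _∖_
    _∖_ : Sub → Sub → Sub
    (S ∖ T) x = not (T x) ∧ S x

    ∣∖∣ : ∀ S T → T ⊑ S → ∣ S ∖ T ∣ₛ ≡ ∣ S ∣ₛ - ∣ T ∣ₛ
    ∣∖∣ S T p = trans (∑-cong vs (λ x → ι-∧ (not (T x)) (S x))) (∑-minus T S p)

    cnt : Sub → Sub → ℤ
    cnt D A = ∑V (λ x → ι (D x) * ι (A x))

    cnt-⊓ : ∀ D A → cnt D A ≡ ∣ A ⊓ₛ D ∣ₛ
    cnt-⊓ D A = ∑-cong vs (λ x → trans (*-comm (ι (D x)) _) (sym (ι-∧ (A x) (D x))))

    cnt-∖ : ∀ S T A → T ⊑ S → cnt (S ∖ T) A ≡ ∣ A ⊓ₛ S ∣ₛ - ∣ A ⊓ₛ T ∣ₛ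
    cnt-∖ S T A p = trans (∑-cong vs pt) (trans (∑-- vs (λ x → ι (S x) * ι (A x)) (λ x → ι (T x) * ι (A x))) (cong₂ _-_ (cnt-⊓ S A) (cnt-⊓ T A)))
      where
      pt : ∀ x → ι (not (T x) ∧ S x) * ι (A x) ≡ ι (S x) * ι (A x) - ι (T x) * ι (A x)
      pt x with T x in eq
      ... | true rewrite p x eq = sym (+-inverseʳ (1ℤ * ι (A x)))
      ... | false = sym (+-identityʳ (ι (S x) * ι (A x)))

    0≤cnt : ∀ D A → 0ℤ ≤ cnt D A
    0≤cnt D A = ∑-nonneg vs (λ x → 0≤* (0≤ι (D x)) (0≤ι (A x)))

    -- Interchanging the sums turns incidences of members with `D` into counts of members through
    -- `p` and a second vector.
    cover₁ : ∀ Z p D b → (∀ x → D x ≡ true → ∑ Z (λ A → ι (A p) * ι (A x)) ≤ b) →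
      ∑ Z (λ A → ι (A p) * cnt D A) ≤ ∣ D ∣ₛ * b
    cover₁ Z p D b h = begin
      ∑ Z (λ A → ι (A p) * cnt D A) ≡⟨ ∑-cong Z (λ A → trans (sym (∑-*ˡ vs (ι (A p)) (λ x → ι (D x) * ι (A x))))
            (∑-cong vs (λ x → r (ι (A p)) (ι (D x)) (ι (A x))))) ⟩
      ∑ Z (λ A → ∑V (λ x → ι (D x) * (ι (A p) * ι (A x)))) ≡⟨ ∑-swap Z vs (λ A x → ι (D x) * (ι (A p) * ι (A x))) ⟩
      ∑V (λ x → ∑ Z (λ A → ι (D x) * (ι (A p) * ι (A x)))) ≡⟨ ∑-cong vs (λ x → ∑-*ˡ Z (ι (D x)) (λ A → ι (A p) * ι (A x))) ⟩
      ∑V (λ x → ι (D x) * ∑ Z (λ A → ι (A p) * ι (A x))) ≤⟨ ∑-mono vs bound ⟩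
      ∑V (λ x → ι (D x) * b) ≡⟨ ∑-*ʳ vs b (λ x → ι (D x)) ⟩
      ∣ D ∣ₛ * b                                                    ∎
      where
      open ≤-Reasoning
      r : ∀ a b c → a * (b * c) ≡ b * (a * c)
      r = solve-∀
      bound : ∀ x → ι (D x) * ∑ Z (λ A → ι (A p) * ι (A x)) ≤ ι (D x) * b
      bound x with D x in eq
      ... | true  = subst₂ _≤_ (sym (*-identityˡ _)) (sym (*-identityˡ b)) (h x eq)
      ... | false = ≤-refl

    cover₂ : ∀ Z p D E b → (∀ x y → D x ≡ true → E y ≡ true → ∑ Z (λ A → ι (A p) * (ι (A x) * ι (A y))) ≤ b) →
      ∑ Z (λ A → ι (A p) * (cnt D A * cnt E A)) ≤ ∣ D ∣ₛ * (∣ E ∣ₛ * b)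
    cover₂ Z p D E b h = begin
      ∑ Z (λ A → ι (A p) * (cnt D A * cnt E A)) ≡⟨ ∑-cong Z spread ⟩
      ∑ Z (λ A → ∑V (λ x → ∑V (λ y → f x y A))) ≡⟨ ∑-swap Z vs (λ A x → ∑V (λ y → f x y A)) ⟩
      ∑V (λ x → ∑ Z (λ A → ∑V (λ y → f x y A))) ≡⟨ ∑-cong vs (λ x → ∑-swap Z vs (λ A y → f x y A)) ⟩
      ∑V (λ x → ∑V (λ y → ∑ Z (f x y))) ≡⟨ ∑-cong vs (λ x → ∑-cong vs (λ y → ∑-*ˡ Z (ι (D x) * ι (E y)) (λ A → ι (A p) * (ι (A x) * ι (A y))))) ⟩
      ∑V (λ x → ∑V (λ y → ι (D x) * ι (E y) * ∑ Z (λ A → ι (A p) * (ι (A x) * ι (A y)))))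
            ≤⟨ ∑-mono vs (λ x → ∑-mono vs (bound x)) ⟩
      ∑V (λ x → ∑V (λ y → ι (D x) * ι (E y) * b)) ≡⟨ ∑-cong vs (λ x → trans (∑-cong vs (λ y → *-assoc (ι (D x)) (ι (E y)) b))
            (trans (∑-*ˡ vs (ι (D x)) (λ y → ι (E y) * b)) (cong (ι (D x) *_) (∑-*ʳ vs b (λ y → ι (E y)))))) ⟩
      ∑V (λ x → ι (D x) * (∣ E ∣ₛ * b)) ≡⟨ ∑-*ʳ vs (∣ E ∣ₛ * b) (λ x → ι (D x)) ⟩
      ∣ D ∣ₛ * (∣ E ∣ₛ * b)                                                 ∎
      where
      open ≤-Reasoning
      f : V (k ℕ.+ k) → V (k ℕ.+ k) → Sub → ℤ
      f x y A = ι (D x) * ι (E y) * (ι (A p) * (ι (A x) * ι (A y)))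
      r : ∀ a d e x y → a * (d * x * (e * y)) ≡ d * e * (a * (x * y))
      r = solve-∀
      spread : ∀ A → ι (A p) * (cnt D A * cnt E A) ≡ ∑V (λ x → ∑V (λ y → f x y A))
      spread A = begin-equality
        ι (A p) * (cnt D A * cnt E A) ≡⟨ cong (ι (A p) *_) (sym (∑-*ʳ vs (cnt E A) (λ x → ι (D x) * ι (A x)))) ⟩
        ι (A p) * ∑V (λ x → ι (D x) * ι (A x) * cnt E A) ≡⟨ sym (∑-*ˡ vs (ι (A p)) (λ x → ι (D x) * ι (A x) * cnt E A)) ⟩
        ∑V (λ x → ι (A p) * (ι (D x) * ι (A x) * cnt E A)) ≡⟨ ∑-cong vs (λ x → trans (cong (ι (A p) *_) (sym (∑-*ˡ vs (ι (D x) * ι (A x)) (λ y → ι (E y) * ι (A y)))))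
            (trans (sym (∑-*ˡ vs (ι (A p)) (λ y → ι (D x) * ι (A x) * (ι (E y) * ι (A y)))))
            (∑-cong vs (λ y → r (ι (A p)) (ι (D x)) (ι (E y)) (ι (A x)) (ι (A y)))))) ⟩
        ∑V (λ x → ∑V (λ y → f x y A))                                                 ∎
      bound : ∀ x y → ι (D x) * ι (E y) * ∑ Z (λ A → ι (A p) * (ι (A x) * ι (A y))) ≤ ι (D x) * ι (E y) * b
      bound x y with D x in d | E y in e
      ... | true  | true  = subst₂ _≤_ (sym (*-identityˡ _)) (sym (*-identityˡ b)) (h x y d e)
      ... | true  | false = ≤-refl
      ... | false | _     = ≤-refl

    module _ {Z : List Sub} (fam : Family Z) where
      open Family fam

      lin∈ : ∀ {A} → A ∈ Z → Lin A
      lin∈ i = Above.lin (All.lookup members i)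

      size∈ : ∀ {A} → A ∈ Z → ∣ A ∣ₛ ≡ Q
      size∈ i = Above.size (All.lookup members i)

      private
        through₂ : ∀ p x → ∑ (through x (through p Z)) (λ _ → 1ℤ) ≡ ∑ Z (λ A → ι (A p) * ι (A x))
        through₂ p x = trans (∑-through x (through p Z) (λ _ → 1ℤ)) (trans (∑-through p Z (λ A → ι (A x) * 1ℤ))
          (∑-cong Z (λ A → cong (ι (A p) *_) (*-identityʳ (ι (A x))))))

        through₃ : ∀ p x y → ∑ (through y (through x (through p Z))) (λ _ → 1ℤ) ≡ ∑ Z (λ A → ι (A p) * (ι (A x) * ι (A y)))
        through₃ p x y = trans (∑-through y (through x (through p Z)) (λ _ → 1ℤ)) (trans (∑-through x (through p Z) (λ A → ι (A y) * 1ℤ))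
          (trans (∑-through p Z (λ A → ι (A x) * (ι (A y) * 1ℤ))) (∑-cong Z (λ A → cong (λ z → ι (A p) * (ι (A x) * z)) (*-identityʳ (ι (A y)))))))

      -- An instance of `count` between a line and the whole space. With k = 2 + j the bound
      -- `G (k ℕ.+ j) j` is [2k-2, k-2], written without subtraction.
      line-count : ∀ j {p x} → k ≡ 2 ℕ.+ j → ¬ p ≡ zeroV → ⟨ p ⟩ x ≡ false → ∑ Z (λ A → ι (A p) * ι (A x)) ≤ G (k ℕ.+ j) j
      line-count j {p} {x} k≡ p≢0 x∉ = subst (_≤ G (k ℕ.+ j) j) (through₂ p x)
        (count j 2 k {Q} {⟨ p ⟩ +⟨ x ⟩} {𝟙} (+⟨⟩-lin (⟨⟩-lin {p})) (trans (∣+⟨⟩∣ (⟨⟩-lin {p}) x∉) (cong (q′ *_) (∣⟨⟩∣ p≢0)))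
          (trans (cong (q′ ^_) k≡) (^-distribˡ-+-* q′ 2 j))
          (trans ∑V-1 (trans (cong (q′ ^_) (trans (cong (k ℕ.+_) k≡) (trans (sym (ℕ.+-assoc k 2 j)) (trans (cong (ℕ._+ j) (ℕ.+-comm k 2)) (ℕ.+-assoc 2 k j)))))
            (^-distribˡ-+-* q′ 2 (k ℕ.+ j))))
          𝟙-lin (λ _ _ → refl) (through-above (through-above members)) (All.tabulate (λ _ _ _ → refl))
          (through-distinct (through-distinct distinct)))

      plane-count : ∀ i {p x y} → k ≡ 3 ℕ.+ i → ¬ p ≡ zeroV → ⟨ p ⟩ x ≡ false → (⟨ p ⟩ +⟨ x ⟩) y ≡ false →
        ∑ Z (λ A → ι (A p) * (ι (A x) * ι (A y))) ≤ G (k ℕ.+ i) i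
      plane-count i {p} {x} {y} k≡ p≢0 x∉ y∉ = subst (_≤ G (k ℕ.+ i) i) (through₃ p x y)
        (count i 3 k {Q} {⟨ p ⟩ +⟨ x ⟩ +⟨ y ⟩} {𝟙} (+⟨⟩-lin {⟨ p ⟩ +⟨ x ⟩} {y} (+⟨⟩-lin {⟨ p ⟩} {x} (⟨⟩-lin {p})))
          (trans (∣+⟨⟩∣ (+⟨⟩-lin {⟨ p ⟩} {x} (⟨⟩-lin {p})) y∉) (cong (q′ *_) (trans (∣+⟨⟩∣ (⟨⟩-lin {p}) x∉) (cong (q′ *_) (∣⟨⟩∣ p≢0)))))
          (trans (cong (q′ ^_) k≡) (^-distribˡ-+-* q′ 3 i))
          (trans ∑V-1 (trans (cong (q′ ^_) (trans (cong (k ℕ.+_) k≡) (trans (sym (ℕ.+-assoc k 3 i)) (trans (cong (ℕ._+ i) (ℕ.+-comm k 3)) (ℕ.+-assoc 3 k i)))))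
            (^-distribˡ-+-* q′ 3 (k ℕ.+ i))))
          𝟙-lin (λ _ _ → refl) (through-above (through-above (through-above members))) (All.tabulate (λ _ _ _ → refl))
          (through-distinct (through-distinct (through-distinct distinct))))

      -- A member through `p` meets a member `C` avoiding `p` in at least q - 1 nonzero vectors, and
      -- each of them spans a line with `p`. The result allows at most a third of a family of the
      -- assumed size to pass through one point, which is enough for finding general position in
      -- `spread`.
      point-bound : ∀ j → k ≡ 2 ℕ.+ j → ∀ {p} → ¬ p ≡ zeroV → (q′ - 1ℤ) * δ Z p ≤ (Q - 1ℤ) * G (k ℕ.+ j) j
      point-bound j k≡ {p} p≢0 with avoid p p≢0
      ... | C , C∈ , p∉ = begin
        (q′ - 1ℤ) * δ Z p ≡⟨ sym (∑-*ˡ Z (q′ - 1ℤ) (λ A → ι (A p))) ⟩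
        ∑ Z (λ A → (q′ - 1ℤ) * ι (A p)) ≤⟨ ∑-monoᴬ (All.tabulate (λ {A} i → each A i)) ⟩
        ∑ Z (λ A → ι (A p) * cnt (C ∖ 𝟘) A) ≤⟨ cover₁ Z p (C ∖ 𝟘) (G (k ℕ.+ j) j) (λ x e → line-count j k≡ p≢0
            (∉⟨⟩ {C} {p} {x} (lin∈ C∈) p∉ (λ z → contra (dec-true (x ≟V zeroV) z) (not⁻ (∧⁻ˡ e))) (∧⁻ʳ {not (𝟘 x)} e))) ⟩
        ∣ C ∖ 𝟘 ∣ₛ * G (k ℕ.+ j) j ≡⟨ cong (_* G (k ℕ.+ j) j) (trans (∣∖∣ C 𝟘 (𝟘⊑ (lin∈ C∈))) (cong₂ _-_ (size∈ C∈) ∣𝟘∣)) ⟩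
        (Q - 1ℤ) * G (k ℕ.+ j) j                             ∎
        where
        open ≤-Reasoning
        each : ∀ A → A ∈ Z → (q′ - 1ℤ) * ι (A p) ≤ ι (A p) * cnt (C ∖ 𝟘) A
        each A i = ≤-trans (≤-reflexive (*-comm (q′ - 1ℤ) (ι (A p)))) (*-monoˡ (ι (A p)) (0≤ι (A p))
          (≤-trans (+-monoˡ-≤ -1ℤ (meet i C∈)) (≤-reflexive (sym (trans (cnt-∖ C 𝟘 A (𝟘⊑ (lin∈ C∈)))
            (cong (λ z → ∣ A ⊓ₛ C ∣ₛ - z) (trans (∑-cong vs (λ x → cong ι (bool-ext (∧⁻ʳ {A x}) (λ e → ∧⁺ (𝟘⊑ (lin∈ i) x e) e)))) ∣𝟘∣)))))))

  -- The improved point bound from two members avoiding the point.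

  module Pencils {q : ℕ} (𝔽 : FiniteField q) (4≤q : + 4 ≤ + q) (k i : ℕ) (k≡ : k ≡ 3 ℕ.+ i) where
    open FiniteField 𝔽 renaming (_≟_ to _≟F_)
    open Geometry 𝔽 using (V; zeroV; _⊕_; _·_)
    open Space 𝔽
    open Subspaces 𝔽 4≤q (k ℕ.+ k)
    open Counting 𝔽 4≤q (k ℕ.+ k)
    open Families 𝔽 4≤q k
    open Gauss q
    open Lin

    -- The coefficients [2k-2, k-2] and [2k-3, k-3], which bound the number of members through a
    -- line and through a plane, and q^(k-2).
    n₂ n₃ X : ℤ
    n₂ = G (k ℕ.+ suc i) (suc i)
    n₃ = G (k ℕ.+ i) i
    X  = q′ ^ suc i

    k≡2 : k ≡ 2 ℕ.+ suc i
    k≡2 = k≡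

    Q≡ : Q ≡ q′ * (q′ * X)
    Q≡ = cong (q′ ^_) k≡

    0<X : 0ℤ < X
    0<X = 0<q^ (suc i)

    -- By `G-step` the ratio of `n₂` to `n₃` is (Q X - 1) / (X - 1), which is at least Q.
    Q*n₃≤n₂ : Q * n₃ ≤ n₂
    Q*n₃≤n₂ = *-cancelˡ (X - 1ℤ) (0<q^-1 i) (begin
      (X - 1ℤ) * (Q * n₃) ≤⟨ ≤-gap ((Q - 1ℤ) * n₃) (0≤* (i≤j⇒0≤j-i (1≤q^ k)) (0≤G (k ℕ.+ i) i)) (r X Q n₃) ⟩
      (Q * X - 1ℤ) * n₃ ≡⟨ cong (λ z → (z - 1ℤ) * n₃) (trans (sym (^-distribˡ-+-* q′ k (suc i))) (cong (q′ ^_) (ℕ.+-suc k i))) ⟩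
      (q′ ^ suc (k ℕ.+ i) - 1ℤ) * n₃ ≡⟨ sym (G-step (k ℕ.+ i) i) ⟩
      (X - 1ℤ) * G (suc (k ℕ.+ i)) (suc i) ≡⟨ cong (λ z → (X - 1ℤ) * G z (suc i)) (sym (ℕ.+-suc k i)) ⟩
      (X - 1ℤ) * n₂                    ∎)
      where
      open ≤-Reasoning
      r : ∀ X Q n → (Q * X - 1ℤ) * n ≡ (X - 1ℤ) * (Q * n) + (Q - 1ℤ) * n
      r = solve-∀

    1+q≤n₂ : 1ℤ + q′ ≤ n₂
    1+q≤n₂ = begin
      1ℤ + q′ ≡⟨ cong (_+_ 1ℤ) (sym (*-identityʳ q′)) ⟩
      1ℤ + q′ * 1ℤ ≤⟨ +-mono-≤ (1≤G k i) (≤-trans (*-monoˡ q′ 0≤q (1≤q^ i)) (≤-trans (≤-reflexive (sym (*-identityʳ X)))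
                                                      (*-monoˡ X (<⇒≤ 0<X) (subst (λ z → 1ℤ ≤ G z (suc i)) (sym e) (1≤G (2 ℕ.+ i) (suc i)))))) ⟩
      n₃ + X * G (k ℕ.+ i) (suc i) ≡⟨ sym (G-pascal (k ℕ.+ i) i) ⟩
      G (suc (k ℕ.+ i)) (suc i) ≡⟨ cong (λ z → G z (suc i)) (sym (ℕ.+-suc k i)) ⟩
      n₂                                         ∎
      where
      open ≤-Reasoning
      e : k ℕ.+ i ≡ (2 ℕ.+ i) ℕ.+ suc i
      e = trans (cong (ℕ._+ i) k≡) (sym (ℕ.+-suc (2 ℕ.+ i) i))

    0≤n₂ : 0ℤ ≤ n₂
    0≤n₂ = 0≤G (k ℕ.+ suc i) (suc i)

    ∣⊓𝟘∣ : ∀ {A} → Lin A → ∣ A ⊓ₛ 𝟘 ∣ₛ ≡ 1ℤ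
    ∣⊓𝟘∣ {A} L = trans (∑-cong vs (λ x → cong ι (bool-ext (∧⁻ʳ {A x}) (λ e → ∧⁺ (𝟘⊑ L x e) e)))) ∣𝟘∣

    module _ {p : V (k ℕ.+ k)} where
      -- The modular law: the intersection is the span of `p` and the part of `C` in `D +⟨ p ⟩`. As
      -- the left side is symmetric in `C` and `D`, the two traces `E` and `E′` below have equal
      -- size.
      ∣+⟨⟩⊓+⟨⟩∣ : ∀ {C D} → Lin C → Lin D → C p ≡ false → ∣ (C +⟨ p ⟩) ⊓ₛ (D +⟨ p ⟩) ∣ₛ ≡ q′ * ∣ C ⊓ₛ (D +⟨ p ⟩) ∣ₛ
      ∣+⟨⟩⊓+⟨⟩∣ {C} {D} L M p∉ = trans (∑-cong vs (λ x → cong ι (bool-ext (to x) (from x))))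
          (∣+⟨⟩∣ (⊓-lin L LD) (not-true (λ e → contra (∧⁻ˡ e) p∉)))
        where
        LD : Lin (D +⟨ p ⟩)
        LD = +⟨⟩-lin M
        to : (C +⟨ p ⟩) ⊓ₛ (D +⟨ p ⟩) ⊑ (C ⊓ₛ (D +⟨ p ⟩)) +⟨ p ⟩
        to x e with +⟨⟩⁻ {C} {p} (∧⁻ˡ e)
        ... | c , r = +⟨⟩⁺ {C ⊓ₛ (D +⟨ p ⟩)} {p} c (∧⁺ r (⊕∈ LD (∧⁻ʳ {(C +⟨ p ⟩) x} e) (·∈ LD c (∈+⟨⟩ {D} {p} M))))
        from : (C ⊓ₛ (D +⟨ p ⟩)) +⟨ p ⟩ ⊑ (C +⟨ p ⟩) ⊓ₛ (D +⟨ p ⟩)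
        from = +⟨⟩-least (⊓-lin (+⟨⟩-lin L) LD) (λ x e → ∧⁺ (⊑+⟨⟩ {C} {p} x (∧⁻ˡ e)) (∧⁻ʳ {C x} e))
          (∧⁺ (∈+⟨⟩ {C} {p} L) (∈+⟨⟩ {D} {p} M))

    module _ {Z : List Sub} (fam : Family Z) {p : V (k ℕ.+ k)} (p≢0 : ¬ p ≡ zeroV) {C₁ : Sub} (C₁∈ : C₁ ∈ Z) (p∉C₁ : C₁ p ≡ false) where
      open Family fam

      private
        W₁ : Sub
        W₁ = C₁ +⟨ p ⟩
        L₁ : Lin C₁
        L₁ = lin∈ fam C₁∈

      -- Members through p meet both C₁ and C₂: either in a point of E, or in points x ∈ C₁, y ∈ C₂ for which p, x, y are independent.
      pencil-bound : ∀ {C₂} → C₂ ∈ Z → C₂ p ≡ false → ∀ {z} → C₂ z ≡ true → W₁ z ≡ false →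
        (q′ - 1ℤ) * δ Z p ≤ (+ 2 * q′ - 1ℤ) * X * n₂
      pencil-bound {C₂} C₂∈ p∉C₂ {z} z∈ z∉ = pencil-arith q′ X Q ε (δ Z p) n₂ n₃ Q≡ 4≤q 0<X 0≤ε ε≤h 0≤n₂ Q*n₃≤n₂ (begin
        (q′ - 1ℤ) * (q′ - 1ℤ) * δ Z p ≡⟨ sym (∑-*ˡ Z ((q′ - 1ℤ) * (q′ - 1ℤ)) (λ A → ι (A p))) ⟩
        ∑ Z (λ A → (q′ - 1ℤ) * (q′ - 1ℤ) * ι (A p)) ≤⟨ ∑-monoᴬ (All.tabulate (λ {A} i → each A i)) ⟩
        ∑ Z (λ A → (q′ - 1ℤ) * (ι (A p) * cnt (E ∖ 𝟘) A) + ι (A p) * (cnt (C₁ ∖ E) A * cnt (C₂ ∖ E′) A))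
            ≡⟨ trans (∑-+ Z (λ A → (q′ - 1ℤ) * (ι (A p) * cnt (E ∖ 𝟘) A)) _) (cong (_+ ∑ Z (λ A → ι (A p) * (cnt (C₁ ∖ E) A * cnt (C₂ ∖ E′) A))) (∑-*ˡ Z (q′ - 1ℤ) (λ A → ι (A p) * cnt (E ∖ 𝟘) A))) ⟩
        (q′ - 1ℤ) * ∑ Z (λ A → ι (A p) * cnt (E ∖ 𝟘) A) + ∑ Z (λ A → ι (A p) * (cnt (C₁ ∖ E) A * cnt (C₂ ∖ E′) A))
            ≤⟨ +-mono-≤ (*-monoˡ (q′ - 1ℤ) (<⇒≤ 0<q-1) (cover₁ Z p (E ∖ 𝟘) n₂ lines)) (cover₂ Z p (C₁ ∖ E) (C₂ ∖ E′) n₃ planes) ⟩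
        (q′ - 1ℤ) * (∣ E ∖ 𝟘 ∣ₛ * n₂) + ∣ C₁ ∖ E ∣ₛ * (∣ C₂ ∖ E′ ∣ₛ * n₃) ≡⟨ cong₂ (λ a b → (q′ - 1ℤ) * (a * n₂) + b) (trans (∣∖∣ E 𝟘 (𝟘⊑ LE)) (cong (λ z → ε - z) ∣𝟘∣))
            (trans (cong₂ (λ a b → a * (b * n₃)) (trans (∣∖∣ C₁ E (λ x → ∧⁻ˡ)) (cong (_- ε) (size∈ fam C₁∈)))
            (trans (∣∖∣ C₂ E′ (λ x → ∧⁻ˡ)) (cong₂ _-_ (size∈ fam C₂∈) ε′≡ε))) (sym (*-assoc (Q - ε) (Q - ε) n₃))) ⟩
        (q′ - 1ℤ) * ((ε - 1ℤ) * n₂) + (Q - ε) * (Q - ε) * n₃                                ∎)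
        where
        open ≤-Reasoning
        L₂ : Lin C₂
        L₂ = lin∈ fam C₂∈
        W₂ E E′ : Sub
        W₂ = C₂ +⟨ p ⟩
        E  = C₁ ⊓ₛ W₂
        E′ = C₂ ⊓ₛ W₁
        LE : Lin E
        LE = ⊓-lin L₁ (+⟨⟩-lin L₂)
        LE′ : Lin E′
        LE′ = ⊓-lin L₂ (+⟨⟩-lin L₁)
        ε : ℤ
        ε = ∣ E ∣ₛ
        0≤ε : 0ℤ ≤ ε
        0≤ε = ∑-nonneg vs (λ x → 0≤ι (E x))
        ε′≡ε : ∣ E′ ∣ₛ ≡ ε
        ε′≡ε = *-cancelˡ-≡′ q′ 0<q (trans (sym (∣+⟨⟩⊓+⟨⟩∣ L₂ L₁ p∉C₂)) (trans
          (∑-cong vs (λ x → cong ι (bool-ext (λ e → ∧⁺ (∧⁻ʳ {W₂ x} e) (∧⁻ˡ e)) (λ e → ∧⁺ (∧⁻ʳ {W₁ x} e) (∧⁻ˡ e)))))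
          (∣+⟨⟩⊓+⟨⟩∣ L₁ L₂ p∉C₁)))
        -- The vector `z` makes `E′` a proper subspace of `C₂`, so it has at most q^(k-1) vectors.
        ε≤h : ε ≤ q′ * X
        ε≤h = *-cancelˡ q′ 0<q (≤-trans (≤-reflexive (cong (q′ *_) (sym ε′≡ε)))
          (≤-trans (proper-size LE′ L₂ (λ x → ∧⁻ˡ) z∈ (not-true (λ e → contra (∧⁻ʳ {C₂ z} e) z∉))) (≤-reflexive (trans (size∈ fam C₂∈) Q≡))))
        lines : ∀ x → (E ∖ 𝟘) x ≡ true → ∑ Z (λ A → ι (A p) * ι (A x)) ≤ n₂
        lines x e = line-count fam (suc i) k≡2 p≢0 (∉⟨⟩ {C₁} {p} {x} L₁ p∉C₁
          (λ z → contra (dec-true (x ≟V zeroV) z) (not⁻ (∧⁻ˡ e))) (∧⁻ˡ (∧⁻ʳ {not (𝟘 x)} e)))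
        planes : ∀ x y → (C₁ ∖ E) x ≡ true → (C₂ ∖ E′) y ≡ true → ∑ Z (λ A → ι (A p) * (ι (A x) * ι (A y))) ≤ n₃
        planes x y ex ey = plane-count fam i k≡ p≢0
            (∉⟨⟩ {C₁} {p} {x} L₁ p∉C₁ (λ z → contra (trans (cong E z) (0∈ LE)) (not⁻ (∧⁻ˡ ex))) x∈)
            -- Both `p` and `x` lie in `W₁`, so a `y` in their span would be in C₂ ∩ W₁, which is
            -- `E′`.
            (not-true (λ e → contra (∧⁺ (∧⁻ʳ {not (E′ y)} ey) (span⊑ y e)) (not⁻ (∧⁻ˡ ey))))
          where
          x∈ : C₁ x ≡ true
          x∈ = ∧⁻ʳ {not (E x)} ex
          span⊑ : ⟨ p ⟩ +⟨ x ⟩ ⊑ W₁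
          span⊑ = +⟨⟩-least {⟨ p ⟩} {x} (+⟨⟩-lin L₁) (⟨⟩⊑ {p} {W₁} (+⟨⟩-lin L₁) (∈+⟨⟩ {C₁} {p} L₁)) (⊑+⟨⟩ {C₁} {p} x x∈)
        each : ∀ A → A ∈ Z → (q′ - 1ℤ) * (q′ - 1ℤ) * ι (A p) ≤ (q′ - 1ℤ) * (ι (A p) * cnt (E ∖ 𝟘) A) + ι (A p) * (cnt (C₁ ∖ E) A * cnt (C₂ ∖ E′) A)
        each A A∈ with A p in p∈
        ... | false = ≤-reflexive (trans (*-zeroʳ ((q′ - 1ℤ) * (q′ - 1ℤ))) (sym (trans (+-identityʳ _) (*-zeroʳ (q′ - 1ℤ)))))
        ... | true with search (λ x → (A ⊓ₛ E) x ∧ not (𝟘 x))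
        ... | inj₁ (x , e) = ≤-trans (≤-reflexive (r (q′ - 1ℤ))) (≤-trans (+-mono-≤ (*-monoˡ (q′ - 1ℤ) (<⇒≤ 0<q-1) big) (0≤* (0≤cnt (C₁ ∖ E) A) (0≤cnt (C₂ ∖ E′) A)))
                  (≤-reflexive (sym (cong₂ _+_ (cong ((q′ - 1ℤ) *_) (*-identityˡ _)) (*-identityˡ _)))))
          where
          r : ∀ a → a * a * 1ℤ ≡ a * a + 0ℤ
          r = solve-∀
          LA : Lin A
          LA = lin∈ fam A∈
          big : q′ - 1ℤ ≤ cnt (E ∖ 𝟘) A
          big = ≤-trans (+-monoˡ-≤ -1ℤ (∃⇒big (⊓-lin LA LE) {x} (λ z → contra (dec-true (x ≟V zeroV) z) (not⁻ (∧⁻ʳ {(A ⊓ₛ E) x} e))) (∧⁻ˡ e)))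
            (≤-reflexive (sym (trans (cnt-∖ E 𝟘 A (𝟘⊑ LE)) (cong (λ z → ∣ A ⊓ₛ E ∣ₛ - z) (∣⊓𝟘∣ LA)))))
        -- Now `A` meets `E`, and therefore also `E′`, only in 0. So `A` has at least q - 1 vectors
        -- in `C₁` outside `E` and in `C₂` outside `E′`, and (q - 1)² pairs of them.
        ... | inj₂ none = ≤-trans (≤-reflexive (r (q′ - 1ℤ))) (≤-trans (+-mono-≤ (0≤* (<⇒≤ 0<q-1) (0≤cnt (E ∖ 𝟘) A)) both)
                  (≤-reflexive (sym (cong₂ _+_ (cong ((q′ - 1ℤ) *_) (*-identityˡ _)) (*-identityˡ _)))))
          where
          r : ∀ a → a * a * 1ℤ ≡ 0ℤ + a * a
          r = solve-∀
          LA : Lin A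
          LA = lin∈ fam A∈
          A⊓E⊑𝟘 : A ⊓ₛ E ⊑ 𝟘
          A⊓E⊑𝟘 x e = strip e (none x)
            where strip : ∀ {a b} → a ≡ true → a ∧ not b ≡ false → b ≡ true
                  strip {b = true} _ _ = refl
                  strip {b = false} refl ()
          -- For `y` in the intersection some y + c p lies in `C₁`, hence in A ∩ E, so it is 0. If c
          -- were nonzero, `p` would be a multiple of `y` and lie in `C₂`; thus c = 0 and y = 0.
          A⊓E′⊑𝟘 : A ⊓ₛ E′ ⊑ 𝟘
          A⊓E′⊑𝟘 y e with +⟨⟩⁻ {C₁} {p} (∧⁻ʳ {C₂ y} (∧⁻ʳ {A y} e))
          ... | c , r′ with c ≟F 0#
          ...   | yes refl = subst (λ v → 𝟘 v ≡ true) y₀≡y (A⊓E⊑𝟘 _ (∧⁺ (subst (λ v → A v ≡ true) (sym y₀≡y) (∧⁻ˡ e))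
                      (∧⁺ r′ (⊑+⟨⟩ {C₂} {p} _ (subst (λ v → C₂ v ≡ true) (sym y₀≡y) (∧⁻ˡ (∧⁻ʳ {A y} e)))))))
            where y₀≡y : y ⊕ (0# · p) ≡ y
                  y₀≡y = trans (cong (y ⊕_) (·-zeroˡ p)) (⊕-idʳ y)
          ...   | no c≢0 = contra (·∈⁻ L₂ c c≢0 (⊕∈⁻ L₂ (∧⁻ˡ (∧⁻ʳ {A y} e)) (subst (λ v → C₂ v ≡ true)
                      (trans (sym (holds (_ ≟V zeroV) (A⊓E⊑𝟘 (y ⊕ (c · p)) (∧⁺ (⊕∈ LA (∧⁻ˡ e) (·∈ LA c p∈)) (∧⁺ r′
                        (⊕∈ (+⟨⟩-lin L₂) (⊑+⟨⟩ {C₂} {p} y (∧⁻ˡ (∧⁻ʳ {A y} e))) (·∈ (+⟨⟩-lin L₂) c (∈+⟨⟩ {C₂} {p} L₂)))))))) (⊕-comm y (c · p))) (0∈ L₂)))) p∉C₂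
          part : ∀ {C F} → C ∈ Z → F ⊑ C → A ⊓ₛ F ⊑ 𝟘 → q′ - 1ℤ ≤ cnt (C ∖ F) A
          part {C} {F} C∈ F⊑ small = ≤-trans (+-mono-≤ (meet A∈ C∈) (neg-mono-≤ (≤-trans (⊑-size small) (≤-reflexive ∣𝟘∣)))) (≤-reflexive (sym (cnt-∖ C F A F⊑)))
          both : (q′ - 1ℤ) * (q′ - 1ℤ) ≤ cnt (C₁ ∖ E) A * cnt (C₂ ∖ E′) A
          both = ≤-trans (*-monoˡ (q′ - 1ℤ) (<⇒≤ 0<q-1) (part C₂∈ (λ x → ∧⁻ˡ) A⊓E′⊑𝟘))
            (*-monoʳ (cnt (C₂ ∖ E′) A) (0≤cnt (C₂ ∖ E′) A) (part C₁∈ (λ x → ∧⁻ˡ) A⊓E⊑𝟘))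

    G-self : ∀ a → G a a ≡ 1ℤ
    G-self zero    = refl
    G-self (suc a) = trans (*-cancelˡ-≡′ (q′ ^ suc a - 1ℤ) (0<q^-1 a) (G-step a a)) (G-self a)

    G-coatoms : ∀ a → (q′ - 1ℤ) * G (suc a) a ≡ q′ ^ suc a - 1ℤ
    G-coatoms a = *-cancelˡ-≡′ (q′ ^ a) (0<q^ a) (begin
      q′ ^ a * ((q′ - 1ℤ) * G (suc a) a) ≡⟨ r q′ (q′ ^ a) (G (suc a) a) ⟩
      (q′ * q′ ^ a - q′ ^ a) * G (suc a) a ≡⟨ G-shift a a ⟩
      q′ ^ a * (q′ ^ suc a - 1ℤ) * G a a ≡⟨ cong (q′ ^ a * (q′ ^ suc a - 1ℤ) *_) (G-self a) ⟩
      q′ ^ a * (q′ ^ suc a - 1ℤ) * 1ℤ ≡⟨ *-identityʳ _ ⟩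
      q′ ^ a * (q′ ^ suc a - 1ℤ)             ∎)
      where
      open ≡-Reasoning
      r : ∀ q A g → A * ((q - 1ℤ) * g) ≡ (q * A - A) * g
      r = solve-∀

    module _ {Z : List Sub} (fam : Family Z) (large : + 3 * ((Q - 1ℤ) * n₂) ≤ (q′ - 1ℤ) * ∑ Z (λ _ → 1ℤ)) where
      open Family fam

      -- Otherwise all members avoiding `p` lie in the (k+1)-dimensional span of `C` and `p`, which
      -- has only (q^(k+1) - 1) / (q - 1) subspaces of dimension k. Together with `point-bound` for
      -- the members through `p` this is fewer than `large` demands.
      spread : ∀ {p} → ¬ p ≡ zeroV → ∀ {C} → C ∈ Z → C p ≡ false →
        ∃ λ D → D ∈ Z × D p ≡ false × ∃ λ z → D z ≡ true × (C +⟨ p ⟩) z ≡ false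
      spread {p} p≢0 {C} C∈ p∉ with Any.any? (λ D → (not (D p) ∧ V∑.anyᵇ (λ z → D z ∧ not ((C +⟨ p ⟩) z))) Bool.≟ true) Z
      ... | yes a with find a
      ... | D , D∈ , e with V∑.anyᵇ⁻ (λ z → D z ∧ not ((C +⟨ p ⟩) z)) (∧⁻ʳ {not (D p)} e)
      ...     | z , ez = D , D∈ , not⁻ (∧⁻ˡ e) , z , ∧⁻ˡ ez , not⁻ (∧⁻ʳ {D z} ez)
      spread {p} p≢0 {C} C∈ p∉ | no none = ⊥-elim (<⇒≱ gap (≤-trans large upper))
        where
        W : Sub
        W = C +⟨ p ⟩
        Z₀ : List Sub
        Z₀ = filter (λ A → not (A p) Bool.≟ true) Z
        inside : All (_⊑ W) Z₀
        inside = All.zipWith (λ { {A} (f , e) x x∈ → sub A f (holds (_ Bool.≟ true) (dec-true (_ Bool.≟ true) e)) x x∈ })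
            (All.filter⁺ (λ A → not (A p) Bool.≟ true) (All.tabulate (λ i e → none (lose i e))) , All.all-filter (λ A → not (A p) Bool.≟ true) Z)
          where
          sub : ∀ A → ¬ (not (A p) ∧ V∑.anyᵇ (λ z → A z ∧ not (W z)) ≡ true) → not (A p) ≡ true → A ⊑ W
          sub A f e x x∈ with W x in eq
          ... | true  = refl
          ... | false = ⊥-elim (f (∧⁺ e (V∑.anyᵇ⁺ (λ z → A z ∧ not (W z)) x (∧⁺ x∈ (not⁺ eq)))))
        few : ∑ Z₀ (λ _ → 1ℤ) ≤ G (suc k) k
        few = count k 0 1 {Q} {𝟘} {W} 𝟘-lin ∣𝟘∣ (sym (*-identityˡ Q))
          (trans (∣+⟨⟩∣ (lin∈ fam C∈) p∉) (trans (cong (q′ *_) (size∈ fam C∈)) (sym (*-identityˡ _))))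
          (+⟨⟩-lin (lin∈ fam C∈)) (𝟘⊑ (+⟨⟩-lin (lin∈ fam C∈)))
          (All.filter⁺ (λ A → not (A p) Bool.≟ true) members) inside (AllPairs.filter⁺ (λ A → not (A p) Bool.≟ true) distinct)
        split : ∑ Z (λ _ → 1ℤ) ≡ δ Z p + ∑ Z₀ (λ _ → 1ℤ)
        split = trans (trans (∑-cong Z (λ A → each (A p))) (∑-+ Z (λ A → ι (A p)) _)) (cong (_+_ (δ Z p)) (sym (∑-filter (λ A → not (A p) Bool.≟ true) Z (λ _ → 1ℤ))))
          where each : ∀ b → 1ℤ ≡ ι b + ⟦ not b Bool.≟ true ⟧ * 1ℤ
                each true  = refl
                each false = refl
        upper : (q′ - 1ℤ) * ∑ Z (λ _ → 1ℤ) ≤ (Q - 1ℤ) * n₂ + (q′ * Q - 1ℤ)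
        upper = begin
          (q′ - 1ℤ) * ∑ Z (λ _ → 1ℤ) ≡⟨ trans (cong ((q′ - 1ℤ) *_) split) (*-distribˡ-+ (q′ - 1ℤ) (δ Z p) _) ⟩
          (q′ - 1ℤ) * δ Z p + (q′ - 1ℤ) * ∑ Z₀ (λ _ → 1ℤ) ≤⟨ +-mono-≤ (point-bound fam (suc i) k≡2 p≢0) (*-monoˡ (q′ - 1ℤ) (<⇒≤ 0<q-1) few) ⟩
          (Q - 1ℤ) * n₂ + (q′ - 1ℤ) * G (suc k) k ≡⟨ cong (_+_ ((Q - 1ℤ) * n₂)) (G-coatoms k) ⟩
          (Q - 1ℤ) * n₂ + (q′ * Q - 1ℤ)                                ∎
          where open ≤-Reasoning
        gap : (Q - 1ℤ) * n₂ + (q′ * Q - 1ℤ) < + 3 * ((Q - 1ℤ) * n₂)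
        gap = begin-strict
          (Q - 1ℤ) * n₂ + (q′ * Q - 1ℤ) ≡⟨ sym (+-identityʳ _) ⟩
          (Q - 1ℤ) * n₂ + (q′ * Q - 1ℤ) + 0ℤ <⟨ +-monoʳ-< ((Q - 1ℤ) * n₂ + (q′ * Q - 1ℤ))
            (+-mono-≤-< (0≤* 0≤q (i≤j⇒0≤j-i 2≤Q)) (+-mono-≤-< (0≤* {+ 2} (+≤+ ℕ.z≤n) (i≤j⇒0≤j-i (1≤q^ k))) (+<+ (ℕ.s≤s ℕ.z≤n)))) ⟩
          (Q - 1ℤ) * n₂ + (q′ * Q - 1ℤ) + (q′ * (Q - + 2) + (+ 2 * (Q - 1ℤ) + 1ℤ))
            ≡⟨ r Q q′ n₂ ⟩
          (Q - 1ℤ) * n₂ + + 2 * ((Q - 1ℤ) * (1ℤ + q′)) ≤⟨ +-monoʳ-≤ ((Q - 1ℤ) * n₂) (*-monoˡ (+ 2) (+≤+ ℕ.z≤n) (*-monoˡ (Q - 1ℤ) (i≤j⇒0≤j-i (1≤q^ k)) 1+q≤n₂)) ⟩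
          (Q - 1ℤ) * n₂ + + 2 * ((Q - 1ℤ) * n₂) ≡⟨ r′ ((Q - 1ℤ) * n₂) ⟩
          + 3 * ((Q - 1ℤ) * n₂)                                        ∎
          where
          open ≤-Reasoning
          2≤Q : + 2 ≤ Q
          2≤Q = begin
            + 2 ≤⟨ +≤+ (ℕ.s≤s (ℕ.s≤s ℕ.z≤n)) ⟩
            + 4 ≤⟨ 4≤q ⟩
            q′ ≡⟨ sym (*-identityʳ q′) ⟩
            q′ * 1ℤ ≤⟨ *-monoˡ q′ 0≤q (1≤q^ (2 ℕ.+ i)) ⟩
            q′ * q′ ^ (2 ℕ.+ i) ≡⟨ sym Q≡ ⟩
            Q                  ∎
          r : ∀ Q q n → (Q - 1ℤ) * n + (q * Q - 1ℤ) + (q * (Q - + 2) + (+ 2 * (Q - 1ℤ) + 1ℤ)) ≡ (Q - 1ℤ) * n + + 2 * ((Q - 1ℤ) * (1ℤ + q))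
          r = solve-∀
          r′ : ∀ a → a + + 2 * a ≡ + 3 * a
          r′ = solve-∀

      -- The factor Q - 1 of `point-bound` drops to (2q - 1) Q / q², roughly 2Q / q. This saving is
      -- what makes the final comparison possible.
      point-bound′ : ∀ {p} → ¬ p ≡ zeroV → (q′ - 1ℤ) * δ Z p ≤ (+ 2 * q′ - 1ℤ) * X * n₂
      point-bound′ {p} p≢0 with avoid p p≢0
      ... | C , C∈ , p∉ with spread p≢0 C∈ p∉
      ...   | D , D∈ , p∉D , z , z∈ , z∉ = pencil-bound fam p≢0 C∈ p∉ D∈ p∉D z∈ z∉

  -- The numerical contradiction for q ≥ 4.

  final-arith : ∀ q X Q y n → Q ≡ q * (q * X) → + 4 ≤ q → q ≤ X → 0ℤ < n →
    + 3 * ((Q - 1ℤ) * n) ≤ (q - 1ℤ) * y →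
    + 3 * ((Q - q) * (q - + 2) * ((Q - 1ℤ) * (Q - 1ℤ))) * y ≤
      (q - 1ℤ) * Q * (Q * Q * ((+ 2 * q - 1ℤ) * X * n) + (Q - q) * (y * (Q - 1ℤ) + Q * ((+ 2 * q - 1ℤ) * X * n))) → ⊥
  final-arith q X .(q * (q * X)) y n refl 4≤q q≤X 0<n large main = <⇒≱ lhs<rhs (*-cancelˡ (Q * Q) (0<* 0<Q 0<Q) (begin
    -- (Q - 1)² (Q - q) exceeds Q² (Q - q - 2) by 2Qq + Q - q; dropping this excess allows the
    -- factor Q² to be cancelled.
    Q * Q * (+ 3 * ((Q - q - + 2) * E)) ≤⟨ ≤-gap (+ 3 * (Q * q + Q * q + (Q - q)) * E) (0≤* (0≤* {+ 3} (+≤+ ℕ.z≤n) (0≤+ (0≤+ 0≤Qq 0≤Qq) 0≤Q-q)) 0≤E) (r₃ q Q E) ⟩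
    + 3 * ((Q - 1ℤ) * C) ≤⟨ *-cancelˡ n 0<n step ⟩
    Q * Q * ((q - 1ℤ) * (q - 1ℤ) * (+ 2 * Q - q) * (+ 2 * q - 1ℤ) * X) ∎))
    where
    open ≤-Reasoning
    Q Δ E C r : ℤ
    Q = q * (q * X)
    Δ = (+ 2 * q - 1ℤ) * X * n
    -- Moving all terms with `y` in `main` to one side leaves the coefficient (Q - q)(Q - 1) times 3
    -- (q - 2)(Q - 1) - (q - 1) Q; `E` is this last factor.
    E = (+ 2 * q - + 5) * Q - + 3 * (q - + 2)
    C = (Q - q) * (Q - 1ℤ) * E
    r = q - + 4
    0≤r : 0ℤ ≤ r
    0≤r = i≤j⇒0≤j-i 4≤q
    nat : ∀ m → 0ℤ ≤ + m
    nat m = +≤+ ℕ.z≤n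
    0<q : 0ℤ < q
    0<q = <-≤-trans (+<+ (ℕ.s≤s ℕ.z≤n)) 4≤q
    0≤q : 0ℤ ≤ q
    0≤q = <⇒≤ 0<q
    0<X : 0ℤ < X
    0<X = <-≤-trans 0<q q≤X
    0<Q : 0ℤ < Q
    0<Q = 0<* 0<q (0<* 0<q 0<X)
    0≤Qq : 0ℤ ≤ Q * q
    0≤Qq = 0≤* (<⇒≤ 0<Q) 0≤q
    0≤q-1 : 0ℤ ≤ q - 1ℤ
    0≤q-1 = ≤-trans (nat 3) (+-monoˡ-≤ -1ℤ 4≤q)
    0≤X-1 : 0ℤ ≤ X - 1ℤ
    0≤X-1 = ≤-trans 0≤q-1 (+-monoˡ-≤ -1ℤ q≤X)
    0≤Q-q : 0ℤ ≤ Q - q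
    0≤Q-q = ≤-trans (0≤* 0≤q (0≤+ (0≤* 0≤q 0≤X-1) 0≤q-1)) (≤-reflexive (ring q X))
      where ring : ∀ q X → q * (q * (X - 1ℤ) + (q - 1ℤ)) ≡ q * (q * X) - q
            ring = solve-∀
    0≤Q-1 : 0ℤ ≤ Q - 1ℤ
    0≤Q-1 = ≤-trans (0≤+ 0≤Q-q 0≤q-1) (≤-reflexive (ring q Q))
      where ring : ∀ q Q → Q - q + (q - 1ℤ) ≡ Q - 1ℤ
            ring = solve-∀
    0≤E : 0ℤ ≤ E
    0≤E = ≤-trans (0≤+ (0≤* (0≤+ (0≤+ 0≤r 0≤r) (nat 3)) 0≤Q-q) (0≤+ (0≤* (0≤+ 0≤r 0≤r) 0≤q) (nat 6))) (≤-reflexive (ring q Q))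
      where ring : ∀ q Q → (q - + 4 + (q - + 4) + + 3) * (Q - q) + ((q - + 4 + (q - + 4)) * q + + 6) ≡ (+ 2 * q - + 5) * Q - + 3 * (q - + 2)
            ring = solve-∀
    r₁ : ∀ q Q y Δ → (q - 1ℤ) * (+ 3 * ((Q - q) * (q - + 2) * ((Q - 1ℤ) * (Q - 1ℤ))) * y) - (q - 1ℤ) * ((q - 1ℤ) * Q * (Q * Q * Δ + (Q - q) * (y * (Q - 1ℤ) + Q * Δ))) ≡
         (Q - q) * (Q - 1ℤ) * ((+ 2 * q - + 5) * Q - + 3 * (q - + 2)) * ((q - 1ℤ) * y) - (q - 1ℤ) * (q - 1ℤ) * (Q * Q) * Δ * (+ 2 * Q - q)
    r₁ = solve-∀
    r₂ : ∀ q Q X n → (q - 1ℤ) * (q - 1ℤ) * (Q * Q) * ((+ 2 * q - 1ℤ) * X * n) * (+ 2 * Q - q) ≡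
         n * (Q * Q * ((q - 1ℤ) * (q - 1ℤ) * (+ 2 * Q - q) * (+ 2 * q - 1ℤ) * X))
    r₂ = solve-∀
    r₃ : ∀ q Q E → + 3 * ((Q - 1ℤ) * ((Q - q) * (Q - 1ℤ) * E)) ≡ Q * Q * (+ 3 * ((Q - q - + 2) * E)) + + 3 * (Q * q + Q * q + (Q - q)) * E
    r₃ = solve-∀
    r₄ : ∀ Q n C → n * (+ 3 * ((Q - 1ℤ) * C)) ≡ C * (+ 3 * ((Q - 1ℤ) * n))
    r₄ = solve-∀
    step : n * (+ 3 * ((Q - 1ℤ) * C)) ≤ n * (Q * Q * ((q - 1ℤ) * (q - 1ℤ) * (+ 2 * Q - q) * (+ 2 * q - 1ℤ) * X))
    step = begin
      n * (+ 3 * ((Q - 1ℤ) * C)) ≡⟨ r₄ Q n C ⟩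
      -- `large` bounds (q - 1) y from below and `main` from above; as both bounds are multiples of
      -- `n`, the family disappears and an inequality in q and X remains.
      C * (+ 3 * ((Q - 1ℤ) * n)) ≤⟨ *-monoˡ C (0≤* (0≤* 0≤Q-q 0≤Q-1) 0≤E) large ⟩
      C * ((q - 1ℤ) * y) ≤⟨ i-j≤0⇒i≤j (≤-trans (≤-reflexive (sym (r₁ q Q y Δ))) (i≤j⇒i-j≤0 (*-monoˡ (q - 1ℤ) 0≤q-1 main))) ⟩
      (q - 1ℤ) * (q - 1ℤ) * (Q * Q) * Δ * (+ 2 * Q - q) ≡⟨ r₂ q Q X n ⟩
      n * (Q * Q * ((q - 1ℤ) * (q - 1ℤ) * (+ 2 * Q - q) * (+ 2 * q - 1ℤ) * X)) ∎
    -- As a polynomial in X the difference is α X² - β X + 9 (q² - 4), and α q ≥ β for q ≥ 4.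
    a gap : ℤ
    a   = + 2 * (q * q * q) - + 5 * (q * q) - + 8 * q + + 2
    gap = + 2 * (q * q * q * q * q * q) - + 5 * (q * q * q * q * q) - + 12 * (q * q * q * q) - + 9 * (q * q * q) + + 52 * (q * q) - q
    0≤a : 0ℤ ≤ a
    -- Horner form in q - 4 with nonnegative coefficients, here and for `gap`: this is where q ≥ 4
    -- is decisive.
    0≤a = ≤-trans (0≤+ (nat 18) (0≤* 0≤r (0≤+ (nat 48) (0≤* 0≤r (0≤+ (nat 19) (0≤* 0≤r (nat 2))))))) (≤-reflexive (ring q))
      where ring : ∀ q → + 18 + (q - + 4) * (+ 48 + (q - + 4) * (+ 19 + (q - + 4) * + 2)) ≡ + 2 * (q * q * q) - + 5 * (q * q) - + 8 * q + + 2
            ring = solve-∀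
    0≤gap : 0ℤ ≤ gap
    0≤gap = ≤-trans (0≤+ (nat 252) (0≤* 0≤r (0≤+ (nat 2799) (0≤* 0≤r (0≤+ (nat 3272) (0≤* 0≤r (0≤+ (nat 1559) (0≤* 0≤r (0≤+ (nat 368) (0≤* 0≤r (0≤+ (nat 43) (0≤* 0≤r (nat 2))))))))))))) (≤-reflexive (ring q))
      where ring : ∀ q → + 252 + (q - + 4) * (+ 2799 + (q - + 4) * (+ 3272 + (q - + 4) * (+ 1559 + (q - + 4) * (+ 368 + (q - + 4) * (+ 43 + (q - + 4) * + 2))))) ≡
                   + 2 * (q * q * q * q * q * q) - + 5 * (q * q * q * q * q) - + 12 * (q * q * q * q) - + 9 * (q * q * q) + + 52 * (q * q) - q
            ring = solve-∀
    r₅ : ∀ q X → + 3 * ((q * (q * X) - q - + 2) * ((+ 2 * q - + 5) * (q * (q * X)) - + 3 * (q - + 2))) ≡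
         (q - 1ℤ) * (q - 1ℤ) * (+ 2 * (q * (q * X)) - q) * (+ 2 * q - 1ℤ) * X
         + (X * (q * q * (+ 2 * (q * q * q) - + 5 * (q * q) - + 8 * q + + 2) * (X - q)
           + (+ 2 * (q * q * q * q * q * q) - + 5 * (q * q * q * q * q) - + 12 * (q * q * q * q) - + 9 * (q * q * q) + + 52 * (q * q) - q))
           + (+ 9 * ((q - + 4) * (q + + 4)) + + 108))
    r₅ = solve-∀
    lhs<rhs : (q - 1ℤ) * (q - 1ℤ) * (+ 2 * Q - q) * (+ 2 * q - 1ℤ) * X < + 3 * ((Q - q - + 2) * E)
    lhs<rhs = subst₂ _<_ (+-identityʳ _) (sym (r₅ q X)) (+-monoʳ-< ((q - 1ℤ) * (q - 1ℤ) * (+ 2 * Q - q) * (+ 2 * q - 1ℤ) * X)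
      (+-mono-≤-< (0≤* (<⇒≤ 0<X) (0≤+ (0≤* (0≤* (0≤* 0≤q 0≤q) 0≤a) (i≤j⇒0≤j-i q≤X)) 0≤gap))
        (+-mono-≤-< (0≤* (nat 9) (0≤* 0≤r (0≤+ 0≤q (nat 4)))) (+<+ (ℕ.s≤s ℕ.z≤n)))))

  -- Orthogonal complements of an intersecting family.

  module Duality {q : ℕ} (𝔽 : FiniteField q) (4≤q : + 4 ≤ + q) (k : ℕ) where
    open Geometry 𝔽 using (V; zeroV; _⊕_)
    open Subspaces 𝔽 4≤q (k ℕ.+ k)
    open Transform 𝔽 4≤q (k ℕ.+ k)
    open Counting 𝔽 4≤q (k ℕ.+ k)
    open Families 𝔽 4≤q k

    ∣ᗮ∣ : ∀ {A} → Above 𝟘 Q A → ∣ A ᗮ ∣ₛ ≡ Q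
    ∣ᗮ∣ {A} (above L _ s) = *-cancelˡ-≡′ Q 0<Q (trans (cong (_* ∣ A ᗮ ∣ₛ) (sym s)) (trans (ᗮ-size L) N≡Q²))

    -- For subspaces of half the dimension the prefactors in `ᗮ-size₂` are both Q² and cancel, so
    -- complements intersect exactly as much as the members themselves.
    ∣ᗮ⊓ᗮ∣ : ∀ {A B} → Above 𝟘 Q A → Above 𝟘 Q B → ∣ A ᗮ ⊓ₛ B ᗮ ∣ₛ ≡ ∣ A ⊓ₛ B ∣ₛ
    ∣ᗮ⊓ᗮ∣ {A} {B} (above L _ s) (above M _ t) = *-cancelˡ-≡′ (Q * Q) (0<* 0<Q 0<Q)
      (trans (cong₂ (λ a b → a * b * ∣ A ᗮ ⊓ₛ B ᗮ ∣ₛ) (sym s) (sym t)) (trans (ᗮ-size₂ L M) (cong (_* ∣ A ⊓ₛ B ∣ₛ) N≡Q²)))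

    -- If the complements agree, their intersection has size Q, hence so does A ∩ B, which then
    -- fills both.
    ᗮ-injective : ∀ {A B} → Above 𝟘 Q A → Above 𝟘 Q B → (∀ x → (A ᗮ) x ≡ (B ᗮ) x) → ∀ x → A x ≡ B x
    ᗮ-injective {A} {B} a b e x = bool-ext (λ p → ∧⁻ʳ {A x} (⊑-full {A ⊓ₛ B} {A} (λ y → ∧⁻ˡ) (≤-reflexive (trans (Above.size a) (sym full))) x p))
                                           (λ p → ∧⁻ˡ (⊑-full {A ⊓ₛ B} {B} (λ y → ∧⁻ʳ {A y}) (≤-reflexive (trans (Above.size b) (sym full))) x p))
      where
      full : ∣ A ⊓ₛ B ∣ₛ ≡ Q
      full = trans (sym (∣ᗮ⊓ᗮ∣ a b)) (trans (∑-cong vs (λ y → cong ι (bool-ext ∧⁻ˡ (λ p → ∧⁺ p (trans (sym (e y)) p))))) (∣ᗮ∣ a))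

    dual-distinct : ∀ {Z} → All (Above 𝟘 Q) Z → Distinct Z → Distinct (map _ᗮ Z)
    dual-distinct []       []       = []
    dual-distinct (a ∷ as) (d ∷ ds) = All.map⁺ (All.zipWith (λ { (b , ne) e → ne (ᗮ-injective a b e) }) (as , d)) ∷ dual-distinct as ds

    dual-family : ∀ {Z} → Family Z → (∀ a → ¬ a ≡ zeroV → ∃ λ A → A ∈ Z × (A ᗮ) a ≡ false) → Family (map _ᗮ Z)
    dual-family {Z} fam coavoid = record
      { members  = All.map⁺ (All.map (λ {A} a → above (ᗮ-lin {A}) (𝟘⊑ (ᗮ-lin {A})) (∣ᗮ∣ a)) members)
      ; distinct = dual-distinct members distinct
      ; meet     = λ i j → meet′ (∈-map⁻ _ᗮ i) (∈-map⁻ _ᗮ j)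
      ; avoid    = λ p p≢0 → avoid′ (coavoid p p≢0) }
      where
      open Family fam
      meet′ : ∀ {A B} → ∃ (λ A′ → A′ ∈ Z × A ≡ A′ ᗮ) → ∃ (λ B′ → B′ ∈ Z × B ≡ B′ ᗮ) → q′ ≤ ∣ A ⊓ₛ B ∣ₛ
      meet′ (A , i , refl) (B , j , refl) = subst (q′ ≤_) (sym (∣ᗮ⊓ᗮ∣ (All.lookup members i) (All.lookup members j))) (meet i j)
      avoid′ : ∀ {p} → ∃ (λ A → A ∈ Z × (A ᗮ) p ≡ false) → ∃ λ A → A ∈ map _ᗮ Z × A p ≡ false
      avoid′ (A , i , e) = A ᗮ , ∈-map⁺ _ᗮ i , e

  -- The centred weight, its transform and the triple correlation.

  module Weight {q : ℕ} (𝔽 : FiniteField q) (4≤q : + 4 ≤ + q) (k : ℕ)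
    {Z : List (Subspaces.Sub 𝔽 4≤q (k ℕ.+ k))} (fam : Families.Family 𝔽 4≤q k Z) where
    open FiniteField 𝔽 renaming (_≟_ to _≟F_)
    open Geometry 𝔽 using (V; zeroV; _⊕_)
    open Space 𝔽
    open Subspaces 𝔽 4≤q (k ℕ.+ k)
    open Transform 𝔽 4≤q (k ℕ.+ k)
    open Moments 𝔽 4≤q (k ℕ.+ k)
    open Counting 𝔽 4≤q (k ℕ.+ k)
    open Families 𝔽 4≤q k
    open Lin
    open Family fam

    private
      Vec₂ : Set
      Vec₂ = V (k ℕ.+ k)

    y s : ℤ
    y = ∑ Z (λ _ → 1ℤ)
    s = Q + 1ℤ

    0≤y : 0ℤ ≤ y
    0≤y = ∑-nonneg Z (λ _ → +≤+ ℕ.z≤n)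

    ζ : Vec₂ → ℤ
    ζ v = ι (𝟘 v)

    -- (q^k + 1) times the deviation of δ from its mean over nonzero vectors.
    w : Vec₂ → ℤ
    w v = s * δ Z v - y - y * Q * ζ v

    δ* : Vec₂ → ℤ
    δ* = δ (map _ᗮ Z)

    -- Obtained term by term from `w`: `δ Z` transforms into Q `δ*`, the constant 1 into N `ζ`, and
    -- `ζ` into the constant 1.
    ŵ : Vec₂ → ℤ
    ŵ a = s * (Q * δ* a) - y * N * ζ a - y * Q

    ζ-0 : ζ zeroV ≡ 1ℤ
    ζ-0 = cong ι (0∈ 𝟘-lin)

    ∑-ζ : ∀ f → ∑V (λ v → ζ v * f v) ≡ f zeroV
    ∑-ζ f = V∑.sift zeroV f

    δ-0 : ∀ Z → All (Above 𝟘 Q) Z → δ Z zeroV ≡ ∑ Z (λ _ → 1ℤ)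
    δ-0 Z h = ∑-congᴬ (All.map (λ a → cong ι (0∈ (Above.lin a))) h)

    ∑-δ : ∑V (δ Z) ≡ y * Q
    ∑-δ = trans (∑-swap vs Z (λ v A → ι (A v))) (trans (∑-congᴬ (All.map (λ a → trans (Above.size a) (sym (*-identityˡ Q))) members)) (∑-*ʳ Z Q (λ _ → 1ℤ)))

    w-0 : w zeroV ≡ 0ℤ
    w-0 = trans (cong₂ (λ a b → s * a - y - y * Q * b) (δ-0 Z members) ζ-0) (ring Q y)
      where ring : ∀ Q y → (Q + 1ℤ) * y - y - y * Q * 1ℤ ≡ 0ℤ
            ring = solve-∀

    ∑-w : ∑V w ≡ 0ℤ
    ∑-w = begin
      ∑V w ≡⟨ trans (∑-- vs (λ v → s * δ Z v - y) (λ v → y * Q * ζ v)) (cong (_- ∑V (λ v → y * Q * ζ v)) (∑-- vs (λ v → s * δ Z v) (λ _ → y))) ⟩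
      ∑V (λ v → s * δ Z v) - ∑V (λ v → y) - ∑V (λ v → y * Q * ζ v) ≡⟨ cong₂ _-_ (cong₂ _-_ (trans (∑-*ˡ vs s (δ Z)) (cong (s *_) ∑-δ)) (trans (∑V-const y) (cong (_* y) N≡Q²)))
            (trans (∑-*ˡ vs (y * Q) ζ) (cong (y * Q *_) ∣𝟘∣)) ⟩
      s * (y * Q) - Q * Q * y - y * Q * 1ℤ ≡⟨ ring Q y ⟩
      0ℤ                                                            ∎
      where
      open ≡-Reasoning
      ring : ∀ Q y → (Q + 1ℤ) * (y * Q) - Q * Q * y - y * Q * 1ℤ ≡ 0ℤ
      ring = solve-∀

    w-homogeneous : Homogeneous w
    w-homogeneous c nz v = cong₂ (λ a b → s * a - y - y * Q * b)
      (∑-congᴬ (All.map (λ a → cong ι (scale (Above.lin a) c nz v)) members)) (cong ι (scale 𝟘-lin c nz v))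

    w-even : ∀ v → w (⊖ v) ≡ w v
    w-even = w-homogeneous -1F -1F≢0

    δ-transform : HasTransform (δ Z) (λ a → Q * δ* a)
    δ-transform a c = begin
      ∑V (λ v → δ Z v * χ (c +F ⟪ a , v ⟫)) ≡⟨ ∑-cong vs (λ v → sym (∑-*ʳ Z (χ (c +F ⟪ a , v ⟫)) (λ A → ι (A v)))) ⟩
      ∑V (λ v → ∑ Z (λ A → ι (A v) * χ (c +F ⟪ a , v ⟫))) ≡⟨ ∑-swap vs Z (λ v A → ι (A v) * χ (c +F ⟪ a , v ⟫)) ⟩
      ∑ Z (λ A → ∑V (λ v → ι (A v) * χ (c +F ⟪ a , v ⟫))) ≡⟨ ∑-congᴬ (All.map (λ {A} m → trans (ι-transform (Above.lin m) a c) (cong (λ z → z * ι ((A ᗮ) a) * χ c) (Above.size m))) members) ⟩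
      ∑ Z (λ A → Q * ι ((A ᗮ) a) * χ c) ≡⟨ trans (∑-*ʳ Z (χ c) (λ A → Q * ι ((A ᗮ) a))) (cong (_* χ c) (∑-*ˡ Z Q (λ A → ι ((A ᗮ) a)))) ⟩
      Q * ∑ Z (λ A → ι ((A ᗮ) a)) * χ c ≡⟨ cong (λ z → Q * z * χ c) (sym (∑-map _ᗮ Z (λ A → ι (A a)))) ⟩
      Q * δ* a * χ c                                                ∎
      where open ≡-Reasoning

    w-transform : HasTransform w ŵ
    w-transform a c = begin
      ∑V (λ v → w v * X v) ≡⟨ ∑-cong vs (λ v → r₁ s (δ Z v) y (y * Q) (ζ v) (X v)) ⟩
      ∑V (λ v → s * (δ Z v * X v) - y * (1ℤ * X v) - y * Q * (ζ v * X v)) ≡⟨ trans (∑-- vs (λ v → s * (δ Z v * X v) - y * (1ℤ * X v)) (λ v → y * Q * (ζ v * X v)))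
            (cong (_- ∑V (λ v → y * Q * (ζ v * X v))) (∑-- vs (λ v → s * (δ Z v * X v)) (λ v → y * (1ℤ * X v)))) ⟩
      ∑V (λ v → s * (δ Z v * X v)) - ∑V (λ v → y * (1ℤ * X v)) - ∑V (λ v → y * Q * (ζ v * X v))
            ≡⟨ cong₂ _-_ (cong₂ _-_ (trans (∑-*ˡ vs s (λ v → δ Z v * X v)) (cong (s *_) (δ-transform a c)))
            (trans (∑-*ˡ vs y (λ v → 1ℤ * X v)) (cong (y *_) (trans (ι-transform 𝟙-lin a c) (cong₂ (λ m b → m * ι b * χ c) ∑V-1 (𝟙ᗮ a))))))
            (trans (∑-*ˡ vs (y * Q) (λ v → ζ v * X v)) (cong (y * Q *_) (trans (ι-transform 𝟘-lin a c) (cong₂ (λ m b → m * ι b * χ c) ∣𝟘∣ (𝟘ᗮ a))))) ⟩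
      s * (Q * δ* a * χ c) - y * (N * ζ a * χ c) - y * Q * (1ℤ * 1ℤ * χ c) ≡⟨ r₂ s (Q * δ* a) y N (ζ a) Q (χ c) ⟩
      ŵ a * χ c                                                                               ∎
      where
      open ≡-Reasoning
      X : Vec₂ → ℤ
      X v = χ (c +F ⟪ a , v ⟫)
      r₁ : ∀ s d y z e x → (s * d - y - z * e) * x ≡ s * (d * x) - y * (1ℤ * x) - z * (e * x)
      r₁ = solve-∀
      r₂ : ∀ s d y N e Q x → s * (d * x) - y * (N * e * x) - y * Q * (1ℤ * 1ℤ * x) ≡ (s * d - y * N * e - y * Q) * x
      r₂ = solve-∀

    -- `τ` is the sum of w(u) w(v) w(u+v) over all pairs u, v.
    ρ τ : ℤ
    ρ = sq w
    τ = ∑V (λ u → w u * corr w u)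

    0≤ρ : 0ℤ ≤ ρ
    0≤ρ = ∑-nonneg vs (λ v → 0≤∙² (w v))

    ∑-ŵ² : ∑V (λ a → ŵ a * ŵ a) ≡ N * ρ
    ∑-ŵ² = trans (parseval₂ w ŵ w ŵ w-transform w-transform) (cong (N *_) (∑-cong vs (λ u → cong (w u *_) (w-even u))))

    ∑-ŵ³ : ∑V (λ a → ŵ a * (ŵ a * ŵ a)) ≡ N * τ
    ∑-ŵ³ = trans (parseval₃ w ŵ w-transform) (cong (N *_) (∑-cong vs (λ u → cong (w u *_) (∑-cong vs (λ v → cong (w v *_)
      (trans (w-even (u ⊕ v)) (cong w (⊕-comm u v))))))))

    module _ {Δ : ℤ} (0≤Δ : 0ℤ ≤ Δ) (δ*≤ : ∀ {a} → ¬ a ≡ zeroV → (q′ - 1ℤ) * δ* a ≤ Δ) where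
      0≤s : 0ℤ ≤ s
      0≤s = 0≤+ (<⇒≤ 0<Q) (+≤+ ℕ.z≤n)

      ŵ≤ : ∀ a → (q′ - 1ℤ) * ŵ a ≤ s * Q * Δ
      ŵ≤ a with a ≟V zeroV in eq
      ... | no nz = begin
        (q′ - 1ℤ) * (s * (Q * δ* a) - y * N * 0ℤ - y * Q) ≡⟨ r q′ s Q (δ* a) y N ⟩
        s * Q * ((q′ - 1ℤ) * δ* a) - (q′ - 1ℤ) * (y * Q) ≤⟨ i-j≤i (s * Q * ((q′ - 1ℤ) * δ* a)) ((q′ - 1ℤ) * (y * Q)) {{nonNegative (0≤* (<⇒≤ 0<q-1) (0≤* 0≤y (<⇒≤ 0<Q)))}} ⟩
        s * Q * ((q′ - 1ℤ) * δ* a) ≤⟨ *-monoˡ (s * Q) (0≤* 0≤s (<⇒≤ 0<Q)) (δ*≤ nz) ⟩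
        s * Q * Δ                                             ∎
        where
        open ≤-Reasoning
        r : ∀ q s Q d y N → (q - 1ℤ) * (s * (Q * d) - y * N * 0ℤ - y * Q) ≡ s * Q * ((q - 1ℤ) * d) - (q - 1ℤ) * (y * Q)
        r = solve-∀
      -- The bound on `δ*` says nothing at 0, but there `ŵ` vanishes because `w` is centred.
      ... | yes refl = ≤-trans (≤-reflexive (trans (cong₂ (λ d n → (q′ - 1ℤ) * (s * (Q * d) - y * n * 1ℤ - y * Q)) δ*-0 N≡Q²) (r q′ Q y))) (0≤* (0≤* 0≤s (<⇒≤ 0<Q)) 0≤Δ)
        where
        δ*-0 : δ* zeroV ≡ y
        δ*-0 = trans (∑-map _ᗮ Z (λ A → ι (A zeroV))) (∑-cong Z (λ A → cong ι (0∈ (ᗮ-lin {A}))))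
        r : ∀ q Q y → (q - 1ℤ) * ((Q + 1ℤ) * (Q * y) - y * (Q * Q) * 1ℤ - y * Q) ≡ 0ℤ
        r = solve-∀

      -- Each cube of `ŵ` is its square times `ŵ`, so a one-sided bound on `ŵ` suffices; Parseval
      -- converts the sums of cubes and of squares back to `τ` and `ρ`.
      τ≤ : (q′ - 1ℤ) * τ ≤ s * Q * Δ * ρ
      τ≤ = *-cancelˡ N 0<N (begin
        N * ((q′ - 1ℤ) * τ) ≡⟨ r₁ N (q′ - 1ℤ) τ ⟩
        (q′ - 1ℤ) * (N * τ) ≡⟨ cong ((q′ - 1ℤ) *_) (sym ∑-ŵ³) ⟩
        (q′ - 1ℤ) * ∑V (λ a → ŵ a * (ŵ a * ŵ a)) ≡⟨ sym (∑-*ˡ vs (q′ - 1ℤ) (λ a → ŵ a * (ŵ a * ŵ a))) ⟩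
        ∑V (λ a → (q′ - 1ℤ) * (ŵ a * (ŵ a * ŵ a))) ≤⟨ ∑-mono vs (λ a → ≤-trans (≤-reflexive (sym (*-assoc (q′ - 1ℤ) (ŵ a) _))) (*-monoʳ (ŵ a * ŵ a) (0≤∙² (ŵ a)) (ŵ≤ a))) ⟩
        ∑V (λ a → s * Q * Δ * (ŵ a * ŵ a)) ≡⟨ ∑-*ˡ vs (s * Q * Δ) (λ a → ŵ a * ŵ a) ⟩
        s * Q * Δ * ∑V (λ a → ŵ a * ŵ a) ≡⟨ cong (s * Q * Δ *_) ∑-ŵ² ⟩
        s * Q * Δ * (N * ρ) ≡⟨ r₁ (s * Q * Δ) N ρ ⟩
        N * (s * Q * Δ * ρ)                                   ∎)
        where
        open ≤-Reasoning
        r₁ : ∀ a b c → a * (b * c) ≡ b * (a * c)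
        r₁ = solve-∀

  -- Lower and upper estimates for the weighted second moment.

  module Estimates {q : ℕ} (𝔽 : FiniteField q) (4≤q : + 4 ≤ + q) (k : ℕ)
    {Z : List (Subspaces.Sub 𝔽 4≤q (k ℕ.+ k))} (fam : Families.Family 𝔽 4≤q k Z) where
    open Geometry 𝔽 using (V; zeroV)
    open Subspaces 𝔽 4≤q (k ℕ.+ k)
    open Moments 𝔽 4≤q (k ℕ.+ k)
    open Counting 𝔽 4≤q (k ℕ.+ k)
    open Families 𝔽 4≤q k
    open Gauss q
    open Lin
    open Family fam
    open Weight 𝔽 4≤q k fam

    -- Here s + m = k, so k + m = 2k - s. Both sides count ordered m-tuples independent modulo an
    -- s-dimensional subspace, on the left grouped by the k-dimensional subspace that they complete.
    gauss-falling : ∀ m s → Q ≡ q′ ^ s * q′ ^ m → G (k ℕ.+ m) m * falling Q m s ≡ falling N m s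
    gauss-falling zero    s e = refl
    gauss-falling (suc m) s e = begin
      G (k ℕ.+ suc m) (suc m) * ((Q - q′ ^ s) * falling Q m (suc s)) ≡⟨ cong₂ (λ a b → G a (suc m) * ((b - q′ ^ s) * falling Q m (suc s))) (ℕ.+-suc k m) e ⟩
      G (suc (k ℕ.+ m)) (suc m) * ((q′ ^ s * q′ ^ suc m - q′ ^ s) * falling Q m (suc s)) ≡⟨ r₁ (G (suc (k ℕ.+ m)) (suc m)) (q′ ^ s) (q′ ^ suc m) (falling Q m (suc s)) ⟩
      q′ ^ s * ((q′ ^ suc m - 1ℤ) * G (suc (k ℕ.+ m)) (suc m)) * falling Q m (suc s) ≡⟨ cong (λ z → q′ ^ s * z * falling Q m (suc s)) (G-step (k ℕ.+ m) m) ⟩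
      q′ ^ s * ((q′ ^ suc (k ℕ.+ m) - 1ℤ) * G (k ℕ.+ m) m) * falling Q m (suc s) ≡⟨ cong (λ z → q′ ^ s * ((q′ * z - 1ℤ) * G (k ℕ.+ m) m) * falling Q m (suc s)) (^-distribˡ-+-* q′ k m) ⟩
      q′ ^ s * ((q′ * (Q * q′ ^ m) - 1ℤ) * G (k ℕ.+ m) m) * falling Q m (suc s) ≡⟨ r₂ (q′ ^ s) q′ Q (q′ ^ m) (G (k ℕ.+ m) m) (falling Q m (suc s)) ⟩
      (Q * (q′ ^ s * q′ ^ suc m) - q′ ^ s) * (G (k ℕ.+ m) m * falling Q m (suc s)) ≡⟨ cong₂ (λ a b → (a - q′ ^ s) * b) (trans (cong (Q *_) (sym e)) (sym N≡Q²))
            (gauss-falling m (suc s) (trans e (r₃ (q′ ^ s) q′ (q′ ^ m)))) ⟩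
      (N - q′ ^ s) * falling N m (suc s)                                           ∎
      where
      open ≡-Reasoning
      r₁ : ∀ g a b f → g * ((a * b - a) * f) ≡ a * ((b - 1ℤ) * g) * f
      r₁ = solve-∀
      r₂ : ∀ a q Q b g f → a * ((q * (Q * b) - 1ℤ) * g) * f ≡ (Q * (a * (q * b)) - a) * (g * f)
      r₂ = solve-∀
      r₃ : ∀ a b c → a * (b * c) ≡ (b * a) * c
      r₃ = solve-∀

    q^s≤Q : ∀ m s → Q ≡ q′ ^ s * q′ ^ m → q′ ^ s ≤ Q
    q^s≤Q m s e = ≤-trans (≤-reflexive (sym (*-identityʳ (q′ ^ s)))) (≤-trans (*-monoˡ (q′ ^ s) (<⇒≤ (0<q^ s)) (1≤q^ m)) (≤-reflexive (sym e)))

    Q≤N : Q ≤ N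
    Q≤N = ≤-trans (≤-reflexive (sym (*-identityʳ Q))) (≤-trans (*-monoˡ Q (<⇒≤ 0<Q) (1≤q^ k)) (≤-reflexive (sym N≡Q²)))

    -- After division by N^(m+1) this bounds a product of factors 1 - q^j / N, s ≤ j < s + m, from
    -- below by 1 minus a sum; the geometric sum of the q^j is at most Q - q^s.
    falling-lower : ∀ m s → Q ≡ q′ ^ s * q′ ^ m → N ^ m * (N - Q + q′ ^ s) ≤ N * falling N m s
    falling-lower zero s e = ≤-reflexive (trans (cong (λ z → 1ℤ * (N - z + q′ ^ s)) (trans e (*-identityʳ (q′ ^ s)))) (r N (q′ ^ s)))
      where r : ∀ N a → 1ℤ * (N - a + a) ≡ N * 1ℤ
            r = solve-∀
    falling-lower (suc m) s e = begin
      N * N ^ m * (N - Q + a) ≡⟨ *-comm (N * N ^ m) (N - Q + a) ⟩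
      (N - Q + a) * (N * N ^ m) ≤⟨ ≤-gap (N ^ m * (a * (N * (q′ - + 2) + (Q - q′ * a)))) (0≤* (<⇒≤ (0<N^ m)) (0≤* (<⇒≤ (0<q^ s)) (0≤+ (0≤* (<⇒≤ 0<N) 0≤q-2) (i≤j⇒0≤j-i (q^s≤Q m (suc s) e′)))))
            (r₂ N (N ^ m) Q a q′) ⟩
      (N - a) * (N ^ m * (N - Q + q′ * a)) ≤⟨ *-monoˡ (N - a) (i≤j⇒0≤j-i (≤-trans (q^s≤Q (suc m) s e) Q≤N)) (falling-lower m (suc s) e′) ⟩
      (N - a) * (N * falling N m (suc s)) ≡⟨ r₁ (N - a) N (falling N m (suc s)) ⟩
      N * ((N - a) * falling N m (suc s))                ∎
      where
      open ≤-Reasoning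
      a : ℤ
      a = q′ ^ s
      r₁ : ∀ a b c → a * (b * c) ≡ b * (a * c)
      r₁ = solve-∀
      r₂ : ∀ N M Q a q → (N - a) * (M * (N - Q + q * a)) ≡ (N - Q + a) * (N * M) + M * (a * (N * (q - + 2) + (Q - q * a)))
      r₂ = solve-∀
      r₃ : ∀ a b c → a * (b * c) ≡ (b * a) * c
      r₃ = solve-∀
      e′ : Q ≡ q′ ^ suc s * q′ ^ m
      e′ = trans e (r₃ (q′ ^ s) q′ (q′ ^ m))
      0≤q-2 : 0ℤ ≤ q′ - + 2
      0≤q-2 = ≤-trans (+≤+ ℕ.z≤n) (+-monoˡ-≤ (- + 2) 4≤q)

    ∑-nonzero : ∀ g → ∑V (λ v → ι (not (𝟘 v)) * g v) ≡ ∑V g - g zeroV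
    ∑-nonzero g = trans (∑-cong vs (λ v → trans (cong (_* g v) (ι-not (𝟘 v))) (r (ζ v) (g v)))) (trans (∑-- vs g (λ v → ζ v * g v)) (cong (λ z → ∑V g - z) (∑-ζ g)))
      where r : ∀ a b → (1ℤ - a) * b ≡ b - a * b
            r = solve-∀

    Φ : Sub → ℤ
    Φ A = ∑V (λ v → ι (not (𝟘 v)) * (ι (A v) * δ Z v))

    Ψ : Sub → ℤ
    Ψ = total w

    -- `Φ A` counts pairs of a member `B` and a nonzero vector of A ∩ B, and every `B`, including
    -- `A` itself, supplies at least q - 1.
    Φ-lower : ∀ {A} → A ∈ Z → (q′ - 1ℤ) * y ≤ Φ A
    Φ-lower {A} i = begin
      (q′ - 1ℤ) * y ≡⟨ sym (∑-*ˡ Z (q′ - 1ℤ) (λ _ → 1ℤ)) ⟩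
      ∑ Z (λ B → (q′ - 1ℤ) * 1ℤ) ≤⟨ ∑-monoᴬ (All.tabulate (λ {B} j → each B j)) ⟩
      ∑ Z (λ B → ∑V (λ v → ι (not (𝟘 v)) * ι ((A ⊓ₛ B) v))) ≡⟨ ∑-swap Z vs (λ B v → ι (not (𝟘 v)) * ι ((A ⊓ₛ B) v)) ⟩
      ∑V (λ v → ∑ Z (λ B → ι (not (𝟘 v)) * ι (A v ∧ B v))) ≡⟨ ∑-cong vs (λ v → trans (∑-*ˡ Z (ι (not (𝟘 v))) (λ B → ι (A v ∧ B v)))
            (cong (ι (not (𝟘 v)) *_) (trans (∑-cong Z (λ B → ι-∧ (A v) (B v))) (∑-*ˡ Z (ι (A v)) (λ B → ι (B v)))))) ⟩
      Φ A                                                                   ∎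
      where
      open ≤-Reasoning
      each : ∀ B → B ∈ Z → (q′ - 1ℤ) * 1ℤ ≤ ∑V (λ v → ι (not (𝟘 v)) * ι ((A ⊓ₛ B) v))
      each B j = ≤-trans (≤-reflexive (*-identityʳ (q′ - 1ℤ))) (≤-trans (+-monoˡ-≤ -1ℤ (meet i j))
        (≤-reflexive (sym (trans (∑-minus 𝟘 (A ⊓ₛ B) (𝟘⊑ (⊓-lin (lin∈ fam i) (lin∈ fam j)))) (cong (λ z → ∣ A ⊓ₛ B ∣ₛ - z) ∣𝟘∣)))))

    Ψ-eq : ∀ {A} → A ∈ Z → Ψ A ≡ s * Φ A - y * (Q - 1ℤ)
    Ψ-eq {A} i = begin
      ∑V (λ v → ι (A v) * w v) ≡⟨ ∑-cong vs (λ v → r₁ (ι (A v)) s (δ Z v) y (y * Q) (ζ v)) ⟩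
      ∑V (λ v → s * (ι (A v) * δ Z v) - y * ι (A v) - y * Q * (ζ v * ι (A v))) ≡⟨ trans (∑-- vs (λ v → s * (ι (A v) * δ Z v) - y * ι (A v)) (λ v → y * Q * (ζ v * ι (A v))))
            (cong (_- ∑V (λ v → y * Q * (ζ v * ι (A v)))) (∑-- vs (λ v → s * (ι (A v) * δ Z v)) (λ v → y * ι (A v)))) ⟩
      ∑V (λ v → s * (ι (A v) * δ Z v)) - ∑V (λ v → y * ι (A v)) - ∑V (λ v → y * Q * (ζ v * ι (A v)))
            ≡⟨ cong₂ _-_ (cong₂ _-_ (∑-*ˡ vs s (λ v → ι (A v) * δ Z v)) (trans (∑-*ˡ vs y (λ v → ι (A v))) (cong (y *_) (size∈ fam i))))
            (trans (∑-*ˡ vs (y * Q) (λ v → ζ v * ι (A v))) (cong (y * Q *_) (trans (∑-ζ (λ v → ι (A v))) A0))) ⟩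
      s * H - y * Q - y * Q * 1ℤ ≡⟨ r₂ Q H y ⟩
      s * (H - 1ℤ * y) - y * (Q - 1ℤ) ≡⟨ cong (λ z → s * z - y * (Q - 1ℤ)) (sym (trans (∑-nonzero (λ v → ι (A v) * δ Z v)) (cong (λ z → H - z) (cong₂ _*_ A0 (δ-0 Z members))))) ⟩
      s * Φ A - y * (Q - 1ℤ)                                                            ∎
      where
      open ≡-Reasoning
      H : ℤ
      H = ∑V (λ v → ι (A v) * δ Z v)
      A0 : ι (A zeroV) ≡ 1ℤ
      A0 = cong ι (0∈ (lin∈ fam i))
      r₁ : ∀ a s d y z e → a * (s * d - y - z * e) ≡ s * (a * d) - y * a - z * (e * a)
      r₁ = solve-∀
      r₂ : ∀ Q H y → (Q + 1ℤ) * H - y * Q - y * Q * 1ℤ ≡ (Q + 1ℤ) * (H - 1ℤ * y) - y * (Q - 1ℤ)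
      r₂ = solve-∀

    0<s : 0ℤ < s
    0<s = +-mono-<-≤ 0<Q (+≤+ ℕ.z≤n)

    -- Centring costs y (Q - 1), which is less than s y for positive y; this lowers q - 1 to q - 2.
    Ψ-lower : ∀ {A} → A ∈ Z → s * ((q′ - + 2) * y) ≤ Ψ A
    Ψ-lower {A} i = begin
      s * ((q′ - + 2) * y) ≤⟨ ≤-gap (y + y) (0≤+ 0≤y 0≤y) (r Q q′ y) ⟩
      s * ((q′ - 1ℤ) * y) - y * (Q - 1ℤ) ≤⟨ +-monoˡ-≤ (- (y * (Q - 1ℤ))) (*-monoˡ s (<⇒≤ 0<s) (Φ-lower i)) ⟩
      s * Φ A - y * (Q - 1ℤ) ≡⟨ sym (Ψ-eq i) ⟩
      Ψ A                                           ∎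
      where
      open ≤-Reasoning
      r : ∀ Q q y → (Q + 1ℤ) * ((q - 1ℤ) * y) - y * (Q - 1ℤ) ≡ (Q + 1ℤ) * ((q - + 2) * y) + (y + y)
      r = solve-∀

    private
      sδ : ∀ v → s * δ Z v ≡ w v + y + y * Q * ζ v
      sδ v = r (s * δ Z v) y (y * Q * ζ v)
        where r : ∀ a b c → a ≡ a - b - c + b + c
              r = solve-∀

      ∑-sδ : ∀ g → s * ∑V (λ v → δ Z v * g v) ≡ ∑V (λ v → w v * g v) + y * ∑V g + y * Q * g zeroV
      ∑-sδ g = begin
        s * ∑V (λ v → δ Z v * g v) ≡⟨ sym (∑-*ˡ vs s (λ v → δ Z v * g v)) ⟩
        ∑V (λ v → s * (δ Z v * g v)) ≡⟨ ∑-cong vs (λ v → trans (sym (*-assoc s (δ Z v) (g v))) (trans (cong (_* g v) (sδ v)) (r (w v) y (y * Q) (ζ v) (g v)))) ⟩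
        ∑V (λ v → w v * g v + y * g v + y * Q * (ζ v * g v)) ≡⟨ trans (∑-+ vs (λ v → w v * g v + y * g v) (λ v → y * Q * (ζ v * g v))) (cong (_+ ∑V (λ v → y * Q * (ζ v * g v))) (∑-+ vs (λ v → w v * g v) (λ v → y * g v))) ⟩
        ∑V (λ v → w v * g v) + ∑V (λ v → y * g v) + ∑V (λ v → y * Q * (ζ v * g v)) ≡⟨ cong₂ (λ a b → ∑V (λ v → w v * g v) + a + b) (∑-*ˡ vs y g) (trans (∑-*ˡ vs (y * Q) (λ v → ζ v * g v)) (cong (y * Q *_) (∑-ζ g))) ⟩
        ∑V (λ v → w v * g v) + y * ∑V g + y * Q * g zeroV                             ∎
        where
        open ≡-Reasoning
        r : ∀ a y z e g → (a + y + z * e) * g ≡ a * g + y * g + z * (e * g)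
        r = solve-∀

    -- Summed over the family, Ψ pairs `w` with `δ Z`. Up to the factor `s`, `δ Z` is `w` plus a
    -- constant plus a multiple of `ζ`, and `w` is orthogonal to both corrections.
    s*∑Ψ : s * ∑ Z Ψ ≡ ρ
    s*∑Ψ = begin
      s * ∑ Z (λ A → ∑V (λ v → ι (A v) * w v)) ≡⟨ cong (s *_) (trans (∑-swap Z vs (λ A v → ι (A v) * w v)) (∑-cong vs (λ v → ∑-*ʳ Z (w v) (λ A → ι (A v))))) ⟩
      s * ∑V (λ v → δ Z v * w v) ≡⟨ ∑-sδ w ⟩
      ρ + y * ∑V w + y * Q * w zeroV ≡⟨ cong₂ (λ a b → ρ + y * a + y * Q * b) ∑-w w-0 ⟩
      ρ + y * 0ℤ + y * Q * 0ℤ ≡⟨ r ρ y Q ⟩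
      ρ                                              ∎
      where
      open ≡-Reasoning
      r : ∀ a y Q → a + y * 0ℤ + y * Q * 0ℤ ≡ a
      r = solve-∀

    0<ρ : 0ℤ < y → 0ℤ < ρ
    0<ρ 0<y = subst (0ℤ <_) s*∑Ψ (0<* 0<s (<-≤-trans (0<* 0<y (0<* 0<s (0<* 0<q-2 0<y)))
      (≤-trans (≤-reflexive (trans (sym (∑-*ʳ Z (s * ((q′ - + 2) * y)) (λ _ → 1ℤ))) (∑-cong Z (λ _ → *-identityˡ _)))) (∑-monoᴬ (All.tabulate (λ i → Ψ-lower i))))))
      where
      0<q-2 : 0ℤ < q′ - + 2
      0<q-2 = <-≤-trans (+<+ (ℕ.s≤s ℕ.z≤n)) (+-monoˡ-≤ (- + 2) 4≤q)

    0≤δ : ∀ v → 0ℤ ≤ δ Z v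
    0≤δ v = ∑-nonneg Z (λ A → 0≤ι (A v))

    -- The second moment of w over k-tuples whose first vector is weighted by δ.
    D : ℕ → ℤ
    D m = ∑V (λ v → ι (not (𝟘 v)) * (δ Z v * Mom m (T v w)))

    module _ (m : ℕ) (k≡ : k ≡ suc m) where
      private
        φ : ℤ
        φ = falling Q m 1
        Q≡ : Q ≡ q′ ^ 1 * q′ ^ m
        Q≡ = trans (cong (q′ ^_) k≡) (^-distribˡ-+-* q′ 1 m)
        0≤φ : 0ℤ ≤ φ
        0≤φ = falling-nonneg m 1 Q≡

      -- Grouping the tuples by the member that they span gives at least φ times the sum of Φ Ψ².
      -- Only one of the two factors Ψ is replaced by its lower bound: the other is kept so that
      -- `s*∑Ψ` produces ρ, which the upper estimate also contains.
      D-lower : φ * ((q′ - 1ℤ) * y * ((q′ - + 2) * y) * ρ) ≤ D m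
      D-lower = begin
        φ * ((q′ - 1ℤ) * y * ((q′ - + 2) * y) * ρ) ≡⟨ cong (λ z → φ * ((q′ - 1ℤ) * y * ((q′ - + 2) * y) * z)) (sym s*∑Ψ) ⟩
        φ * ((q′ - 1ℤ) * y * ((q′ - + 2) * y) * (s * ∑ Z Ψ)) ≡⟨ cong (φ *_) (trans (r₁ ((q′ - 1ℤ) * y) ((q′ - + 2) * y) s (∑ Z Ψ)) (sym (∑-*ˡ Z ((q′ - 1ℤ) * y * (s * ((q′ - + 2) * y))) Ψ))) ⟩
        φ * ∑ Z (λ A → (q′ - 1ℤ) * y * (s * ((q′ - + 2) * y)) * Ψ A) ≤⟨ *-monoˡ φ 0≤φ (∑-monoᴬ (All.tabulate (λ {A} i → each A i))) ⟩
        φ * ∑ Z (λ A → Φ A * (Ψ A * Ψ A)) ≡⟨ sym (∑-*ˡ Z φ (λ A → Φ A * (Ψ A * Ψ A))) ⟩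
        ∑ Z (λ A → φ * (Φ A * (Ψ A * Ψ A))) ≡⟨ ∑-cong Z (λ A → trans (cong (φ *_) (sym (∑-*ʳ vs (Ψ A * Ψ A) (λ v → ι (not (𝟘 v)) * (ι (A v) * δ Z v)))))
            (sym (∑-*ˡ vs φ (λ v → ι (not (𝟘 v)) * (ι (A v) * δ Z v) * (Ψ A * Ψ A))))) ⟩
        ∑ Z (λ A → ∑V (λ v → f v A)) ≡⟨ ∑-swap Z vs (λ A v → f v A) ⟩
        ∑V (λ v → ∑ Z (f v)) ≤⟨ ∑-mono vs bound ⟩
        D m                                                                     ∎
        where
        open ≤-Reasoning
        f : V (k ℕ.+ k) → Sub → ℤ
        f v A = φ * (ι (not (𝟘 v)) * (ι (A v) * δ Z v) * (Ψ A * Ψ A))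
        r₁ : ∀ a b s p → a * b * (s * p) ≡ a * (s * b) * p
        r₁ = solve-∀
        r₂ : ∀ φ z a d p → φ * (z * (a * d) * p) ≡ z * (d * φ) * (a * p)
        r₂ = solve-∀
        r₃ : ∀ z d φ x → z * (d * φ) * x ≡ z * (d * (φ * x))
        r₃ = solve-∀
        0≤c : 0ℤ ≤ s * ((q′ - + 2) * y)
        0≤c = 0≤* (<⇒≤ 0<s) (0≤* (≤-trans (+≤+ ℕ.z≤n) (+-monoˡ-≤ (- + 2) 4≤q)) 0≤y)
        each : ∀ A → A ∈ Z → (q′ - 1ℤ) * y * (s * ((q′ - + 2) * y)) * Ψ A ≤ Φ A * (Ψ A * Ψ A)
        each A i = ≤-trans (≤-reflexive (*-assoc ((q′ - 1ℤ) * y) (s * ((q′ - + 2) * y)) (Ψ A)))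
          (≤-trans (*-monoˡ ((q′ - 1ℤ) * y) (0≤* (<⇒≤ 0<q-1) 0≤y) (*-monoʳ (Ψ A) (≤-trans 0≤c (Ψ-lower i)) (Ψ-lower i)))
            (*-monoʳ (Ψ A * Ψ A) (0≤∙² (Ψ A)) (Φ-lower i)))
        bound : ∀ v → ∑ Z (f v) ≤ ι (not (𝟘 v)) * (δ Z v * Mom m (T v w))
        bound v = begin
          ∑ Z (f v) ≡⟨ trans (∑-cong Z (λ A → r₂ φ (ι (not (𝟘 v))) (ι (A v)) (δ Z v) (Ψ A * Ψ A))) (∑-*ˡ Z (ι (not (𝟘 v)) * (δ Z v * φ)) (λ A → ι (A v) * (Ψ A * Ψ A))) ⟩
          ι (not (𝟘 v)) * (δ Z v * φ) * ∑ Z (λ A → ι (A v) * (Ψ A * Ψ A)) ≡⟨ cong (ι (not (𝟘 v)) * (δ Z v * φ) *_) (sym (∑-through v Z (λ A → Ψ A * Ψ A))) ⟩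
          ι (not (𝟘 v)) * (δ Z v * φ) * ∑ (through v Z) (λ A → Ψ A * Ψ A) ≡⟨ r₃ (ι (not (𝟘 v))) (δ Z v) φ (∑ (through v Z) (λ A → Ψ A * Ψ A)) ⟩
          ι (not (𝟘 v)) * (δ Z v * (φ * ∑ (through v Z) (λ A → Ψ A * Ψ A))) ≤⟨ moment ⟩
          ι (not (𝟘 v)) * (δ Z v * Mom m (T v w))                                       ∎
          where
          moment : ι (not (𝟘 v)) * (δ Z v * (φ * ∑ (through v Z) (λ A → Ψ A * Ψ A))) ≤ ι (not (𝟘 v)) * (δ Z v * Mom m (T v w))
          moment with 𝟘 v in eq
          ... | true  = ≤-refl
          -- The first vector is `v`, and `T v w` is the coset sum of `w` over ⟨v⟩, so the remaining
          -- m vectors start from dimension 1.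
          ... | false = *-monoˡ 1ℤ (+≤+ ℕ.z≤n) (*-monoˡ (δ Z v) (0≤δ v) (≤-trans
            (moment-lower w m 1 {Q} {⟨ v ⟩} {through v Z} (⟨⟩-lin {v}) (trans (∣+⟨⟩∣ 𝟘-lin eq) (cong (q′ *_) ∣𝟘∣)) Q≡ (through-above members) (through-distinct distinct))
            (≤-reflexive (Mom-cong m (λ x → trans (sym (T-cosum w 𝟘-lin eq x)) (T-cong (cosum-0 w) v x))))))

      module _ {Δ : ℤ} (0≤Δ : 0ℤ ≤ Δ) (δ≤ : ∀ {v} → ¬ v ≡ zeroV → (q′ - 1ℤ) * δ Z v ≤ Δ) (δ*≤ : ∀ {a} → ¬ a ≡ zeroV → (q′ - 1ℤ) * δ* a ≤ Δ) where

        private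
          c₁ c₂ A₁ C₁ : ℤ
          c₁ = N * N ^ m * (q′ - 1ℤ)
          c₂ = N ^ m * (q′ - 1ℤ) * (Q - q′)
          A₁ = ∑V (λ v → ι (not (𝟘 v)) * (δ Z v * ((q′ - 1ℤ) * (w v * w v))))
          C₁ = ∑V (λ v → ι (not (𝟘 v)) * (δ Z v * corr w v))

          0≤c₁ : 0ℤ ≤ c₁
          0≤c₁ = 0≤* (0≤* (<⇒≤ 0<N) (<⇒≤ (0<N^ m))) (<⇒≤ 0<q-1)

          0≤c₂ : 0ℤ ≤ c₂
          0≤c₂ = 0≤* (0≤* (<⇒≤ (0<N^ m)) (<⇒≤ 0<q-1)) (i≤j⇒0≤j-i (≤-trans (≤-reflexive (sym (*-identityʳ q′))) (q^s≤Q m 1 Q≡)))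

        -- `second-moment` for `T v w`: its value at 0 is (q - 1) w(v), since w(0) = 0, and its
        -- square sum brings in the autocorrelation of `w` at `v`.
        N*Mom : ∀ v → N * Mom m (T v w) ≡ c₁ * ((q′ - 1ℤ) * (w v * w v)) + c₂ * (ρ + (q′ - 1ℤ) * corr w v)
        N*Mom v = trans (second-moment m (T v w) (T-homogeneous w v w-homogeneous) (T-sum w v ∑-w))
          (trans (cong₂ (λ a b → N * N ^ m * (a * a) + N ^ m * (q′ - 1ℤ) * (q′ ^ m - 1ℤ) * b)
              (trans (T-0 w w-homogeneous v) (trans (cong (_+ (q′ - 1ℤ) * w v) w-0) (+-identityˡ ((q′ - 1ℤ) * w v)))) (T-sq w w-homogeneous v))
            (trans (r (N * N ^ m) (N ^ m) q′ (q′ ^ m) (w v) (ρ + (q′ - 1ℤ) * corr w v)) (cong (λ z → c₁ * ((q′ - 1ℤ) * (w v * w v)) + N ^ m * (q′ - 1ℤ) * (z - q′) * (ρ + (q′ - 1ℤ) * corr w v)) (sym (cong (q′ ^_) k≡)))))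
          where
          r : ∀ a M q P x z → a * ((q - 1ℤ) * x * ((q - 1ℤ) * x)) + M * (q - 1ℤ) * (P - 1ℤ) * (q * z) ≡ a * (q - 1ℤ) * ((q - 1ℤ) * (x * x)) + M * (q - 1ℤ) * (q * P - q) * z
          r = solve-∀

        N*D : N * D m ≡ c₁ * A₁ + c₂ * (ρ * (y * (Q - 1ℤ)) + (q′ - 1ℤ) * C₁)
        N*D = begin
          N * D m ≡⟨ sym (∑-*ˡ vs N (λ v → ι (not (𝟘 v)) * (δ Z v * Mom m (T v w)))) ⟩
          ∑V (λ v → N * (ι (not (𝟘 v)) * (δ Z v * Mom m (T v w)))) ≡⟨ ∑-cong vs (λ v → trans (r₁ N (ι (not (𝟘 v))) (δ Z v) (Mom m (T v w))) (trans (cong (λ z → ι (not (𝟘 v)) * (δ Z v * z)) (N*Mom v))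
            (r₂ (ι (not (𝟘 v))) (δ Z v) c₁ c₂ ((q′ - 1ℤ) * (w v * w v)) ρ (q′ - 1ℤ) (corr w v)))) ⟩
          ∑V (λ v → c₁ * a v + c₂ * (ρ * b v) + c₂ * ((q′ - 1ℤ) * c v)) ≡⟨ trans (∑-+ vs (λ v → c₁ * a v + c₂ * (ρ * b v)) (λ v → c₂ * ((q′ - 1ℤ) * c v))) (cong (_+ ∑V (λ v → c₂ * ((q′ - 1ℤ) * c v))) (∑-+ vs (λ v → c₁ * a v) (λ v → c₂ * (ρ * b v)))) ⟩
          ∑V (λ v → c₁ * a v) + ∑V (λ v → c₂ * (ρ * b v)) + ∑V (λ v → c₂ * ((q′ - 1ℤ) * c v)) ≡⟨ cong₂ _+_ (cong₂ _+_ (∑-*ˡ vs c₁ a) (trans (∑-*ˡ vs c₂ (λ v → ρ * b v)) (cong (c₂ *_) (trans (∑-*ˡ vs ρ b) (cong (ρ *_) ∑b)))))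
            (trans (∑-*ˡ vs c₂ (λ v → (q′ - 1ℤ) * c v)) (cong (c₂ *_) (∑-*ˡ vs (q′ - 1ℤ) c))) ⟩
          c₁ * A₁ + c₂ * (ρ * (y * (Q - 1ℤ))) + c₂ * ((q′ - 1ℤ) * C₁) ≡⟨ r₃ (c₁ * A₁) c₂ (ρ * (y * (Q - 1ℤ))) ((q′ - 1ℤ) * C₁) ⟩
          c₁ * A₁ + c₂ * (ρ * (y * (Q - 1ℤ)) + (q′ - 1ℤ) * C₁)                                  ∎
          where
          open ≡-Reasoning
          a b c : V (k ℕ.+ k) → ℤ
          a v = ι (not (𝟘 v)) * (δ Z v * ((q′ - 1ℤ) * (w v * w v)))
          b v = ι (not (𝟘 v)) * δ Z v
          c v = ι (not (𝟘 v)) * (δ Z v * corr w v)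
          ∑b : ∑V b ≡ y * (Q - 1ℤ)
          ∑b = trans (∑-nonzero (δ Z)) (trans (cong₂ _-_ ∑-δ (δ-0 Z members)) (r₄ y Q))
            where r₄ : ∀ y Q → y * Q - y ≡ y * (Q - 1ℤ)
                  r₄ = solve-∀
          r₁ : ∀ N z d x → N * (z * (d * x)) ≡ z * (d * (N * x))
          r₁ = solve-∀
          r₂ : ∀ z d c e x p q g → z * (d * (c * x + e * (p + q * g))) ≡ c * (z * (d * x)) + e * (p * (z * d)) + e * (q * (z * (d * g)))
          r₂ = solve-∀
          r₃ : ∀ a c x z → a + c * x + c * z ≡ a + c * (x + z)
          r₃ = solve-∀

        A₁≤ : A₁ ≤ Δ * ρ
        A₁≤ = ≤-trans (∑-mono vs pt) (≤-reflexive (∑-*ˡ vs Δ (λ v → w v * w v)))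
          where
          r : ∀ d q x → 1ℤ * (d * (q * x)) ≡ q * d * x
          r = solve-∀
          bound : ∀ z x d → 0ℤ ≤ x → (z ≡ false → (q′ - 1ℤ) * d ≤ Δ) → ι (not z) * (d * ((q′ - 1ℤ) * x)) ≤ Δ * x
          bound true  x d 0≤x h = 0≤* 0≤Δ 0≤x
          bound false x d 0≤x h = ≤-trans (≤-reflexive (r d (q′ - 1ℤ) x)) (*-monoʳ x 0≤x (h refl))
          pt : ∀ v → ι (not (𝟘 v)) * (δ Z v * ((q′ - 1ℤ) * (w v * w v))) ≤ Δ * (w v * w v)
          pt v = bound (𝟘 v) (w v * w v) (δ Z v) (0≤∙² (w v)) (λ e → δ≤ (λ z → contra (dec-true (v ≟V zeroV) z) e))

        -- Replacing s δ by w + y + y Q ζ turns the sum into τ; the term with y vanishes because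
        -- `corr w` sums to 0. The contributions at the zero vector combine to -y ρ, which has the
        -- favourable sign.
        C₁≤ : (q′ - 1ℤ) * C₁ ≤ Q * Δ * ρ
        C₁≤ = *-cancelˡ s 0<s (begin
          s * ((q′ - 1ℤ) * C₁) ≡⟨ r₁ s (q′ - 1ℤ) C₁ ⟩
          (q′ - 1ℤ) * (s * C₁) ≡⟨ cong ((q′ - 1ℤ) *_) sC₁ ⟩
          (q′ - 1ℤ) * (τ - y * ρ) ≤⟨ *-monoˡ (q′ - 1ℤ) (<⇒≤ 0<q-1) (i-j≤i τ (y * ρ) {{nonNegative (0≤* 0≤y 0≤ρ)}}) ⟩
          (q′ - 1ℤ) * τ ≤⟨ τ≤ 0≤Δ δ*≤ ⟩
          s * Q * Δ * ρ ≡⟨ r₂ s Q Δ ρ ⟩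
          s * (Q * Δ * ρ)                                       ∎)
          where
          open ≤-Reasoning
          r₁ : ∀ a b c → a * (b * c) ≡ b * (a * c)
          r₁ = solve-∀
          r₂ : ∀ a b c d → a * b * c * d ≡ a * (b * c * d)
          r₂ = solve-∀
          r₃ : ∀ t Q y p → t + y * 0ℤ + y * Q * p - (Q + 1ℤ) * (y * p) ≡ t - y * p
          r₃ = solve-∀
          r₄ : ∀ s a b → s * (a - b) ≡ s * a - s * b
          r₄ = solve-∀
          sC₁ : s * C₁ ≡ τ - y * ρ
          sC₁ = trans (cong (s *_) (∑-nonzero (λ v → δ Z v * corr w v))) (trans (r₄ s _ _)
            (trans (cong₂ (λ a b → a - s * b) (∑-sδ (corr w)) (cong₂ _*_ (δ-0 Z members) (corr-0 w)))
              (trans (cong₂ (λ a b → τ + y * a + y * Q * b - s * (y * ρ)) (corr-sum w ∑-w) (corr-0 w)) (r₃ τ Q y ρ))))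

        D-upper : N * D m ≤ N ^ m * (q′ - 1ℤ) * (N * Δ + (Q - q′) * (y * (Q - 1ℤ) + Q * Δ)) * ρ
        D-upper = begin
          N * D m ≡⟨ N*D ⟩
          c₁ * A₁ + c₂ * (ρ * (y * (Q - 1ℤ)) + (q′ - 1ℤ) * C₁) ≤⟨ +-mono-≤ (*-monoˡ c₁ 0≤c₁ A₁≤) (*-monoˡ c₂ 0≤c₂ (+-monoʳ-≤ (ρ * (y * (Q - 1ℤ))) C₁≤)) ⟩
          c₁ * (Δ * ρ) + c₂ * (ρ * (y * (Q - 1ℤ)) + Q * Δ * ρ) ≡⟨ r N (N ^ m) (q′ - 1ℤ) Δ ρ (Q - q′) (y * (Q - 1ℤ)) Q ⟩
          N ^ m * (q′ - 1ℤ) * (N * Δ + (Q - q′) * (y * (Q - 1ℤ) + Q * Δ)) * ρ  ∎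
          where
          open ≤-Reasoning
          r : ∀ N M q D p e z Q → N * M * q * (D * p) + M * q * e * (p * z + Q * D * p) ≡ M * q * (N * D + e * (z + Q * D)) * p
          r = solve-∀

  -- Eliminating the moment between the two estimates.

  combine : ∀ q Q M N g H n y ρ D R → N ≡ Q * Q → 0ℤ < Q → 0ℤ < M → 0ℤ < ρ → 0ℤ < q - 1ℤ → 0ℤ ≤ Q - 1ℤ → 0ℤ ≤ (Q - q) * (q - + 2) * y → 0ℤ ≤ g →
    (Q - q) * g * ((q - 1ℤ) * y * ((q - + 2) * y) * ρ) ≤ D →
    N * D ≤ N * M * (q - 1ℤ) * R * ρ →
    n * g ≡ H → M * (N - Q) ≤ N * H →
    + 3 * ((Q - 1ℤ) * n) ≤ (q - 1ℤ) * y →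
    + 3 * ((Q - q) * (q - + 2) * ((Q - 1ℤ) * (Q - 1ℤ))) * y ≤ (q - 1ℤ) * Q * R
  combine q Q M .(Q * Q) g .(n * g) n y ρ D R refl 0<Q 0<M 0<ρ 0<q-1 0≤Q-1 0≤e 0≤g lower upper refl H≥ large = *-cancelˡ M 0<M (begin
    M * (+ 3 * ((Q - q) * (q - + 2) * ((Q - 1ℤ) * (Q - 1ℤ))) * y) ≡⟨ r₁ q Q M y ⟩
    (Q - q) * (q - + 2) * y * (+ 3 * (Q - 1ℤ) * (M * (Q - 1ℤ))) ≤⟨ *-monoˡ ((Q - q) * (q - + 2) * y) 0≤e (begin
      + 3 * (Q - 1ℤ) * (M * (Q - 1ℤ)) ≤⟨ *-monoˡ (+ 3 * (Q - 1ℤ)) (0≤* {+ 3} (+≤+ ℕ.z≤n) 0≤Q-1) MQ≤ ⟩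
      + 3 * (Q - 1ℤ) * (Q * (n * g)) ≡⟨ r₂ Q n g ⟩
      -- The lower estimate is quadratic in `y` while `R` is affine in it. One of its factors `y` is
      -- traded here for 3 (Q - 1) n / (q - 1); the product n g is then controlled by
      -- `falling-lower`.
      Q * g * (+ 3 * ((Q - 1ℤ) * n)) ≤⟨ *-monoˡ (Q * g) (0≤* (<⇒≤ 0<Q) 0≤g) large ⟩
      Q * g * ((q - 1ℤ) * y)                                                  ∎) ⟩
    (Q - q) * (q - + 2) * y * (Q * g * ((q - 1ℤ) * y)) ≡⟨ r₃ q Q g y ⟩
    (q - 1ℤ) * Q * ((Q - q) * (q - + 2) * y * (g * y)) ≤⟨ *-monoˡ ((q - 1ℤ) * Q) (0≤* (<⇒≤ 0<q-1) (<⇒≤ 0<Q)) squeeze ⟩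
    (q - 1ℤ) * Q * (M * R) ≡⟨ r₄ ((q - 1ℤ) * Q) M R ⟩
    M * ((q - 1ℤ) * Q * R)                                                  ∎)
    where
    open ≤-Reasoning
    r₁ : ∀ q Q M y → M * (+ 3 * ((Q - q) * (q - + 2) * ((Q - 1ℤ) * (Q - 1ℤ))) * y) ≡ (Q - q) * (q - + 2) * y * (+ 3 * (Q - 1ℤ) * (M * (Q - 1ℤ)))
    r₁ = solve-∀
    r₂ : ∀ Q n g → + 3 * (Q - 1ℤ) * (Q * (n * g)) ≡ Q * g * (+ 3 * ((Q - 1ℤ) * n))
    r₂ = solve-∀
    r₃ : ∀ q Q g y → (Q - q) * (q - + 2) * y * (Q * g * ((q - 1ℤ) * y)) ≡ (q - 1ℤ) * Q * ((Q - q) * (q - + 2) * y * (g * y))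
    r₃ = solve-∀
    r₄ : ∀ a b c → a * (b * c) ≡ b * (a * c)
    r₄ = solve-∀
    r₅ : ∀ Q M → Q * (M * (Q - 1ℤ)) ≡ M * (Q * Q - Q)
    r₅ = solve-∀
    MQ≤ : M * (Q - 1ℤ) ≤ Q * (n * g)
    MQ≤ = *-cancelˡ Q 0<Q (≤-trans (≤-reflexive (r₅ Q M)) (≤-trans H≥ (≤-reflexive (*-assoc Q Q (n * g)))))
    r₆ : ∀ q Q g y ρ → Q * Q * ((q - 1ℤ) * ρ) * ((Q - q) * (q - + 2) * y * (g * y)) ≡ Q * Q * ((Q - q) * g * ((q - 1ℤ) * y * ((q - + 2) * y) * ρ))
    r₆ = solve-∀
    r₇ : ∀ q Q M R ρ → Q * Q * M * (q - 1ℤ) * R * ρ ≡ Q * Q * ((q - 1ℤ) * ρ) * (M * R)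
    r₇ = solve-∀
    0<QQ : 0ℤ < Q * Q
    0<QQ = 0<* 0<Q 0<Q
    squeeze : (Q - q) * (q - + 2) * y * (g * y) ≤ M * R
    squeeze = *-cancelˡ (Q * Q * ((q - 1ℤ) * ρ)) (0<* 0<QQ (0<* 0<q-1 0<ρ))
      (≤-trans (≤-reflexive (r₆ q Q g y ρ)) (≤-trans (*-monoˡ (Q * Q) (<⇒≤ 0<QQ) lower) (≤-trans upper (≤-reflexive (r₇ q Q M R ρ)))))

  -- The case k ≥ 3.

  module _ {q : ℕ} (𝔽 : FiniteField q) (4≤q : + 4 ≤ + q) where

    module _ (i : ℕ) {k : ℕ} (k≡ : k ≡ 3 ℕ.+ i) where
      open Subspaces 𝔽 4≤q (k ℕ.+ k)
      open Transform 𝔽 4≤q (k ℕ.+ k)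
      open Counting 𝔽 4≤q (k ℕ.+ k)
      open Families 𝔽 4≤q k
      open Pencils 𝔽 4≤q k i k≡

      no-large-family : ∀ {Z} → Family Z → Family (map _ᗮ Z) → ¬ + 3 * ((Q - 1ℤ) * n₂) ≤ (q′ - 1ℤ) * ∑ Z (λ _ → 1ℤ)
      no-large-family {Z} fam fam* large = final-arith q′ X Q y n₂ Q≡ 4≤q q≤X 0<n₂ large
        (subst (λ z → + 3 * ((Q - q′) * (q′ - + 2) * ((Q - 1ℤ) * (Q - 1ℤ))) * y ≤ (q′ - 1ℤ) * Q * (z * Δ + (Q - q′) * (y * (Q - 1ℤ) + Q * Δ))) N≡Q²
          (combine q′ Q (N ^ suc i) N (falling Q (suc i) 2) (falling N (suc i) 2) n₂ y ρ (D m) (N * Δ + (Q - q′) * (y * (Q - 1ℤ) + Q * Δ))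
            N≡Q² 0<Q (0<N^ (suc i)) (0<ρ 0<y) 0<q-1 0≤Q-1 (0≤* (0≤* 0≤Q-q 0≤q-2) 0≤y) (falling-nonneg (suc i) 2 Q≡₂)
            -- `falling Q m 1` unfolds to Q - q^1 times `falling Q (suc i) 2`; only the second
            -- factor pairs with `n₂` in `gauss-falling`.
            (subst (λ z → (Q - z) * falling Q (suc i) 2 * ((q′ - 1ℤ) * y * ((q′ - + 2) * y) * ρ) ≤ D m) (*-identityʳ q′) (D-lower m k≡))
            -- Taking complements keeps the number of members, so the same point bound holds in the
            -- dual family and serves there as the hyperplane bound.
            (D-upper m k≡ 0≤Δ (point-bound′ fam large) (point-bound′ fam* (subst (λ z → + 3 * ((Q - 1ℤ) * n₂) ≤ (q′ - 1ℤ) * z) (sym (∑-map _ᗮ Z (λ _ → 1ℤ))) large)))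
            (gauss-falling (suc i) 2 Q≡₂)
            (≤-trans (*-monoˡ (N ^ suc i) (<⇒≤ (0<N^ (suc i))) (≤-gap (q′ ^ 2) (<⇒≤ (0<q^ 2)) refl)) (falling-lower (suc i) 2 Q≡₂))
            large))
        where
        open Weight 𝔽 4≤q k fam
        open Estimates 𝔽 4≤q k fam
        m : ℕ
        m = 2 ℕ.+ i
        Δ : ℤ
        Δ = (+ 2 * q′ - 1ℤ) * X * n₂
        0≤q-2 : 0ℤ ≤ q′ - + 2
        0≤q-2 = ≤-trans (+≤+ ℕ.z≤n) (+-monoˡ-≤ (- + 2) 4≤q)
        0≤Δ : 0ℤ ≤ Δ
        0≤Δ = 0≤* (0≤* (≤-trans (0≤+ 0≤q (<⇒≤ 0<q-1)) (≤-reflexive (r q′))) (<⇒≤ 0<X)) 0≤n₂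
          where r : ∀ q → q + (q - 1ℤ) ≡ + 2 * q - 1ℤ
                r = solve-∀
        Q≡₂ : Q ≡ q′ ^ 2 * q′ ^ suc i
        Q≡₂ = trans (cong (q′ ^_) k≡) (^-distribˡ-+-* q′ 2 (suc i))
        0≤Q-1 : 0ℤ ≤ Q - 1ℤ
        0≤Q-1 = i≤j⇒0≤j-i (1≤q^ k)
        0≤Q-q : 0ℤ ≤ Q - q′
        0≤Q-q = i≤j⇒0≤j-i (≤-trans (≤-reflexive (sym (*-identityʳ q′))) (q^s≤Q m 1 (trans (cong (q′ ^_) k≡) (^-distribˡ-+-* q′ 1 m))))
        q≤X : q′ ≤ X
        q≤X = ≤-trans (≤-reflexive (sym (*-identityʳ q′))) (*-monoˡ q′ 0≤q (1≤q^ i))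
        0<n₂ : 0ℤ < n₂
        0<n₂ = <-≤-trans (+-mono-≤-< {0ℤ} {1ℤ} (+≤+ ℕ.z≤n) 0<q) 1+q≤n₂
        0<Q-1 : 0ℤ < Q - 1ℤ
        0<Q-1 = subst (λ z → 0ℤ < z - 1ℤ) (cong (q′ ^_) (sym k≡)) (0<q^-1 (2 ℕ.+ i))
        0<y : 0ℤ < y
        0<y = *-cancelˡ-<-nonNeg (q′ - 1ℤ) {{nonNegative (<⇒≤ 0<q-1)}} (subst (_< (q′ - 1ℤ) * y) (sym (*-zeroʳ (q′ - 1ℤ)))
          (<-≤-trans (0<* {+ 3} (+<+ (ℕ.s≤s ℕ.z≤n)) (0<* 0<Q-1 0<n₂)) large))

  -- The cases k = 1 and k = 2.

  module _ {q : ℕ} (𝔽 : FiniteField q) (4≤q : + 4 ≤ + q) where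
    open Geometry 𝔽 using (V; zeroV)

    module _ {k : ℕ} where
      open Subspaces 𝔽 4≤q (k ℕ.+ k)
      open Transform 𝔽 4≤q (k ℕ.+ k)
      open Families 𝔽 4≤q k

      q≤q^ : ∀ j → q′ ≤ q′ ^ suc j
      q≤q^ j = ≤-trans (≤-reflexive (sym (*-identityʳ q′))) (*-monoˡ q′ 0≤q (1≤q^ j))

      module _ {Z : List Sub} (fam : Family Z) where
        open Family fam

        common : ∀ {A B} → A ∈ Z → B ∈ Z → ∃ λ x → ¬ x ≡ zeroV × A x ≡ true × B x ≡ true
        common {A} {B} i j with big⇒∃ {A ⊓ₛ B} (meet i j)
        ... | x , x≢0 , e = x , x≢0 , ∧⁻ˡ e , ∧⁻ʳ {A x} e

        module _ (j : ℕ) (k≡ : k ≡ suc j) where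
          nonzero : ∃ λ (x : V (k ℕ.+ k)) → ¬ x ≡ zeroV
          nonzero with big⇒∃ {𝟙} (≤-trans (q≤q^ (j ℕ.+ k)) (≤-reflexive (trans (cong (λ z → q′ ^ (z ℕ.+ k)) (sym k≡)) (sym ∑V-1))))
          ... | x , x≢0 , _ = x , x≢0

          member : ∃ λ A → A ∈ Z × ∃ λ x → ¬ x ≡ zeroV × A x ≡ true
          member with avoid (proj₁ nonzero) (proj₂ nonzero)
          ... | A , i , _ with common i i
          ...   | x , x≢0 , x∈ , _ = A , i , x , x≢0 , x∈

        -- Two one-dimensional subspaces that meet nontrivially coincide, so a vector of one member
        -- cannot be avoided by another.
        no-points : ¬ k ≡ 1
        no-points k≡ with member 0 k≡
        ... | C , C∈ , x , x≢0 , x∈ with avoid x x≢0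
        ...   | C′ , C′∈ , x∉ with common C∈ C′∈
        ... | z , z≢0 , z∈ , z∈′ = contra (⊑-full {⟨ x ⟩} {C} (⟨⟩⊑ {x} {C} (lin∈ fam C∈) x∈)
                    (≤-reflexive (trans (size∈ fam C∈) (trans (cong (q′ ^_) k≡) (sym (∣⟨⟩∣ x≢0))))) z z∈)
                  (∉⟨⟩ {C′} {x} {z} (lin∈ fam C′∈) x∉ z≢0 z∈′)

        module _ (k≡ : k ≡ 2) where
          spanned : ∀ {D a b} → D ∈ Z → ¬ a ≡ zeroV → D a ≡ true → D b ≡ true → ⟨ a ⟩ b ≡ false → D ⊑ ⟨ a ⟩ +⟨ b ⟩
          spanned {D} {a} {b} i a≢0 a∈ b∈ b∉ = ⊑-full {⟨ a ⟩ +⟨ b ⟩} {D}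
            (+⟨⟩-least {⟨ a ⟩} {b} (lin∈ fam i) (⟨⟩⊑ {a} {D} (lin∈ fam i) a∈) b∈)
            (≤-reflexive (trans (size∈ fam i) (trans (cong (q′ ^_) k≡) (sym (trans (∣+⟨⟩∣ (⟨⟩-lin {a}) b∉) (cong (q′ *_) (∣⟨⟩∣ a≢0)))))))

          span⊑ : ∀ {W a b} → Lin W → W a ≡ true → W b ≡ true → ⟨ a ⟩ +⟨ b ⟩ ⊑ W
          span⊑ {W} {a} {b} L p r = +⟨⟩-least {⟨ a ⟩} {b} L (⟨⟩⊑ {a} {W} L p) r

          -- Pairwise meeting projective lines without a common point lie in a plane. Here `A` and
          -- `B` are distinct lines through `p`, and `C` is a line avoiding `p`; the plane is
          -- spanned by `C` and `p`. A line through `p` meets `C` elsewhere, and a line avoiding `p`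
          -- meets `A` and `B` in different points.
          coplanar : ∃ λ W → Lin W × ∣ W ∣ₛ ≡ q′ * Q × (∀ {D} → D ∈ Z → D ⊑ W)
          coplanar with member 1 k≡
          ... | A , A∈ , a , a≢0 , a∈A with avoid a a≢0
          ...   | B , B∈ , a∉B with common A∈ B∈
          ...     | p , p≢0 , p∈A , p∈B with avoid p p≢0
          ... | C , C∈ , p∉C = C +⟨ p ⟩ , LW , trans (∣+⟨⟩∣ (lin∈ fam C∈) p∉C) (cong (q′ *_) (size∈ fam C∈)) , λ {D} → all D
            where
            LW : Lin (C +⟨ p ⟩)
            LW = +⟨⟩-lin (lin∈ fam C∈)
            p∈W : (C +⟨ p ⟩) p ≡ true
            p∈W = ∈+⟨⟩ {C} {p} (lin∈ fam C∈)
            concurrent : ∀ {D} → D ∈ Z → D p ≡ true → D ⊑ C +⟨ p ⟩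
            concurrent {D} D∈ p∈D x x∈ with common D∈ C∈
            ... | u , u≢0 , u∈D , u∈C = span⊑ {C +⟨ p ⟩} {p} {u} LW p∈W (⊑+⟨⟩ {C} {p} u u∈C) x
                    (spanned {D} {p} {u} D∈ p≢0 p∈D u∈D (∉⟨⟩ {C} {p} {u} (lin∈ fam C∈) p∉C u≢0 u∈C) x x∈)
            all : ∀ D → D ∈ Z → D ⊑ C +⟨ p ⟩
            all D D∈ with D p in p?
            ... | true  = concurrent D∈ p?
            ... | false with common D∈ A∈ | common D∈ B∈
            ...   | u , u≢0 , u∈D , u∈A | v , v≢0 , v∈D , v∈B with B u in u?
            ... | false = λ x x∈ → span⊑ {C +⟨ p ⟩} {u} {v} LW (concurrent A∈ p∈A u u∈A) (concurrent B∈ p∈B v v∈B) x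
                        (spanned {D} {u} {v} D∈ u≢0 u∈D v∈D (∉⟨⟩ {B} {u} {v} (lin∈ fam B∈) u? v≢0 v∈B) x x∈)
            -- If `u` were also in `B`, then `A`, spanned by `p` and `u`, would lie in `B`, although
            -- `B` avoids `a`.
            ...     | true = contra (span⊑ {B} {p} {u} (lin∈ fam B∈) p∈B u? a
                        (spanned {A} {p} {u} A∈ p≢0 p∈A u∈A (∉⟨⟩ {D} {p} {u} (lin∈ fam D∈) p? u≢0 u∈D) a a∈A)) a∉B

          -- A nonzero vector orthogonal to the common plane lies in the complement of every member.
          no-lines : ¬ (∀ a → ¬ a ≡ zeroV → ∃ λ A → A ∈ Z × (A ᗮ) a ≡ false)
          no-lines coavoid = absurd coplanar
            where
            r : ∀ Q q → Q * (q * (q * 1ℤ)) ≡ q * Q * q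
            r = solve-∀
            ∣Wᗮ∣ : ∀ {W} → Lin W → ∣ W ∣ₛ ≡ q′ * Q → ∣ W ᗮ ∣ₛ ≡ q′
            ∣Wᗮ∣ {W} LW size = *-cancelˡ-≡′ (q′ * Q) (0<* 0<q 0<Q) (begin
              q′ * Q * ∣ W ᗮ ∣ₛ ≡⟨ cong (_* ∣ W ᗮ ∣ₛ) (sym size) ⟩
              ∣ W ∣ₛ * ∣ W ᗮ ∣ₛ ≡⟨ ᗮ-size LW ⟩
              N ≡⟨ N≡Q² ⟩
              Q * Q ≡⟨ cong (λ z → Q * q′ ^ z) k≡ ⟩
              Q * (q′ * (q′ * 1ℤ)) ≡⟨ r Q q′ ⟩
              q′ * Q * q′            ∎)
              where open ≡-Reasoning
            absurd : (∃ λ W → Lin W × ∣ W ∣ₛ ≡ q′ * Q × (∀ {D} → D ∈ Z → D ⊑ W)) → ⊥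
            absurd (W , LW , size , inside) =
              let a , a≢0 , a∈ = big⇒∃ {W ᗮ} (≤-reflexive (sym (∣Wᗮ∣ {W} LW size)))
                  A , A∈ , a∉  = coavoid a a≢0
              in contra (ᗮ⁺ A a (λ v v∈ → ᗮ⁻ W a a∈ (inside A∈ v v∈))) a∉

  -- From the hypotheses on the list to families and the bound.

  pairwise : ∀ {A : Set} {R : A → A → Set} {xs} → (∀ {x y} → R x y → R y x) → All (λ x → R x x) xs → AllPairs R xs →
    ∀ {x y} → x ∈ xs → y ∈ xs → R x y
  pairwise sy (r ∷ rs) (p ∷ ps) (here refl) (here refl) = r
  pairwise sy (r ∷ rs) (p ∷ ps) (here refl) (there j)   = All.lookup p j
  pairwise sy (r ∷ rs) (p ∷ ps) (there i)   (here refl) = sy (All.lookup p i)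
  pairwise sy (r ∷ rs) (p ∷ ps) (there i)   (there j)   = pairwise sy rs ps i j

  module Main {q : ℕ} (𝔽 : FiniteField q) (4≤q : + 4 ≤ + q) (k : ℕ) (Y : List (Geometry.Subset 𝔽 (k ℕ.+ k))) where
    open Geometry 𝔽 using (zeroV; IsSubspaceOfDim; MeetNontrivially; InDictator; InDualDictator; SameSet)
    open Space 𝔽
    open Subspaces 𝔽 4≤q (k ℕ.+ k)
    open Transform 𝔽 4≤q (k ℕ.+ k)
    open Counting 𝔽 4≤q (k ℕ.+ k)
    open Families 𝔽 4≤q k
    open Duality 𝔽 4≤q k
    open Gauss q

    module _ (j : ℕ) (k≡ : k ≡ suc j) (dims : All (λ U → IsSubspaceOfDim U k) Y)
      (distinct : AllPairs (λ U W → ¬ SameSet U W) Y) (meets : AllPairs MeetNontrivially Y)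
      (¬dictator : ¬ InDictator Y) (¬dual : ¬ InDualDictator Y) where

      private
        members : All (Above 𝟘 Q) Y
        members = All.map (λ d → above (dim⇒lin d) (𝟘⊑ (dim⇒lin d)) (dim⇒size d)) dims

        self : All (λ A → MeetNontrivially A A) Y
        self = All.map (λ {A} a → nontrivial A (Above.size a)) members
          where
          nontrivial : ∀ A → ∣ A ∣ₛ ≡ Q → MeetNontrivially A A
          nontrivial A size = let x , x≢0 , x∈ = big⇒∃ {A} (≤-trans (q≤q^ 𝔽 4≤q {k} j) (≤-reflexive (trans (cong (q′ ^_) (sym k≡)) (sym size))))
                              in x , x≢0 , x∈ , x∈

      family : Family Y
      family = record
        { members  = members
        ; distinct = distinct
        ; meet     = λ {A} {B} i j′ → big (Above.lin (All.lookup members i)) (Above.lin (All.lookup members j′))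
                       (pairwise (λ (x , x≢0 , a , b) → x , x≢0 , b , a) self meets i j′)
        ; avoid    = escape }
        where
        big : ∀ {A B} → Lin A → Lin B → MeetNontrivially A B → q′ ≤ ∣ A ⊓ₛ B ∣ₛ
        big L M (x , x≢0 , a , b) = ∃⇒big (⊓-lin L M) x≢0 (∧⁺ a b)
        escape : ∀ p → ¬ p ≡ zeroV → ∃ λ A → A ∈ Y × A p ≡ false
        escape p p≢0 with Any.any? (λ A → A p Bool.≟ false) Y
        ... | yes a = find a
        ... | no none = ⊥-elim (¬dictator (p , p≢0 , All.tabulate (λ {A} i → not-false (λ e → none (lose i e)))))

      -- A vector `a` in all complements would put every member into the hyperplane orthogonal to
      -- `a`. A dual dictator requires an explicit basis of that hyperplane, which `lin⇒dim`
      -- extracts from its cardinality.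
      coavoid : ∀ a → ¬ a ≡ zeroV → ∃ λ A → A ∈ Y × (A ᗮ) a ≡ false
      coavoid a a≢0 with Any.any? (λ A → (A ᗮ) a Bool.≟ false) Y
      ... | yes h = find h
      ... | no none = ⊥-elim (¬dual (⟨ a ⟩ ᗮ , lin⇒dim (ᗮ-lin {⟨ a ⟩}) size , All.tabulate (λ {A} i → inside A (not-false (λ e → none (lose i e))))))
        where
        inside : ∀ A → (A ᗮ) a ≡ true → A ⊑ ⟨ a ⟩ ᗮ
        inside A a∈ v v∈ = ᗮ⁺ ⟨ a ⟩ v (λ u u∈ → trans (⟪⟫-sym v u) (ᗮ⁻ A u (⟨⟩⊑ {a} {A ᗮ} (ᗮ-lin {A}) a∈ u u∈) v∈))
        size : ∣ ⟨ a ⟩ ᗮ ∣ₛ ≡ q′ ^ (k ℕ.+ k ℕ.∸ 1)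
        size = *-cancelˡ-≡′ q′ 0<q (trans (cong (_* ∣ ⟨ a ⟩ ᗮ ∣ₛ) (sym (trans (∣⟨⟩∣ a≢0) (*-identityʳ q′)))) (trans (ᗮ-size (⟨⟩-lin {a}))
          (cong (λ z → q′ ^ z) (predecessor k≡))))
          where predecessor : ∀ {k} → k ≡ suc j → k ℕ.+ k ≡ suc (k ℕ.+ k ℕ.∸ 1)
                predecessor refl = refl

      -- The case split lets the truncated subtraction in gaussℤ be evaluated.
      bounded : length Y ℕ.< 3 ℕ.* gauss q k 1 ℕ.* gaussℤ q (k ℕ.+ k ℕ.∸ 2) (+ k - + 2)
      bounded = split k refl
        where
        split : ∀ k′ → k ≡ k′ → length Y ℕ.< 3 ℕ.* gauss q k′ 1 ℕ.* gaussℤ q (k′ ℕ.+ k′ ℕ.∸ 2) (+ k′ - + 2)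
        split 0 e with trans (sym k≡) e
        ... | ()
        -- For k = 1 the right-hand side is 0, so no strict bound could hold: here, as for k = 2,
        -- the hypotheses contradict one another.
        split 1 e = ⊥-elim (no-points 𝔽 4≤q {k} family e)
        split 2 e = ⊥-elim (no-lines 𝔽 4≤q {k} family e coavoid)
        split (suc (suc (suc i))) e with length Y ℕ.<? 3 ℕ.* gauss q (3 ℕ.+ i) 1 ℕ.* gauss q (suc (i ℕ.+ (3 ℕ.+ i))) (suc i)
        ... | yes h = h
        ... | no ¬h = ⊥-elim (no-large-family 𝔽 4≤q i e family (dual-family family coavoid) large)
          where
          open ≤-Reasoning
          g₁ g₂ : ℤ
          g₁ = G (3 ℕ.+ i) 1
          g₂ = G (suc (i ℕ.+ (3 ℕ.+ i))) (suc i)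
          r₁ : ∀ q g → (q * 1ℤ - 1ℤ) * g ≡ (q - 1ℤ) * g
          r₁ = solve-∀
          r₂ : ∀ q a b → + 3 * ((q - 1ℤ) * a * b) ≡ (q - 1ℤ) * (+ 3 * a * b)
          r₂ = solve-∀
          Q-1 : Q - 1ℤ ≡ (q′ - 1ℤ) * g₁
          Q-1 = trans (cong (λ z → q′ ^ z - 1ℤ) e) (trans (sym (*-identityʳ _)) (trans (sym (G-step (2 ℕ.+ i) 0)) (r₁ q′ g₁)))
          n₂≡ : G (k ℕ.+ suc i) (suc i) ≡ g₂
          n₂≡ = cong (λ z → G z (suc i)) (trans (cong (ℕ._+ suc i) e) (trans (ℕ.+-suc (3 ℕ.+ i) i) (cong suc (ℕ.+-comm (3 ℕ.+ i) i))))
          large : + 3 * ((Q - 1ℤ) * G (k ℕ.+ suc i) (suc i)) ≤ (q′ - 1ℤ) * ∑ Y (λ _ → 1ℤ)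
          large = begin
            + 3 * ((Q - 1ℤ) * G (k ℕ.+ suc i) (suc i)) ≡⟨ cong₂ (λ a b → + 3 * (a * b)) Q-1 n₂≡ ⟩
            + 3 * ((q′ - 1ℤ) * g₁ * g₂) ≡⟨ r₂ q′ g₁ g₂ ⟩
            (q′ - 1ℤ) * (+ 3 * g₁ * g₂) ≡⟨ cong ((q′ - 1ℤ) *_) (sym (trans (pos-* (3 ℕ.* gauss q (3 ℕ.+ i) 1) _) (cong (_* g₂) (pos-* 3 (gauss q (3 ℕ.+ i) 1))))) ⟩
            (q′ - 1ℤ) * + (3 ℕ.* gauss q (3 ℕ.+ i) 1 ℕ.* gauss q (suc (i ℕ.+ (3 ℕ.+ i))) (suc i))
            ≤⟨ *-monoˡ (q′ - 1ℤ) (<⇒≤ 0<q-1) (+≤+ (ℕ.≮⇒≥ ¬h)) ⟩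
            (q′ - 1ℤ) * + length Y ≡⟨ cong ((q′ - 1ℤ) *_) (sym (trans (∑-const Y 1ℤ) (*-identityʳ _))) ⟩
            (q′ - 1ℤ) * ∑ Y (λ _ → 1ℤ)                           ∎

open import Data.Nat using (ℕ; suc; _+_; _*_; _∸_; _<_; _≥_)
open import Data.Integer using (+_)
open import Data.Integer as ℤ using ()
open import Data.List using (List; length)
open import Data.List.Relation.Unary.All using (All)
open import Data.List.Relation.Unary.AllPairs using (AllPairs)
open import Relation.Nullary using (¬_)
open import Relation.Binary.PropositionalEquality using (refl)

theorem6 : (q : ℕ) → IsPrimePower q → q ≥ 4 → (𝔽 : FiniteField q) → (k : ℕ) → k ≥ 1 →
    (Y : List (Geometry.Subset 𝔽 (k + k))) →
    All (λ U → Geometry.IsSubspaceOfDim 𝔽 U k) Y →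
    AllPairs (λ U W → ¬ Geometry.SameSet 𝔽 U W) Y →
    AllPairs (Geometry.MeetNontrivially 𝔽) Y →
    ¬ Geometry.InDictator 𝔽 Y →
    ¬ Geometry.InDualDictator 𝔽 Y →
    length Y < 3 * gauss q k 1 * gaussℤ q (k + k ∸ 2) (+ k ℤ.- + 2)
theorem6 q _ 4≤q 𝔽 (suc j) _ Y dims distinct meets ¬dictator ¬dual =
  Proof.Main.bounded 𝔽 (ℤ.+≤+ 4≤q) (suc j) Y j refl dims distinct meets ¬dictator ¬dual
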